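{- Let $\mathtt{P}$ and $\mathtt{Q}$ be finite $\pi$-calculus processes and let $\bar n$ be the list of free names of $\mathtt{P}$ and $\mathtt{Q}$. Then $\mathtt{P}\sim_l\mathtt{Q}$ (strong late bisimilarity) if and only if, for some finite subset $\mathcal{X}\subseteq\mathcal{E}$, the sequent $\mathcal{X}\vdash\nabla\bar n.\,\mathrm{lbisim}\,[\![\mathtt{P}]\!]\,[\![\mathtt{Q}]\!]$ (empty global signature) is provable in $FO\lambda^{\Delta\nabla}$ with the definition consisting of the clauses $\mathbf{D}_\pi$ and the clause for $\mathrm{lbisim}$ given in the context.
   Context: Finite $\pi$-calculus: processes $\mathtt{P}::=0\mid\bar xy.\mathtt{P}\mid x(y).\mathtt{P}\mid\tau.\mathtt{P}\mid(x)\mathtt{P}\mid[x=y]\mathtt{P}\mid\mathtt{P}|\mathtt{P}\mid\mathtt{P}+\mathtt{P}$, with $y$ bound in $x(y).\mathtt{P}$ and $(y)\mathtt{P}$, identified up to $\alpha$-conversion; $\mathrm{fn},\mathrm{bn},\mathrm{n}$ denote free, bound, all names. Actions: $\tau$, free input $xy$, free output $\bar xy$, bound input $x(y)$, bound output $\bar x(y)$ ($y$ bound); free actions are those with no bound name. $\mathtt{P}\xrightarrow{\alpha}\mathtt{Q}$ is the standard late transition relation of Milner–Parrow–Walker. A symmetric relation $\mathcal{R}$ is a strong late bisimulation if whenever $\mathtt{P}\,\mathcal{R}\,\mathtt{Q}$: (1) if $\mathtt{P}\xrightarrow{\alpha}\mathtt{P}'$ with $\alpha$ free then $\mathtt{Q}\xrightarrow{\alpha}\mathtt{Q}'$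 for some $\mathtt{Q}'$ with $\mathtt{P}'\mathcal{R}\mathtt{Q}'$; (2) if $\mathtt{P}\xrightarrow{x(z)}\mathtt{P}'$, $z\notin\mathrm{n}(\mathtt{P},\mathtt{Q})$, then there is $\mathtt{Q}'$ with $\mathtt{Q}\xrightarrow{x(z)}\mathtt{Q}'$ and for every name $y$, $\mathtt{P}'[y/z]\,\mathcal{R}\,\mathtt{Q}'[y/z]$; (3) if $\mathtt{P}\xrightarrow{\bar x(z)}\mathtt{P}'$, $z\notin\mathrm{n}(\mathtt{P},\mathtt{Q})$, then there is $\mathtt{Q}'$ with $\mathtt{Q}\xrightarrow{\bar x(z)}\mathtt{Q}'$ and $\mathtt{P}'\mathcal{R}\mathtt{Q}'$. $\sim_l$ is the union of all strong late bisimulations. The logic $FO\lambda^{\Delta\nabla}$ (Miller–Tiu): intuitionistic sequent calculus over simply typed $\lambda$-terms (modulo $\beta\eta$; formulas have type $o$; quantifiers range only over types not containing $o$) with $\top,\bot,\land,\lor,\supset$ ($\neg B:=B\supset\bot$) and quantifiers $\forall,\exists,\nabla$. Sequents are $\Sigma;\sigma_1\triangleright B_1,\dots,\sigma_m\triangleright B_m\vdash\sigma_0\triangleright B_0$ with $\Sigma$ a set of global eigenvariables and each $\sigma_i$ a list of locally scoped variables. The $\nabla$ rules (left and right) replace $\sigma\triangleright\nabla x.B$ by $(\sigma,y)\triangleright B[y/x]$, $y$ fresh; $\forall$R and $\exists$L replace $x$ by $h\,\sigma$ for a fresh eigenvariable $h$ (raising); $\forall$L and $\exists$R instantiate with any term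 over $\Sigma\cup\sigma$; the other rules (init, cut, contraction, weakening, propositional rules) are those of LJ lifted to judgments $\sigma\triangleright B$. A definition is a set of stratified clauses $\forall\bar x[p\,\bar t\triangleq B]$ (closed under raising over local signatures); rule defR replaces an atom on the right by the corresponding instance of a clause body; rule defL replaces an atom $\mathcal{A}$ on the left by the set of premises, one for each clause head $\mathcal{H}$ and each $\theta$ in a complete set of unifiers of $\mathcal{A}$ and $\mathcal{H}$, where $\theta$ is applied to the whole sequent and the atom is replaced by the body instance (no premises if no clause unifies). Equality is defined by $\forall x[x=x\triangleq\top]$; $s\neq t$ abbreviates $(s=t)\supset\bot$. Encoding: types $n$ (names; no constants), $p$ (processes), $a$ (actions). Constructors $\tau:a$, $\downarrow,\uparrow:n\to n\to a$; $0:p$, $\tau:p\to p$, $\mathrm{out}:n\to n\to p\to p$, $\mathrm{in}:n\to(n\to p)\to p$, $+,|:p\to p\to p$, $\mathrm{match}:n\to n\to p\to p$, $\nu:(n\to p)\to p$. Translation: $[\![0]\!]=0$, $[\![\mathtt{P}+\mathtt{Q}]\!]=[\![\mathtt{P}]\!]+[\![\mathtt{Q}]\!]$, $[\![\mathtt{P}|\mathtt{Q}]\!]=[\![\mathtt{P}]\!]|[\![\mathtt{Q}]\!]$, $[\![\tau.\mathtt{P}]\!]=\tau[\![\mathtt{P}]\!]$, $[\![[x=y]\mathtt{P}]\!]=\mathrm{match}\,x\,y\,[\![\mathtt{P}]\!]$, $[\![\bar xy.\mathtt{P}]\!]=\mathrm{out}\,x\,y\,[\![\mathtt{P}]\!]$,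 $[\![x(y).\mathtt{P}]\!]=\mathrm{in}\,x\,(\lambda y.[\![\mathtt{P}]\!])$, $[\![(x)\mathtt{P}]\!]=\nu(\lambda x.[\![\mathtt{P}]\!])$; names become variables of type $n$. Predicates $\mathrm{one}:p\to a\to p\to o$ and $\mathrm{onep}:p\to(n\to a)\to(n\to p)\to o$. $\mathbf{D}_\pi$ consists of the clauses (free variables universally quantified): $\mathrm{one}(\tau P)\tau P\triangleq\top$; $\mathrm{onep}(\mathrm{in}\,X\,M)(\downarrow X)M\triangleq\top$; $\mathrm{one}(\mathrm{out}\,x\,y\,P)(\uparrow x\,y)P\triangleq\top$; $\mathrm{one}(\mathrm{match}\,x\,x\,P)A\,Q\triangleq\mathrm{one}\,P\,A\,Q$; $\mathrm{onep}(\mathrm{match}\,x\,x\,P)A\,Q\triangleq\mathrm{onep}\,P\,A\,Q$; $\mathrm{one}(P+Q)A\,R\triangleq\mathrm{one}\,P\,A\,R$; $\mathrm{one}(P+Q)A\,R\triangleq\mathrm{one}\,Q\,A\,R$; the same two for $\mathrm{onep}$; $\mathrm{one}(P|Q)A(P'|Q)\triangleq\mathrm{one}\,P\,A\,P'$; $\mathrm{one}(P|Q)A(P|Q')\triangleq\mathrm{one}\,Q\,A\,Q'$; $\mathrm{onep}(P|Q)A(\lambda n.(M\,n|Q))\triangleq\mathrm{onep}\,P\,A\,M$; $\mathrm{onep}(P|Q)A(\lambda n.(P|N\,n))\triangleq\mathrm{onep}\,Q\,A\,N$; $\mathrm{one}(\nu\lambda n.P\,n)A(\nu\lambda n.Q\,n)\triangleq\nabla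 n.\mathrm{one}(P\,n)A(Q\,n)$; $\mathrm{onep}(\nu\lambda n.P\,n)A(\lambda m.\nu\lambda n.P'\,n\,m)\triangleq\nabla n.\mathrm{onep}(P\,n)A(P'\,n)$; $\mathrm{onep}(\nu\lambda n.M\,n)(\uparrow X)M'\triangleq\nabla n.\mathrm{one}(M\,n)(\uparrow X\,n)(M'\,n)$; $\mathrm{one}(P|Q)\tau(\nu\lambda n.(M\,n|N\,n))\triangleq\exists X.\mathrm{onep}\,P(\downarrow X)M\land\mathrm{onep}\,Q(\uparrow X)N$; $\mathrm{one}(P|Q)\tau(\nu\lambda n.(M\,n|N\,n))\triangleq\exists X.\mathrm{onep}\,P(\uparrow X)M\land\mathrm{onep}\,Q(\downarrow X)N$; $\mathrm{one}(P|Q)\tau(M\,Y|Q')\triangleq\exists X.\mathrm{onep}\,P(\downarrow X)M\land\mathrm{one}\,Q(\uparrow X\,Y)Q'$; $\mathrm{one}(P|Q)\tau(P'|N\,Y)\triangleq\exists X.\mathrm{one}\,P(\uparrow X\,Y)P'\land\mathrm{onep}\,Q(\downarrow X)N$. The clause for $\mathrm{lbisim}:p\to p\to o$ is $\mathrm{lbisim}\,P\,Q\triangleq$ the conjunction of: $\forall A\forall P'[\mathrm{one}\,P\,A\,P'\supset\exists Q'.\mathrm{one}\,Q\,A\,Q'\land\mathrm{lbisim}\,P'\,Q']$; $\forall A\forall Q'[\mathrm{one}\,Q\,A\,Q'\supset\exists P'.\mathrm{one}\,P\,A\,P'\land\mathrm{lbisim}\,Q'\,P']$; $\forall X\forall P'[\mathrm{onep}\,P(\downarrow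 X)P'\supset\exists Q'.\mathrm{onep}\,Q(\downarrow X)Q'\land\forall w.\mathrm{lbisim}(P'w)(Q'w)]$; $\forall X\forall Q'[\mathrm{onep}\,Q(\downarrow X)Q'\supset\exists P'.\mathrm{onep}\,P(\downarrow X)P'\land\forall w.\mathrm{lbisim}(Q'w)(P'w)]$; $\forall X\forall P'[\mathrm{onep}\,P(\uparrow X)P'\supset\exists Q'.\mathrm{onep}\,Q(\uparrow X)Q'\land\nabla w.\mathrm{lbisim}(P'w)(Q'w)]$; $\forall X\forall Q'[\mathrm{onep}\,Q(\uparrow X)Q'\supset\exists P'.\mathrm{onep}\,P(\uparrow X)P'\land\nabla w.\mathrm{lbisim}(Q'w)(P'w)]$. $\mathcal{E}=\{\nabla n_1\cdots\nabla n_k\forall x\forall y(x=y\lor x\neq y)\mid k\ge0\}$ (quantified variables of type $n$). -}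

module Defs where

open import Data.Nat using (ℕ; zero; suc; _≟_; _≡ᵇ_)
open import Data.Bool using (Bool; true; false; if_then_else_)
open import Data.Fin using (Fin; zero; suc)
open import Data.List using (List; []; _∷_; _++_; map; deduplicate; replicate)
open import Data.List.Membership.Propositional using (_∈_; _∉_)
open import Data.List.Relation.Unary.All as All using (All; []; _∷_)
open import Data.List.Relation.Binary.Permutation.Propositional using (_↭_)
open import Data.Maybe using (Maybe; just; nothing; _>>=_)
import Data.Maybe as Maybe
open import Data.Product using (Σ; _,_; _×_; ∃)
open import Data.Empty using (⊥)
open import Data.Unit using (⊤)
open import Relation.Binary.PropositionalEquality using (_≡_; _≢_)

-- PART I.  The finite π-calculus (locally nameless: free names are
-- atoms ℕ, bound names are well-scoped de Bruijn indices, so a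
-- closed term  Proc 0  is exactly an α-equivalence class of processes).

data Nm (k : ℕ) : Set where
  fr : ℕ → Nm k
  bd : Fin k → Nm k

data Proc (k : ℕ) : Set where
  nil  : Proc k
  out  : Nm k → Nm k → Proc k → Proc k
  inp  : Nm k → Proc (suc k) → Proc k
  tau  : Proc k → Proc k
  res  : Proc (suc k) → Proc k
  mat  : Nm k → Nm k → Proc k → Proc k
  par  : Proc k → Proc k → Proc k
  sum  : Proc k → Proc k → Proc k

wkNm : ∀ {m} → Nm m → Nm (suc m)
wkNm (fr a) = fr a
wkNm (bd i) = bd (suc i)

liftNm : ∀ {k m} → (Nm k → Nm m) → Nm (suc k) → Nm (suc m)
liftNm f (fr a)       = wkNm (f (fr a))
liftNm f (bd zero)    = bd zero
liftNm f (bd (suc i)) = wkNm (f (bd i))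

mapP : ∀ {k m} → (Nm k → Nm m) → Proc k → Proc m
mapP f nil         = nil
mapP f (out x y P) = out (f x) (f y) (mapP f P)
mapP f (inp x P)   = inp (f x) (mapP (liftNm f) P)
mapP f (tau P)     = tau (mapP f P)
mapP f (res P)     = res (mapP (liftNm f) P)
mapP f (mat x y P) = mat (f x) (f y) (mapP f P)
mapP f (par P Q)   = par (mapP f P) (mapP f Q)
mapP f (sum P Q)   = sum (mapP f P) (mapP f Q)

fnNm : ∀ {k} → Nm k → List ℕ
fnNm (fr a) = a ∷ []
fnNm (bd i) = []

fn : ∀ {k} → Proc k → List ℕ
fn nil         = []
fn (out x y P) = fnNm x ++ fnNm y ++ fn P
fn (inp x P)   = fnNm x ++ fn P
fn (tau P)     = fn P
fn (res P)     = fn P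
fn (mat x y P) = fnNm x ++ fnNm y ++ fn P
fn (par P Q)   = fn P ++ fn Q
fn (sum P Q)   = fn P ++ fn Q

openNm : ∀ {k} → ℕ → Nm (suc k) → Nm k
openNm w (fr a)       = fr a
openNm w (bd zero)    = fr w
openNm w (bd (suc i)) = bd i

openP : ∀ {k} → ℕ → Proc (suc k) → Proc k
openP w = mapP (openNm w)

closeNm : ∀ {k} → ℕ → Nm k → Nm (suc k)
closeNm w (fr a) = if a ≡ᵇ w then bd zero else fr a
closeNm w (bd i) = bd (suc i)

closeP : ∀ {k} → ℕ → Proc k → Proc (suc k)
closeP w = mapP (closeNm w)

renNm : ∀ {k} → ℕ → ℕ → Nm k → Nm k
renNm y z (fr a) = if a ≡ᵇ z then fr y else fr a
renNm y z (bd i) = bd i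

_[_/_] : Proc 0 → ℕ → ℕ → Proc 0
P [ y / z ] = mapP (renNm y z) P

data Act : Set where
  τ    : Act
  fin  : ℕ → ℕ → Act
  fout : ℕ → ℕ → Act
  bin  : ℕ → ℕ → Act
  bout : ℕ → ℕ → Act

FreeAct : Act → Set
FreeAct τ          = ⊤
FreeAct (fin _ _)  = ⊤
FreeAct (fout _ _) = ⊤
FreeAct (bin _ _)  = ⊥
FreeAct (bout _ _) = ⊥

nAct : Act → List ℕ
nAct τ          = []
nAct (fin x y)  = x ∷ y ∷ []
nAct (fout x y) = x ∷ y ∷ []
nAct (bin x y)  = x ∷ y ∷ []
nAct (bout x y) = x ∷ y ∷ []

bnAct : Act → List ℕ
bnAct (bin x y)  = y ∷ []
bnAct (bout x y) = y ∷ []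
bnAct _          = []

BnFresh : Act → Proc 0 → Set
BnFresh α Q = ∀ {w} → w ∈ bnAct α → w ∉ fn Q

-- The late transition relation of Milner–Parrow–Walker (on α-classes).
infix 4 _─_⟶_
data _─_⟶_ : Proc 0 → Act → Proc 0 → Set where
  TAU   : ∀ {P} → tau P ─ τ ⟶ P
  OUT   : ∀ {x y P} → out (fr x) (fr y) P ─ fout x y ⟶ P
  IN    : ∀ {x w B} → w ∉ fn B → inp (fr x) B ─ bin x w ⟶ openP w B
  SUML  : ∀ {P Q α P'} → P ─ α ⟶ P' → sum P Q ─ α ⟶ P'
  SUMR  : ∀ {P Q α Q'} → Q ─ α ⟶ Q' → sum P Q ─ α ⟶ Q'
  MATCH : ∀ {x P α P'} → P ─ α ⟶ P' → mat (fr x) (fr x) P ─ α ⟶ P'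
  PARL  : ∀ {P Q α P'} → P ─ α ⟶ P' → BnFresh α Q → par P Q ─ α ⟶ par P' Q
  PARR  : ∀ {P Q α Q'} → Q ─ α ⟶ Q' → BnFresh α P → par P Q ─ α ⟶ par P Q'
  COML  : ∀ {P Q P' Q' x y z} → P ─ fout x y ⟶ P' → Q ─ bin x z ⟶ Q' →
          par P Q ─ τ ⟶ par P' (Q' [ y / z ])
  COMR  : ∀ {P Q P' Q' x y z} → P ─ bin x z ⟶ P' → Q ─ fout x y ⟶ Q' →
          par P Q ─ τ ⟶ par (P' [ y / z ]) Q'
  CLOSEL : ∀ {P Q P' Q' x w} → P ─ bout x w ⟶ P' → Q ─ bin x w ⟶ Q' →
          par P Q ─ τ ⟶ res (closeP w (par P' Q'))
  CLOSER : ∀ {P Q P' Q' x w} → P ─ bin x w ⟶ P' → Q ─ bout x w ⟶ Q' →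
          par P Q ─ τ ⟶ res (closeP w (par P' Q'))
  RES   : ∀ {B y α P'} → y ∉ fn B → openP y B ─ α ⟶ P' → y ∉ nAct α →
          res B ─ α ⟶ res (closeP y P')
  OPEN  : ∀ {B x y w P'} → y ∉ fn B → openP y B ─ fout x y ⟶ P' → y ≢ x →
          w ∉ fn (res (closeP y P')) →
          res B ─ bout x w ⟶ P' [ w / y ]

-- n(P,Q): on α-classes the names of a process that cannot be renamed
-- away are its free names.
_∉fn_,_ : ℕ → Proc 0 → Proc 0 → Set
z ∉fn P , Q = z ∉ fn P × z ∉ fn Q

record IsLateBisim (R : Proc 0 → Proc 0 → Set) : Set where
  field
    symm : ∀ {P Q} → R P Q → R Q P
    free : ∀ {P Q α P'} → R P Q → FreeAct α → P ─ α ⟶ P' →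
           ∃ λ Q' → (Q ─ α ⟶ Q') × R P' Q'
    binp : ∀ {P Q x z P'} → R P Q → P ─ bin x z ⟶ P' → z ∉fn P , Q →
           ∃ λ Q' → (Q ─ bin x z ⟶ Q') × (∀ y → R (P' [ y / z ]) (Q' [ y / z ]))
    boutp : ∀ {P Q x z P'} → R P Q → P ─ bout x z ⟶ P' → z ∉fn P , Q →
           ∃ λ Q' → (Q ─ bout x z ⟶ Q') × R P' Q'

_∼l_ : Proc 0 → Proc 0 → Set₁
P ∼l Q = Σ (Proc 0 → Proc 0 → Set) λ R → IsLateBisim R × R P Q

-- base types n, p, a (no type o: quantifiers never range over o)
data Ty : Set where
  nm pr ac : Ty
  _⇒_ : Ty → Ty → Ty
infixr 5 _⇒_

Ctx : Set
Ctx = List Ty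

data Var : Ctx → Ty → Set where
  vz : ∀ {Γ t} → Var (t ∷ Γ) t
  vs : ∀ {Γ s t} → Var Γ t → Var (s ∷ Γ) t

data Const : Ty → Set where
  τA     : Const ac
  ↓C ↑C  : Const (nm ⇒ nm ⇒ ac)
  zeroC  : Const pr
  τC     : Const (pr ⇒ pr)
  outC   : Const (nm ⇒ nm ⇒ pr ⇒ pr)
  inC    : Const (nm ⇒ (nm ⇒ pr) ⇒ pr)
  plusC  : Const (pr ⇒ pr ⇒ pr)
  parC   : Const (pr ⇒ pr ⇒ pr)
  matchC : Const (nm ⇒ nm ⇒ pr ⇒ pr)
  nuC    : Const ((nm ⇒ pr) ⇒ pr)

data Tm (Γ : Ctx) : Ty → Set where
  var : ∀ {t} → Var Γ t → Tm Γ t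
  con : ∀ {t} → Const t → Tm Γ t
  app : ∀ {s t} → Tm Γ (s ⇒ t) → Tm Γ s → Tm Γ t
  lam : ∀ {s t} → Tm (s ∷ Γ) t → Tm Γ (s ⇒ t)

Ren : Ctx → Ctx → Set
Ren Γ Δ = ∀ {t} → Var Γ t → Var Δ t

Sub : Ctx → Ctx → Set
Sub Γ Δ = ∀ {t} → Var Γ t → Tm Δ t

liftR : ∀ {Γ Δ s} → Ren Γ Δ → Ren (s ∷ Γ) (s ∷ Δ)
liftR ρ vz     = vz
liftR ρ (vs x) = vs (ρ x)

ren : ∀ {Γ Δ t} → Ren Γ Δ → Tm Γ t → Tm Δ t
ren ρ (var x)   = var (ρ x)
ren ρ (con c)   = con c
ren ρ (app M N) = app (ren ρ M) (ren ρ N)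
ren ρ (lam M)   = lam (ren (liftR ρ) M)

liftS : ∀ {Γ Δ s} → Sub Γ Δ → Sub (s ∷ Γ) (s ∷ Δ)
liftS θ vz     = var vz
liftS θ (vs x) = ren vs (θ x)

sub : ∀ {Γ Δ t} → Sub Γ Δ → Tm Γ t → Tm Δ t
sub θ (var x)   = θ x
sub θ (con c)   = con c
sub θ (app M N) = app (sub θ M) (sub θ N)
sub θ (lam M)   = lam (sub (liftS θ) M)

sub1 : ∀ {Γ s} → Tm Γ s → Sub (s ∷ Γ) Γ
sub1 N vz     = N
sub1 N (vs x) = var x

infix 4 _≈_
data _≈_ : ∀ {Γ t} → Tm Γ t → Tm Γ t → Set where
  β      : ∀ {Γ s t} {M : Tm (s ∷ Γ) t} {N : Tm Γ s} → app (lam M) N ≈ sub (sub1 N) M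
  η      : ∀ {Γ s t} {M : Tm Γ (s ⇒ t)} → M ≈ lam (app (ren vs M) (var vz))
  ≈refl  : ∀ {Γ t} {M : Tm Γ t} → M ≈ M
  ≈sym   : ∀ {Γ t} {M N : Tm Γ t} → M ≈ N → N ≈ M
  ≈trans : ∀ {Γ t} {M N L : Tm Γ t} → M ≈ N → N ≈ L → M ≈ L
  appc   : ∀ {Γ s t} {M M' : Tm Γ (s ⇒ t)} {N N' : Tm Γ s} → M ≈ M' → N ≈ N' → app M N ≈ app M' N'
  lamc   : ∀ {Γ s t} {M M' : Tm (s ∷ Γ) t} → M ≈ M' → lam M ≈ lam M'

data Pred : Set where
  one onep lbisim : Pred
  eq : Ty → Pred

arity : Pred → List Ty
arity one    = pr ∷ ac ∷ pr ∷ []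
arity onep   = pr ∷ (nm ⇒ ac) ∷ (nm ⇒ pr) ∷ []
arity lbisim = pr ∷ pr ∷ []
arity (eq t) = t ∷ t ∷ []

infixr 6 _∧'_
infixr 5 _∨'_
infixr 4 _⊃'_

data Fm (Γ : Ctx) : Set where
  atom : (q : Pred) → All (Tm Γ) (arity q) → Fm Γ
  ⊤' ⊥' : Fm Γ
  _∧'_ _∨'_ _⊃'_ : Fm Γ → Fm Γ → Fm Γ
  ∀' ∃' ∇' : (t : Ty) → Fm (t ∷ Γ) → Fm Γ

renF : ∀ {Γ Δ} → Ren Γ Δ → Fm Γ → Fm Δ
renF ρ (atom q ts) = atom q (All.map (ren ρ) ts)
renF ρ ⊤'         = ⊤'
renF ρ ⊥'         = ⊥'
renF ρ (A ∧' B)   = renF ρ A ∧' renF ρ B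
renF ρ (A ∨' B)   = renF ρ A ∨' renF ρ B
renF ρ (A ⊃' B)   = renF ρ A ⊃' renF ρ B
renF ρ (∀' t B)   = ∀' t (renF (liftR ρ) B)
renF ρ (∃' t B)   = ∃' t (renF (liftR ρ) B)
renF ρ (∇' t B)   = ∇' t (renF (liftR ρ) B)

subF : ∀ {Γ Δ} → Sub Γ Δ → Fm Γ → Fm Δ
subF θ (atom q ts) = atom q (All.map (sub θ) ts)
subF θ ⊤'         = ⊤'
subF θ ⊥'         = ⊥'
subF θ (A ∧' B)   = subF θ A ∧' subF θ B
subF θ (A ∨' B)   = subF θ A ∨' subF θ B
subF θ (A ⊃' B)   = subF θ A ⊃' subF θ B
subF θ (∀' t B)   = ∀' t (subF (liftS θ) B)
subF θ (∃' t B)   = ∃' t (subF (liftS θ) B)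
subF θ (∇' t B)   = ∇' t (subF (liftS θ) B)

data ArgsEq : ∀ {Γ ts} → All (Tm Γ) ts → All (Tm Γ) ts → Set where
  []  : ∀ {Γ} → ArgsEq {Γ} [] []
  _∷_ : ∀ {Γ t ts} {M N : Tm Γ t} {ms ns : All (Tm Γ) ts} →
        M ≈ N → ArgsEq ms ns → ArgsEq (M ∷ ms) (N ∷ ns)

infix 4 _≈F_
data _≈F_ : ∀ {Γ} → Fm Γ → Fm Γ → Set where
  atomc : ∀ {Γ q} {ts us : All (Tm Γ) (arity q)} → ArgsEq ts us → atom q ts ≈F atom q us
  ⊤c : ∀ {Γ} → ⊤' {Γ} ≈F ⊤'
  ⊥c : ∀ {Γ} → ⊥' {Γ} ≈F ⊥'
  ∧c : ∀ {Γ} {A A' B B' : Fm Γ} → A ≈F A' → B ≈F B' → (A ∧' B) ≈F (A' ∧' B')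
  ∨c : ∀ {Γ} {A A' B B' : Fm Γ} → A ≈F A' → B ≈F B' → (A ∨' B) ≈F (A' ∨' B')
  ⊃c : ∀ {Γ} {A A' B B' : Fm Γ} → A ≈F A' → B ≈F B' → (A ⊃' B) ≈F (A' ⊃' B')
  ∀c : ∀ {Γ t} {B B' : Fm (t ∷ Γ)} → B ≈F B' → ∀' t B ≈F ∀' t B'
  ∃c : ∀ {Γ t} {B B' : Fm (t ∷ Γ)} → B ≈F B' → ∃' t B ≈F ∃' t B'
  ∇c : ∀ {Γ t} {B B' : Fm (t ∷ Γ)} → B ≈F B' → ∇' t B ≈F ∇' t B'

-- a generic judgment σ ▷ B over the global signature G:
-- σ is the local signature (innermost variable first); B is over σ ++ G
Judg : Ctx → Set
Judg G = Σ Ctx λ σ → Fm (σ ++ G)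

underR : ∀ {G G'} (σ : Ctx) → Ren G G' → Ren (σ ++ G) (σ ++ G')
underR []      ρ = ρ
underR (s ∷ σ) ρ = liftR (underR σ ρ)

underS : ∀ {G G'} (σ : Ctx) → Sub G G' → Sub (σ ++ G) (σ ++ G')
underS []      θ = θ
underS (s ∷ σ) θ = liftS (underS σ θ)

renJ : ∀ {G G'} → Ren G G' → Judg G → Judg G'
renJ ρ (σ , B) = σ , renF (underR σ ρ) B

subJ : ∀ {G G'} → Sub G G' → Judg G → Judg G'
subJ θ (σ , B) = σ , subF (underS σ θ) B

-- raising: the type of an eigenvariable h standing for a term over σ
raiseTy : Ctx → Ty → Ty
raiseTy []      t = t
raiseTy (s ∷ σ) t = s ⇒ raiseTy σ t

appAll : ∀ {Δ t} (σ : Ctx) → Tm Δ (raiseTy σ t) → All (Tm Δ) σ → Tm Δ t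
appAll []      M []       = M
appAll (s ∷ σ) M (N ∷ Ns) = appAll σ (app M N) Ns

locals : ∀ {Δ} (σ : Ctx) → All (Tm (σ ++ Δ)) σ
locals []      = []
locals (s ∷ σ) = var vz ∷ All.map (ren vs) (locals σ)

hVar : ∀ {G u} (σ : Ctx) → Var (σ ++ (u ∷ G)) u
hVar []      = vz
hVar (s ∷ σ) = vs (hVar σ)

raiseSub : ∀ {G t} (σ : Ctx) → Sub (t ∷ (σ ++ G)) (σ ++ (raiseTy σ t ∷ G))
raiseSub σ vz     = appAll σ (var (hVar σ)) (locals σ)
raiseSub σ (vs x) = var (underR σ vs x)

record Clause : Set where
  constructor clause
  field
    cvars : Ctx
    cpred : Pred
    chead : All (Tm cvars) (arity cpred)
    cbody : Fm cvars
open Clause public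

-- a unifier of the left atom  σ ▷ q ts  (eigenvariables of G are logic
-- variables) with the head of clause c (clause variables raised over σ)
record Unifier (G σ : Ctx) (q : Pred) (ts : All (Tm (σ ++ G)) (arity q)) (c : Clause) : Set where
  field
    G' : Ctx
    ρ  : Sub G G'
    θ  : Sub (cvars c) (σ ++ G')
    unifies : atom q (All.map (sub (underS σ ρ)) ts) ≈F atom (cpred c) (All.map (sub θ) (chead c))
open Unifier public

MoreGeneral : ∀ {G σ q ts c} → Unifier G σ q ts c → Unifier G σ q ts c → Set
MoreGeneral {G} {σ} {c = c} u u' =
  Σ (Sub (G' u) (G' u')) λ ξ →
    (∀ {t} (x : Var G t) → sub ξ (ρ u x) ≈ ρ u' x) ×
    (∀ {t} (x : Var (cvars c) t) → sub (underS σ ξ) (θ u x) ≈ θ u' x)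

record CSU (G σ : Ctx) (q : Pred) (ts : All (Tm (σ ++ G)) (arity q)) (c : Clause) : Set₁ where
  field
    Idx      : Set
    unifier  : Idx → Unifier G σ q ts c
    complete : (u' : Unifier G σ q ts c) → Σ Idx λ i → MoreGeneral (unifier i) u'
open CSU public

module Calculus (Defn : Clause → Set) where

  infix 2 _⊢_⊢_
  data _⊢_⊢_ (G : Ctx) : List (Judg G) → Judg G → Set₁ where
    init  : ∀ {σ} {B B' : Fm (σ ++ G)} → B ≈F B' → G ⊢ (σ , B) ∷ [] ⊢ (σ , B')
    cut   : ∀ {Δ Γ J C} → G ⊢ Δ ⊢ J → G ⊢ J ∷ Γ ⊢ C → G ⊢ Δ ++ Γ ⊢ C
    exch  : ∀ {Γ Γ' C} → Γ ↭ Γ' → G ⊢ Γ ⊢ C → G ⊢ Γ' ⊢ C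
    contr : ∀ {J Γ C} → G ⊢ J ∷ J ∷ Γ ⊢ C → G ⊢ J ∷ Γ ⊢ C
    weak  : ∀ {J Γ C} → G ⊢ Γ ⊢ C → G ⊢ J ∷ Γ ⊢ C
    ⊥L    : ∀ {σ Γ C} → G ⊢ (σ , ⊥') ∷ Γ ⊢ C
    ⊤R    : ∀ {σ Γ} → G ⊢ Γ ⊢ (σ , ⊤')
    ∧L₁   : ∀ {σ A B Γ C} → G ⊢ (σ , A) ∷ Γ ⊢ C → G ⊢ (σ , A ∧' B) ∷ Γ ⊢ C
    ∧L₂   : ∀ {σ A B Γ C} → G ⊢ (σ , B) ∷ Γ ⊢ C → G ⊢ (σ , A ∧' B) ∷ Γ ⊢ C
    ∧R    : ∀ {σ A B Γ} → G ⊢ Γ ⊢ (σ , A) → G ⊢ Γ ⊢ (σ , B) → G ⊢ Γ ⊢ (σ , A ∧' B)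
    ∨L    : ∀ {σ A B Γ C} → G ⊢ (σ , A) ∷ Γ ⊢ C → G ⊢ (σ , B) ∷ Γ ⊢ C →
            G ⊢ (σ , A ∨' B) ∷ Γ ⊢ C
    ∨R₁   : ∀ {σ A B Γ} → G ⊢ Γ ⊢ (σ , A) → G ⊢ Γ ⊢ (σ , A ∨' B)
    ∨R₂   : ∀ {σ A B Γ} → G ⊢ Γ ⊢ (σ , B) → G ⊢ Γ ⊢ (σ , A ∨' B)
    ⊃L    : ∀ {σ A B Δ Γ C} → G ⊢ Δ ⊢ (σ , A) → G ⊢ (σ , B) ∷ Γ ⊢ C →
            G ⊢ (σ , A ⊃' B) ∷ (Δ ++ Γ) ⊢ C
    ⊃R    : ∀ {σ A B Γ} → G ⊢ (σ , A) ∷ Γ ⊢ (σ , B) → G ⊢ Γ ⊢ (σ , A ⊃' B)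
    ∀L    : ∀ {σ t B Γ C} (T : Tm (σ ++ G) t) → G ⊢ (σ , subF (sub1 T) B) ∷ Γ ⊢ C →
            G ⊢ (σ , ∀' t B) ∷ Γ ⊢ C
    ∀R    : ∀ {σ t B Γ} →
            (raiseTy σ t ∷ G) ⊢ map (renJ vs) Γ ⊢ (σ , subF (raiseSub σ) B) →
            G ⊢ Γ ⊢ (σ , ∀' t B)
    ∃L    : ∀ {σ t B Γ C} →
            (raiseTy σ t ∷ G) ⊢ (σ , subF (raiseSub σ) B) ∷ map (renJ vs) Γ ⊢ renJ vs C →
            G ⊢ (σ , ∃' t B) ∷ Γ ⊢ C
    ∃R    : ∀ {σ t B Γ} (T : Tm (σ ++ G) t) → G ⊢ Γ ⊢ (σ , subF (sub1 T) B) →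
            G ⊢ Γ ⊢ (σ , ∃' t B)
    ∇L    : ∀ {σ t B Γ C} → G ⊢ (t ∷ σ , B) ∷ Γ ⊢ C → G ⊢ (σ , ∇' t B) ∷ Γ ⊢ C
    ∇R    : ∀ {σ t B Γ} → G ⊢ Γ ⊢ (t ∷ σ , B) → G ⊢ Γ ⊢ (σ , ∇' t B)
    defR  : ∀ {σ Γ} {A : Fm (σ ++ G)} (c : Clause) → Defn c →
            (θ : Sub (cvars c) (σ ++ G)) →
            atom (cpred c) (All.map (sub θ) (chead c)) ≈F A →
            G ⊢ Γ ⊢ (σ , subF θ (cbody c)) → G ⊢ Γ ⊢ (σ , A)
    defL  : ∀ {σ q ts Γ C} →
            (csu : (c : Clause) → Defn c → CSU G σ q ts c) →
            ((c : Clause) (d : Defn c) (i : Idx (csu c d)) →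
               G' (unifier (csu c d) i)
                 ⊢ (σ , subF (θ (unifier (csu c d) i)) (cbody c))
                     ∷ map (subJ (ρ (unifier (csu c d) i))) Γ
                 ⊢ subJ (ρ (unifier (csu c d) i)) C) →
            G ⊢ (σ , atom q ts) ∷ Γ ⊢ C

v0 : ∀ {Γ a} → Tm (a ∷ Γ) a
v0 = var vz
v1 : ∀ {Γ a b} → Tm (b ∷ a ∷ Γ) a
v1 = var (vs vz)
v2 : ∀ {Γ a b c} → Tm (c ∷ b ∷ a ∷ Γ) a
v2 = var (vs (vs vz))
v3 : ∀ {Γ a b c d} → Tm (d ∷ c ∷ b ∷ a ∷ Γ) a
v3 = var (vs (vs (vs vz)))
v4 : ∀ {Γ a b c d e} → Tm (e ∷ d ∷ c ∷ b ∷ a ∷ Γ) a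
v4 = var (vs (vs (vs (vs vz))))
v5 : ∀ {Γ a b c d e f} → Tm (f ∷ e ∷ d ∷ c ∷ b ∷ a ∷ Γ) a
v5 = var (vs (vs (vs (vs (vs vz)))))
v6 : ∀ {Γ a b c d e f g} → Tm (g ∷ f ∷ e ∷ d ∷ c ∷ b ∷ a ∷ Γ) a
v6 = var (vs (vs (vs (vs (vs (vs vz))))))

_·_ : ∀ {Γ s t} → Tm Γ (s ⇒ t) → Tm Γ s → Tm Γ t
_·_ = app
infixl 9 _·_

τT : ∀ {Γ} → Tm Γ ac
τT = con τA
↓T : ∀ {Γ} → Tm Γ nm → Tm Γ (nm ⇒ ac)
↓T X = con ↓C · X
↑T : ∀ {Γ} → Tm Γ nm → Tm Γ (nm ⇒ ac)
↑T X = con ↑C · X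
↑T2 : ∀ {Γ} → Tm Γ nm → Tm Γ nm → Tm Γ ac
↑T2 X Y = con ↑C · X · Y
τP : ∀ {Γ} → Tm Γ pr → Tm Γ pr
τP P = con τC · P
outT : ∀ {Γ} → Tm Γ nm → Tm Γ nm → Tm Γ pr → Tm Γ pr
outT x y P = con outC · x · y · P
inT : ∀ {Γ} → Tm Γ nm → Tm Γ (nm ⇒ pr) → Tm Γ pr
inT x M = con inC · x · M
_⊕_ _∥_ : ∀ {Γ} → Tm Γ pr → Tm Γ pr → Tm Γ pr
P ⊕ Q = con plusC · P · Q
P ∥ Q = con parC · P · Q
matchT : ∀ {Γ} → Tm Γ nm → Tm Γ nm → Tm Γ pr → Tm Γ pr
matchT x y P = con matchC · x · y · P
νT : ∀ {Γ} → Tm Γ (nm ⇒ pr) → Tm Γ pr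
νT M = con nuC · M

One : ∀ {Γ} → Tm Γ pr → Tm Γ ac → Tm Γ pr → Fm Γ
One P A Q = atom one (P ∷ A ∷ Q ∷ [])
Onep : ∀ {Γ} → Tm Γ pr → Tm Γ (nm ⇒ ac) → Tm Γ (nm ⇒ pr) → Fm Γ
Onep P A M = atom onep (P ∷ A ∷ M ∷ [])
Lbisim : ∀ {Γ} → Tm Γ pr → Tm Γ pr → Fm Γ
Lbisim P Q = atom lbisim (P ∷ Q ∷ [])
_≐_ : ∀ {Γ t} → Tm Γ t → Tm Γ t → Fm Γ
_≐_ {t = t} x y = atom (eq t) (x ∷ y ∷ [])

oneC : (xs : Ctx) → Tm xs pr → Tm xs ac → Tm xs pr → Fm xs → Clause
oneC xs P A Q B = clause xs one (P ∷ A ∷ Q ∷ []) B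
onepC : (xs : Ctx) → Tm xs pr → Tm xs (nm ⇒ ac) → Tm xs (nm ⇒ pr) → Fm xs → Clause
onepC xs P A M B = clause xs onep (P ∷ A ∷ M ∷ []) B

-- body of the lbisim clause, over variables  Q ∷ P ∷ []  (P = v1, Q = v0)
lbisimBody : Fm (pr ∷ pr ∷ [])
lbisimBody =
  ∀' ac (∀' pr (One v3 v1 v0 ⊃' ∃' pr (One v3 v2 v0 ∧' Lbisim v1 v0)))
  ∧' ∀' ac (∀' pr (One v2 v1 v0 ⊃' ∃' pr (One v4 v2 v0 ∧' Lbisim v1 v0)))
  ∧' ∀' nm (∀' (nm ⇒ pr) (Onep v3 (↓T v1) v0 ⊃'
        ∃' (nm ⇒ pr) (Onep v3 (↓T v2) v0 ∧' ∀' nm (Lbisim (v2 · v0) (v1 · v0)))))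
  ∧' ∀' nm (∀' (nm ⇒ pr) (Onep v2 (↓T v1) v0 ⊃'
        ∃' (nm ⇒ pr) (Onep v4 (↓T v2) v0 ∧' ∀' nm (Lbisim (v2 · v0) (v1 · v0)))))
  ∧' ∀' nm (∀' (nm ⇒ pr) (Onep v3 (↑T v1) v0 ⊃'
        ∃' (nm ⇒ pr) (Onep v3 (↑T v2) v0 ∧' ∇' nm (Lbisim (v2 · v0) (v1 · v0)))))
  ∧' ∀' nm (∀' (nm ⇒ pr) (Onep v2 (↑T v1) v0 ⊃'
        ∃' (nm ⇒ pr) (Onep v4 (↑T v2) v0 ∧' ∇' nm (Lbisim (v2 · v0) (v1 · v0)))))

-- The clauses.  Clause-variable contexts list the innermost (v0) first.
data Dpi : Clause → Set where
  c-tau : Dpi (oneC (pr ∷ []) (τP v0) τT v0 ⊤')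
  c-in : Dpi (onepC (nm ∷ (nm ⇒ pr) ∷ []) (inT v0 v1) (↓T v0) v1 ⊤')
  c-out : Dpi (oneC (pr ∷ nm ∷ nm ∷ []) (outT v2 v1 v0) (↑T2 v2 v1) v0 ⊤')
  c-match : Dpi (oneC (pr ∷ ac ∷ pr ∷ nm ∷ []) (matchT v3 v3 v2) v1 v0 (One v2 v1 v0))
  c-matchp : Dpi (onepC ((nm ⇒ pr) ∷ (nm ⇒ ac) ∷ pr ∷ nm ∷ []) (matchT v3 v3 v2) v1 v0 (Onep v2 v1 v0))
  c-sumL : Dpi (oneC (pr ∷ ac ∷ pr ∷ pr ∷ []) (v3 ⊕ v2) v1 v0 (One v3 v1 v0))
  c-sumR : Dpi (oneC (pr ∷ ac ∷ pr ∷ pr ∷ []) (v3 ⊕ v2) v1 v0 (One v2 v1 v0))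
  c-sumLp : Dpi (onepC ((nm ⇒ pr) ∷ (nm ⇒ ac) ∷ pr ∷ pr ∷ []) (v3 ⊕ v2) v1 v0 (Onep v3 v1 v0))
  c-sumRp : Dpi (onepC ((nm ⇒ pr) ∷ (nm ⇒ ac) ∷ pr ∷ pr ∷ []) (v3 ⊕ v2) v1 v0 (Onep v2 v1 v0))
  c-parL : Dpi (oneC (pr ∷ ac ∷ pr ∷ pr ∷ []) (v3 ∥ v2) v1 (v0 ∥ v2) (One v3 v1 v0))
  c-parR : Dpi (oneC (pr ∷ ac ∷ pr ∷ pr ∷ []) (v3 ∥ v2) v1 (v3 ∥ v0) (One v2 v1 v0))
  c-parLp : Dpi (onepC ((nm ⇒ pr) ∷ (nm ⇒ ac) ∷ pr ∷ pr ∷ [])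
                  (v3 ∥ v2) v1 (lam ((v1 · v0) ∥ v3)) (Onep v3 v1 v0))
  c-parRp : Dpi (onepC ((nm ⇒ pr) ∷ (nm ⇒ ac) ∷ pr ∷ pr ∷ [])
                  (v3 ∥ v2) v1 (lam (v4 ∥ (v1 · v0))) (Onep v2 v1 v0))
  c-res : Dpi (oneC ((nm ⇒ pr) ∷ ac ∷ (nm ⇒ pr) ∷ [])
                (νT (lam (v3 · v0))) v1 (νT (lam (v1 · v0)))
                (∇' nm (One (v3 · v0) v2 (v1 · v0))))
  c-resp : Dpi (onepC ((nm ⇒ nm ⇒ pr) ∷ (nm ⇒ ac) ∷ (nm ⇒ pr) ∷ [])
                 (νT (lam (v3 · v0))) v1 (lam (νT (lam (v2 · v0 · v1))))
                 (∇' nm (Onep (v3 · v0) v2 (v1 · v0))))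
  c-open : Dpi (onepC ((nm ⇒ pr) ∷ nm ∷ (nm ⇒ pr) ∷ [])
                 (νT (lam (v3 · v0))) (↑T v1) v0
                 (∇' nm (One (v3 · v0) (↑T2 v2 v0) (v1 · v0))))
  c-closeL : Dpi (oneC ((nm ⇒ pr) ∷ (nm ⇒ pr) ∷ pr ∷ pr ∷ [])
                   (v3 ∥ v2) τT (νT (lam ((v2 · v0) ∥ (v1 · v0))))
                   (∃' nm (Onep v4 (↓T v0) v2 ∧' Onep v3 (↑T v0) v1)))
  c-closeR : Dpi (oneC ((nm ⇒ pr) ∷ (nm ⇒ pr) ∷ pr ∷ pr ∷ [])
                   (v3 ∥ v2) τT (νT (lam ((v2 · v0) ∥ (v1 · v0))))
                   (∃' nm (Onep v4 (↑T v0) v2 ∧' Onep v3 (↓T v0) v1)))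
  c-comL : Dpi (oneC (pr ∷ nm ∷ (nm ⇒ pr) ∷ pr ∷ pr ∷ [])
                 (v4 ∥ v3) τT ((v2 · v1) ∥ v0)
                 (∃' nm (Onep v5 (↓T v0) v3 ∧' One v4 (↑T2 v0 v2) v1)))
  c-comR : Dpi (oneC (nm ∷ (nm ⇒ pr) ∷ pr ∷ pr ∷ pr ∷ [])
                 (v4 ∥ v3) τT (v2 ∥ (v1 · v0))
                 (∃' nm (One v5 (↑T2 v0 v1) v3 ∧' Onep v4 (↓T v0) v2)))
  c-lbisim : Dpi (clause (pr ∷ pr ∷ []) lbisim (v1 ∷ v0 ∷ []) lbisimBody)
  c-eq : ∀ t → Dpi (clause (t ∷ []) (eq t) (v0 ∷ v0 ∷ []) ⊤')

open Calculus Dpi public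

nmCtx : List ℕ → Ctx
nmCtx ns = map (λ _ → nm) ns

lookupName : (ns : List ℕ) → ℕ → Maybe (Var (nmCtx ns) nm)
lookupName []       a = nothing
lookupName (b ∷ ns) a = if a ≡ᵇ b then just vz else Maybe.map vs (lookupName ns a)

liftEnv : ∀ {k Δ} → (Nm k → Maybe (Tm Δ nm)) → Nm (suc k) → Maybe (Tm (nm ∷ Δ) nm)
liftEnv e (fr a)       = Maybe.map (ren vs) (e (fr a))
liftEnv e (bd zero)    = just (var vz)
liftEnv e (bd (suc i)) = Maybe.map (ren vs) (e (bd i))

tr : ∀ {k Δ} → (Nm k → Maybe (Tm Δ nm)) → Proc k → Maybe (Tm Δ pr)
tr e nil         = just (con zeroC)
tr e (out x y P) = e x >>= λ x' → e y >>= λ y' → tr e P >>= λ P' → just (outT x' y' P')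
tr e (inp x P)   = e x >>= λ x' → tr (liftEnv e) P >>= λ P' → just (inT x' (lam P'))
tr e (tau P)     = tr e P >>= λ P' → just (τP P')
tr e (res P)     = tr (liftEnv e) P >>= λ P' → just (νT (lam P'))
tr e (mat x y P) = e x >>= λ x' → e y >>= λ y' → tr e P >>= λ P' → just (matchT x' y' P')
tr e (par P Q)   = tr e P >>= λ P' → tr e Q >>= λ Q' → just (P' ∥ Q')
tr e (sum P Q)   = tr e P >>= λ P' → tr e Q >>= λ Q' → just (P' ⊕ Q')

topEnv : (ns : List ℕ) → Nm 0 → Maybe (Tm (nmCtx ns) nm)
topEnv ns (fr a) = Maybe.map var (lookupName ns a)
topEnv ns (bd ())

⟦_⟧_ : Proc 0 → (ns : List ℕ) → Maybe (Tm (nmCtx ns) pr)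
⟦ P ⟧ ns = tr (topEnv ns) P

fnPQ : Proc 0 → Proc 0 → List ℕ
fnPQ P Q = deduplicate _≟_ (fn P ++ fn Q)

-- ∇x₁ … ∇x_k . B  for B over the variables Γ (head of Γ = innermost)
∇all : (Γ : Ctx) → Fm Γ → Fm []
∇all []      B = B
∇all (t ∷ Γ) B = ∇all Γ (∇' t B)

Eform : ℕ → Fm []
Eform k = ∇all (replicate k nm) (∀' nm (∀' nm ((v1 ≐ v0) ∨' ((v1 ≐ v0) ⊃' ⊥'))))

-- a finite subset 𝒳 ⊆ ℰ, given by the list of the k's, as hypotheses
Ehyps : List ℕ → List (Judg [])
Ehyps X = map (λ k → ([] , Eform k)) X

{-# OPTIONS --safe #-}
module Submission where

-- Soundness: the calculus has a term model over a signature with infinitely many closed names, in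
-- which ∇ adds a local variable, one and onep are inductive, lbisim is the least fixed point of its
-- clause, and the hypotheses ℰ hold because βη-equality is decidable (normalisation by evaluation).
-- The unifiers of a defL step cover every closed instance, so validity in the model follows rule by
-- rule, cut included.  A model bisimulation is read back as a late bisimulation, an unused closed
-- name standing for the fresh names that a late input may receive.
--
-- Completeness: the set of all unifiers is a complete set of unifiers, so defL can be applied with
-- one premise per instance.  Analysing a hypothesis one P A Q then leaves exactly the transitions of
-- P, provided that no two names of P get identified; ℰ is used to compare each input variable with
-- the names known so far, its negative cases being the hypotheses that refute such identifications.

open import Defs
open import Data.Bool using (true; false; T; if_then_else_)
open import Data.Empty using (⊥; ⊥-elim)
import Data.Fin as Fin
open import Data.Fin using (Fin; zero; suc)
open import Data.List using (List; []; _∷_; _++_; map; replicate; length; lookup; allFin; upTo)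
open import Data.List.Membership.Propositional using (_∈_; _∉_)
open import Data.List.Membership.Propositional.Properties using (∈-++⁺ˡ; ∈-++⁺ʳ; ∈-++⁻; ∈-map⁺; ∈-allFin; ∈-deduplicate⁺; ∈-lookup; ∈-upTo⁺)
open import Data.List.Properties using (∷-injective; ∷-injectiveʳ; ≡-dec; map-cong; map-++)
open import Data.List.Relation.Binary.Permutation.Propositional as Perm using (↭-sym; _↭_)
open import Data.List.Relation.Binary.Permutation.Propositional.Properties using (All-resp-↭)
open import Data.List.Relation.Unary.All as All using (All; []; _∷_)
import Data.List.Relation.Unary.All.Properties as AllP
open import Data.List.Relation.Unary.AllPairs using ([]; _∷_)
import Data.List.Relation.Unary.Any as Any
open import Data.List.Relation.Unary.Any using (here; there)
open import Data.List.Relation.Unary.Any.Properties using (lookup-index)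
open import Data.List.Relation.Unary.Unique.Propositional using (Unique)
import Data.Maybe as Maybe
open import Data.Maybe using (Maybe; just)
open import Data.Maybe.Properties using (just-injective)
open import Data.Nat using (ℕ; zero; suc; _+_; _≤_; _<_; s≤s; _≟_; _≡ᵇ_; _⊔_)
open import Data.Nat.Properties using (m≤m⊔n; m≤n⊔m; ≤-trans; ≤-refl; <-irrefl; suc-injective; ≡⇒≡ᵇ; ≡ᵇ⇒≡; ≤-reflexive; m≤m+n; m≤n+m; +-mono-<; +-mono-<-≤; +-mono-≤-<; +-comm; +-suc; <-≤-trans; ≤-pred)
open import Data.Product using (Σ; _×_; _,_; proj₁; proj₂; ∃; map₁; map₂)
open import Data.Sum using (_⊎_; inj₁; inj₂)
open import Data.Unit using (⊤; tt)
open import Function.Bundles using (_⇔_; mk⇔)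
open import Level using (Lift; lift; lower)
open import Relation.Binary.PropositionalEquality
open import Relation.Nullary using (¬_; Dec; yes; no)
open import Data.List.Membership.DecPropositional _≟_ using (_∈?_)
open import Data.List.Relation.Unary.Unique.DecPropositional.Properties _≟_ using (deduplicate-!)

-- Both sides of the theorem are compared through a third syntax, the scoped processes `Pr n`, whose
-- free names are indices: `nameP` reads one as a π-process and `trT` as a λ-term. The obstacle
-- throughout is the identification of names. A `defL` step may instantiate eigenvariables, and in
-- an instance that merges two names a match or a communication may fire that the process with
-- distinct names does not have. Statements about hypotheses are therefore made for all later
-- instances ξ, and merging instances have to be discharged: in the calculus by an inequality among
-- the hypotheses, in the model by injectivity of the interpretation of names. Otherwise the
-- analysis of a transition hypothesis is the same in both, so it is done once, over an abstract
-- family of left rules. Finitely many members of ℰ suffice because a transition consumes at least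
-- one prefix: the combined size of the two processes falls in every round while ∇ adds at most one
-- local variable, so the local depth stays below a bound fixed at the start.

private variable
  Γ Δ Θ G H : Ctx
  s t u : Ty
  n m k : ℕ

-- Substitutions

_⊙_ : Sub Δ Θ → Sub Γ Δ → Sub Γ Θ
(θ ⊙ ξ) x = sub θ (ξ x)

_▸_ : Sub Γ Δ → Tm Δ s → Sub (s ∷ Γ) Δ
(θ ▸ M) vz     = M
(θ ▸ M) (vs x) = θ x

wkS : Sub Γ (s ∷ Γ)
wkS x = var (vs x)

emp : Sub [] Γ
emp ()

ren-ren : {ρ : Ren Δ Θ} {ρ' : Ren Γ Δ} {ρ'' : Ren Γ Θ} → (∀ {t} (x : Var Γ t) → ρ (ρ' x) ≡ ρ'' x) →
          (M : Tm Γ t) → ren ρ (ren ρ' M) ≡ ren ρ'' M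
ren-ren h (var x)   = cong var (h x)
ren-ren h (con c)   = refl
ren-ren h (app M N) = cong₂ app (ren-ren h M) (ren-ren h N)
ren-ren h (lam M)   = cong lam (ren-ren (λ { vz → refl ; (vs x) → cong vs (h x) }) M)

sub-ren : {θ : Sub Δ Θ} {ρ : Ren Γ Δ} {ξ : Sub Γ Θ} → (∀ {t} (x : Var Γ t) → θ (ρ x) ≡ ξ x) →
          (M : Tm Γ t) → sub θ (ren ρ M) ≡ sub ξ M
sub-ren h (var x)   = h x
sub-ren h (con c)   = refl
sub-ren h (app M N) = cong₂ app (sub-ren h M) (sub-ren h N)
sub-ren h (lam M)   = cong lam (sub-ren (λ { vz → refl ; (vs x) → cong (ren vs) (h x) }) M)

ren-liftS : (ρ : Ren Δ Θ) (θ : Sub Γ Δ) (x : Var (s ∷ Γ) t) →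
            ren (liftR ρ) (liftS θ x) ≡ liftS (λ y → ren ρ (θ y)) x
ren-liftS ρ θ vz     = refl
ren-liftS ρ θ (vs x) = trans (ren-ren (λ _ → refl) (θ x)) (sym (ren-ren (λ _ → refl) (θ x)))

ren-sub : {ρ : Ren Δ Θ} {θ : Sub Γ Δ} {ξ : Sub Γ Θ} → (∀ {t} (x : Var Γ t) → ren ρ (θ x) ≡ ξ x) →
          (M : Tm Γ t) → ren ρ (sub θ M) ≡ sub ξ M
ren-sub h (var x)   = h x
ren-sub h (con c)   = refl
ren-sub h (app M N) = cong₂ app (ren-sub h M) (ren-sub h N)
ren-sub {ρ = ρ} {θ} h (lam M) =
  cong lam (ren-sub (λ { vz → refl ; (vs x) → trans (ren-liftS ρ θ (vs x)) (cong (ren vs) (h x)) }) M)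

liftS-⊙ : (θ : Sub Δ Θ) (ξ : Sub Γ Δ) (x : Var (s ∷ Γ) t) → sub (liftS θ) (liftS ξ x) ≡ liftS (θ ⊙ ξ) x
liftS-⊙ θ ξ vz     = refl
liftS-⊙ θ ξ (vs x) = trans (sub-ren (λ _ → refl) (ξ x)) (sym (ren-sub (λ _ → refl) (ξ x)))

liftS-cong : {θ ξ : Sub Γ Δ} → (∀ {t} (x : Var Γ t) → θ x ≡ ξ x) → (x : Var (s ∷ Γ) t) → liftS θ x ≡ liftS ξ x
liftS-cong h vz     = refl
liftS-cong h (vs x) = cong (ren vs) (h x)

liftS-id : {θ : Sub Γ Γ} → (∀ {t} (x : Var Γ t) → θ x ≡ var x) → (x : Var (s ∷ Γ) t) → liftS θ x ≡ var x
liftS-id h vz     = refl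
liftS-id h (vs x) = cong (ren vs) (h x)

sub-sub : {θ : Sub Δ Θ} {ξ : Sub Γ Δ} {ζ : Sub Γ Θ} → (∀ {t} (x : Var Γ t) → sub θ (ξ x) ≡ ζ x) →
          (M : Tm Γ t) → sub θ (sub ξ M) ≡ sub ζ M
sub-sub h (var x)   = h x
sub-sub h (con c)   = refl
sub-sub h (app M N) = cong₂ app (sub-sub h M) (sub-sub h N)
sub-sub {θ = θ} {ξ} h (lam M) =
  cong lam (sub-sub (λ x → trans (liftS-⊙ θ ξ x) (liftS-cong h x)) M)

sub-id : {θ : Sub Γ Γ} → (∀ {t} (x : Var Γ t) → θ x ≡ var x) → (M : Tm Γ t) → sub θ M ≡ M
sub-id h (var x)   = h x
sub-id h (con c)   = refl
sub-id h (app M N) = cong₂ app (sub-id h M) (sub-id h N)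
sub-id h (lam M)   = cong lam (sub-id (liftS-id h) M)

sub-cong : {θ ξ : Sub Γ Δ} → (∀ {t} (x : Var Γ t) → θ x ≡ ξ x) → (M : Tm Γ t) → sub θ M ≡ sub ξ M
sub-cong h (var x)   = h x
sub-cong h (con c)   = refl
sub-cong h (app M N) = cong₂ app (sub-cong h M) (sub-cong h N)
sub-cong h (lam M)   = cong lam (sub-cong (liftS-cong h) M)

liftR-S : {ρ : Ren Γ Δ} {θ : Sub Γ Δ} → (∀ {t} (x : Var Γ t) → var (ρ x) ≡ θ x) →
          (x : Var (s ∷ Γ) t) → var (liftR ρ x) ≡ liftS θ x
liftR-S h vz     = refl
liftR-S h (vs x) = cong (ren vs) (h x)

ren-as-sub : {ρ : Ren Γ Δ} {θ : Sub Γ Δ} → (∀ {t} (x : Var Γ t) → var (ρ x) ≡ θ x) →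
             (M : Tm Γ t) → ren ρ M ≡ sub θ M
ren-as-sub h (var x)   = h x
ren-as-sub h (con c)   = refl
ren-as-sub h (app M N) = cong₂ app (ren-as-sub h M) (ren-as-sub h N)
ren-as-sub h (lam M)   = cong lam (ren-as-sub (liftR-S h) M)

sub1-wk : (N : Tm Γ s) (M : Tm Γ t) → sub (sub1 N) (ren vs M) ≡ M
sub1-wk N M = trans (sub-ren {ξ = var} (λ _ → refl) M) (sub-id (λ _ → refl) M)

sub-wk : (θ : Sub Γ Δ) (M : Tm Γ t) → sub (liftS {s = s} θ) (ren vs M) ≡ ren vs (sub θ M)
sub-wk θ M = trans (sub-ren (λ _ → refl) M) (sym (ren-sub (λ _ → refl) M))

≡⇒≈ : {M N : Tm Γ t} → M ≡ N → M ≈ N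
≡⇒≈ refl = ≈refl

sub-≈ : (θ : Sub Γ Δ) {M N : Tm Γ t} → M ≈ N → sub θ M ≈ sub θ N
sub-≈ θ (β {M = M} {N}) = ≈trans β (≡⇒≈ (trans
  (sub-sub {ζ = θ ▸ sub θ N} (λ { vz → refl ; (vs x) → sub1-wk _ (θ x) }) M)
  (sym (sub-sub (λ { vz → refl ; (vs x) → refl }) M))))
sub-≈ θ (η {M = M}) = ≈trans η (lamc (appc (≡⇒≈ (sym (sub-wk θ M))) ≈refl))
sub-≈ θ ≈refl        = ≈refl
sub-≈ θ (≈sym p)     = ≈sym (sub-≈ θ p)
sub-≈ θ (≈trans p q) = ≈trans (sub-≈ θ p) (sub-≈ θ q)
sub-≈ θ (appc p q)   = appc (sub-≈ θ p) (sub-≈ θ q)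
sub-≈ θ (lamc p)     = lamc (sub-≈ (liftS θ) p)

ren-≈ : (ρ : Ren Γ Δ) {M N : Tm Γ t} → M ≈ N → ren ρ M ≈ ren ρ N
ren-≈ ρ {M} {N} p = ≈trans (≡⇒≈ (ren-as-sub (λ _ → refl) M))
  (≈trans (sub-≈ (λ x → var (ρ x)) p) (≡⇒≈ (sym (ren-as-sub (λ _ → refl) N))))

liftS-cong≈ : {θ ξ : Sub Γ Δ} → (∀ {t} (x : Var Γ t) → θ x ≈ ξ x) → (x : Var (s ∷ Γ) t) → liftS θ x ≈ liftS ξ x
liftS-cong≈ h vz     = ≈refl
liftS-cong≈ h (vs x) = ren-≈ vs (h x)

sub-cong≈ : {θ ξ : Sub Γ Δ} → (∀ {t} (x : Var Γ t) → θ x ≈ ξ x) → (M : Tm Γ t) → sub θ M ≈ sub ξ M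
sub-cong≈ h (var x)   = h x
sub-cong≈ h (con c)   = ≈refl
sub-cong≈ h (app M N) = appc (sub-cong≈ h M) (sub-cong≈ h N)
sub-cong≈ h (lam M)   = lamc (sub-cong≈ (liftS-cong≈ h) M)

wkβ : (M : Tm (s ∷ Γ) t) → app (ren vs (lam M)) (var vz) ≈ M
wkβ M = ≈trans β (≡⇒≈ (trans (sub-ren {ξ = var} (λ { vz → refl ; (vs x) → refl }) M) (sub-id (λ _ → refl) M)))

lam-inj : {M N : Tm (s ∷ Γ) t} → lam M ≈ lam N → M ≈ N
lam-inj {M = M} {N} p = ≈trans (≈sym (wkβ M)) (≈trans (appc (ren-≈ vs p) ≈refl) (wkβ N))

-- Normalisation by evaluation

mutual
  data Ne (Γ : Ctx) : Ty → Set where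
    var : Var Γ t → Ne Γ t
    con : Const t → Ne Γ t
    app : Ne Γ (s ⇒ t) → Nf Γ s → Ne Γ t

  -- Neutral terms are normal only at the base types, with one constructor for each; normal forms
  -- are thus η-long and can be compared syntactically.
  data Nf (Γ : Ctx) : Ty → Set where
    nmN : Ne Γ nm → Nf Γ nm
    prN : Ne Γ pr → Nf Γ pr
    acN : Ne Γ ac → Nf Γ ac
    lam : Nf (s ∷ Γ) t → Nf Γ (s ⇒ t)

mutual
  renNe : Ren Γ Δ → Ne Γ t → Ne Δ t
  renNe ρ (var x)   = var (ρ x)
  renNe ρ (con c)   = con c
  renNe ρ (app n m) = app (renNe ρ n) (renNf ρ m)

  renNf : Ren Γ Δ → Nf Γ t → Nf Δ t
  renNf ρ (nmN n) = nmN (renNe ρ n)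
  renNf ρ (prN n) = prN (renNe ρ n)
  renNf ρ (acN n) = acN (renNe ρ n)
  renNf ρ (lam n) = lam (renNf (liftR ρ) n)

mutual
  renNe-∘ : {ρ : Ren Δ Θ} {ρ' : Ren Γ Δ} {ρ'' : Ren Γ Θ} → (∀ {t} (x : Var Γ t) → ρ (ρ' x) ≡ ρ'' x) →
            (n : Ne Γ t) → renNe ρ (renNe ρ' n) ≡ renNe ρ'' n
  renNe-∘ h (var x)   = cong var (h x)
  renNe-∘ h (con c)   = refl
  renNe-∘ h (app n m) = cong₂ app (renNe-∘ h n) (renNf-∘ h m)

  renNf-∘ : {ρ : Ren Δ Θ} {ρ' : Ren Γ Δ} {ρ'' : Ren Γ Θ} → (∀ {t} (x : Var Γ t) → ρ (ρ' x) ≡ ρ'' x) →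
            (n : Nf Γ t) → renNf ρ (renNf ρ' n) ≡ renNf ρ'' n
  renNf-∘ h (nmN n) = cong nmN (renNe-∘ h n)
  renNf-∘ h (prN n) = cong prN (renNe-∘ h n)
  renNf-∘ h (acN n) = cong acN (renNe-∘ h n)
  renNf-∘ h (lam n) = cong lam (renNf-∘ (λ { vz → refl ; (vs x) → cong vs (h x) }) n)

mutual
  renNe-id : {ρ : Ren Γ Γ} → (∀ {t} (x : Var Γ t) → ρ x ≡ x) → (n : Ne Γ t) → renNe ρ n ≡ n
  renNe-id h (var x)   = cong var (h x)
  renNe-id h (con c)   = refl
  renNe-id h (app n m) = cong₂ app (renNe-id h n) (renNf-id h m)

  renNf-id : {ρ : Ren Γ Γ} → (∀ {t} (x : Var Γ t) → ρ x ≡ x) → (n : Nf Γ t) → renNf ρ n ≡ n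
  renNf-id h (nmN n) = cong nmN (renNe-id h n)
  renNf-id h (prN n) = cong prN (renNe-id h n)
  renNf-id h (acN n) = cong acN (renNe-id h n)
  renNf-id h (lam n) = cong lam (renNf-id (λ { vz → refl ; (vs x) → cong vs (h x) }) n)

mutual
  embNe : Ne Γ t → Tm Γ t
  embNe (var x)   = var x
  embNe (con c)   = con c
  embNe (app n m) = app (embNe n) (embNf m)

  embNf : Nf Γ t → Tm Γ t
  embNf (nmN n) = embNe n
  embNf (prN n) = embNe n
  embNf (acN n) = embNe n
  embNf (lam n) = lam (embNf n)

mutual
  embNe-ren : (ρ : Ren Γ Δ) (n : Ne Γ t) → embNe (renNe ρ n) ≡ ren ρ (embNe n)
  embNe-ren ρ (var x)   = refl
  embNe-ren ρ (con c)   = refl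
  embNe-ren ρ (app n m) = cong₂ app (embNe-ren ρ n) (embNf-ren ρ m)

  embNf-ren : (ρ : Ren Γ Δ) (n : Nf Γ t) → embNf (renNf ρ n) ≡ ren ρ (embNf n)
  embNf-ren ρ (nmN n) = embNe-ren ρ n
  embNf-ren ρ (prN n) = embNe-ren ρ n
  embNf-ren ρ (acN n) = embNe-ren ρ n
  embNf-ren ρ (lam n) = cong lam (embNf-ren (liftR ρ) n)

-- Function values need not be natural in the renaming. Naturality is demanded by the relation `Eq`
-- instead, so values remain plain functions and are compared without function extensionality.
Val : Ty → Ctx → Set
Val nm Γ      = Ne Γ nm
Val pr Γ      = Ne Γ pr
Val ac Γ      = Ne Γ ac
Val (s ⇒ t) Γ = ∀ {Δ} → Ren Γ Δ → Val s Δ → Val t Δ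

mono : ∀ t → Ren Γ Δ → Val t Γ → Val t Δ
mono nm ρ v        = renNe ρ v
mono pr ρ v        = renNe ρ v
mono ac ρ v        = renNe ρ v
mono (s ⇒ t) ρ f σ = f (λ x → σ (ρ x))

mutual
  reflect : ∀ t → Ne Γ t → Val t Γ
  reflect nm n          = n
  reflect pr n          = n
  reflect ac n          = n
  reflect (s ⇒ t) n ρ a = reflect t (app (renNe ρ n) (reify s a))

  reify : ∀ t → Val t Γ → Nf Γ t
  reify nm v      = nmN v
  reify pr v      = prN v
  reify ac v      = acN v
  reify (s ⇒ t) f = lam (reify t (f vs (reflect s (var vz))))

Env : Ctx → Ctx → Set
Env Γ Δ = ∀ {t} → Var Γ t → Val t Δ

extE : Env Γ Δ → Val s Δ → Env (s ∷ Γ) Δ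
extE ρ a vz     = a
extE ρ a (vs x) = ρ x

monoE : Ren Δ Θ → Env Γ Δ → Env Γ Θ
monoE σ ρ {t} x = mono t σ (ρ x)

eval : Tm Γ t → Env Γ Δ → Val t Δ
eval (var x) ρ     = ρ x
eval (con c) ρ     = reflect _ (con c)
eval (app M N) ρ   = eval M ρ (λ x → x) (eval N ρ)
eval (lam M) ρ σ a = eval M (extE (monoE σ ρ) a)

idE : Env Γ Γ
idE {t = t} x = reflect t (var x)

nf : Tm Γ t → Nf Γ t
nf M = reify _ (eval M idE)

-- Extensional equality of values; the second component at arrow type is naturality.
Eq : ∀ t → Val t Γ → Val t Γ → Set
Eq nm v w = v ≡ w
Eq pr v w = v ≡ w
Eq ac v w = v ≡ w
Eq {Γ} (s ⇒ t) f g =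
  (∀ {Δ} (ρ : Ren Γ Δ) {a b} → Eq s a b → Eq t (f ρ a) (g ρ b)) ×
  (∀ {Δ Θ} (ρ : Ren Γ Δ) (σ : Ren Δ Θ) {a b} → Eq s a b →
     Eq t (mono t σ (f ρ a)) (g (λ x → σ (ρ x)) (mono s σ b)))

Eq-mono : ∀ t (ρ : Ren Γ Δ) {v w} → Eq t v w → Eq t (mono t ρ v) (mono t ρ w)
Eq-mono nm ρ p = cong (renNe ρ) p
Eq-mono pr ρ p = cong (renNe ρ) p
Eq-mono ac ρ p = cong (renNe ρ) p
Eq-mono (s ⇒ t) ρ (p , q) = (λ σ → p (λ x → σ (ρ x))) , (λ σ ς → q (λ x → σ (ρ x)) ς)

mutual
  Eq-sym : ∀ t {v w : Val t Γ} → Eq t v w → Eq t w v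
  Eq-sym nm p = sym p
  Eq-sym pr p = sym p
  Eq-sym ac p = sym p
  Eq-sym (s ⇒ t) (p , q) =
    (λ ρ e → Eq-sym t (p ρ (Eq-sym s e))) ,
    (λ ρ σ e → Eq-trans t (Eq-mono t σ (Eq-sym t (p ρ (Eq-sym s e))))
              (Eq-trans t (q ρ σ (Eq-trans s (Eq-sym s e) e))
                          (Eq-sym t (p (λ x → σ (ρ x)) (Eq-mono s σ (Eq-trans s (Eq-sym s e) e))))))

  Eq-trans : ∀ t {u v w : Val t Γ} → Eq t u v → Eq t v w → Eq t u w
  Eq-trans nm p q = trans p q
  Eq-trans pr p q = trans p q
  Eq-trans ac p q = trans p q
  Eq-trans (s ⇒ t) (p , q) (p' , q') =
    (λ ρ e → Eq-trans t (p ρ e) (p' ρ (Eq-trans s (Eq-sym s e) e))) ,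
    (λ ρ σ e → Eq-trans t (q ρ σ e)
                 (p' (λ x → σ (ρ x)) (Eq-mono s σ (Eq-trans s (Eq-sym s e) e))))

-- `Eq` is only a partial equivalence, since a non-natural function is not related to itself;
-- reflexivity is available for a value that is related to something.
Eq-reflˡ : ∀ t {v w : Val t Γ} → Eq t v w → Eq t v v
Eq-reflˡ t e = Eq-trans t e (Eq-sym t e)

Eq-reflʳ : ∀ t {v w : Val t Γ} → Eq t v w → Eq t w w
Eq-reflʳ t e = Eq-trans t (Eq-sym t e) e

-- Naturality in the left argument comes for free from its self-equality.
Eq-⇒ : ∀ s t {f g : Val (s ⇒ t) Γ} → Eq (s ⇒ t) f f →
       (∀ {Δ} (ρ : Ren Γ Δ) {a b} → Eq s a b → Eq t (f ρ a) (g ρ b)) → Eq (s ⇒ t) f g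
Eq-⇒ s t (_ , q) h = h , λ ρ σ e → Eq-trans t (q ρ σ (Eq-reflˡ s e)) (h (λ x → σ (ρ x)) (Eq-mono s σ e))

mono-∘ : ∀ t (σ : Ren Δ Θ) (ρ : Ren Γ Δ) {v w} → Eq t v w →
         Eq t (mono t σ (mono t ρ v)) (mono t (λ x → σ (ρ x)) w)
mono-∘ nm σ ρ {v} refl = renNe-∘ (λ _ → refl) v
mono-∘ pr σ ρ {v} refl = renNe-∘ (λ _ → refl) v
mono-∘ ac σ ρ {v} refl = renNe-∘ (λ _ → refl) v
mono-∘ (s ⇒ t) σ ρ e   = Eq-mono (s ⇒ t) (λ x → σ (ρ x)) e

mono-id : ∀ t {v w : Val t Γ} → Eq t v w → Eq t (mono t (λ x → x) v) w
mono-id nm {v} refl = renNe-id (λ _ → refl) v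
mono-id pr {v} refl = renNe-id (λ _ → refl) v
mono-id ac {v} refl = renNe-id (λ _ → refl) v
mono-id (s ⇒ t) e   = e

mutual
  reflect-Eq : ∀ t {n m : Ne Γ t} → n ≡ m → Eq t (reflect t n) (reflect t m)
  reflect-Eq nm e = e
  reflect-Eq pr e = e
  reflect-Eq ac e = e
  reflect-Eq (s ⇒ t) {n} refl =
    (λ ρ e → reflect-Eq t (cong (app (renNe ρ n)) (reify-Eq s e))) ,
    (λ ρ σ e → Eq-trans t (reflect-mono t σ _)
      (reflect-Eq t (cong₂ app (renNe-∘ (λ _ → refl) n) (reify-mono s σ e))))

  reflect-mono : ∀ t (ρ : Ren Γ Δ) (n : Ne Γ t) → Eq t (mono t ρ (reflect t n)) (reflect t (renNe ρ n))
  reflect-mono nm ρ n = refl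
  reflect-mono pr ρ n = refl
  reflect-mono ac ρ n = refl
  reflect-mono (s ⇒ t) ρ n = Eq-⇒ s t (Eq-mono (s ⇒ t) ρ (reflect-Eq (s ⇒ t) refl))
    (λ σ e → reflect-Eq t (cong₂ app (sym (renNe-∘ (λ _ → refl) n)) (reify-Eq s e)))

  reify-Eq : ∀ t {v w : Val t Γ} → Eq t v w → reify t v ≡ reify t w
  reify-Eq nm e = cong nmN e
  reify-Eq pr e = cong prN e
  reify-Eq ac e = cong acN e
  reify-Eq (s ⇒ t) (p , _) = cong lam (reify-Eq t (p vs (reflect-Eq s refl)))

  reify-mono : ∀ t (ρ : Ren Γ Δ) {v w : Val t Γ} → Eq t v w → renNf ρ (reify t v) ≡ reify t (mono t ρ w)
  reify-mono nm ρ e = cong (λ n → nmN (renNe ρ n)) e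
  reify-mono pr ρ e = cong (λ n → prN (renNe ρ n)) e
  reify-mono ac ρ e = cong (λ n → acN (renNe ρ n)) e
  reify-mono (s ⇒ t) ρ (p , q) = cong lam (trans
    (reify-mono t (liftR ρ) (Eq-reflˡ t (p vs (reflect-Eq s refl))))
    (reify-Eq t (Eq-trans t (q vs (liftR ρ) (reflect-Eq s refl))
                  (Eq-reflˡ (s ⇒ t) (Eq-sym (s ⇒ t) (p , q)) .proj₁ (λ x → vs (ρ x)) (reflect-mono s (liftR ρ) (var vz))))))

EqE : Env Γ Δ → Env Γ Δ → Set
EqE {Γ} ρ ρ' = ∀ {t} (x : Var Γ t) → Eq t (ρ x) (ρ' x)

extE-Eq : {ρ ρ' : Env Γ Δ} {a b : Val s Δ} → EqE ρ ρ' → Eq s a b → EqE (extE ρ a) (extE ρ' b)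
extE-Eq h e vz     = e
extE-Eq h e (vs x) = h x

mutual
  eval-Eq : (M : Tm Γ t) {ρ ρ' : Env Γ Δ} → EqE ρ ρ' → Eq t (eval M ρ) (eval M ρ')
  eval-Eq (var x) h   = h x
  eval-Eq (con c) h   = reflect-Eq _ refl
  eval-Eq (app M N) h = eval-Eq M h .proj₁ (λ x → x) (eval-Eq N h)
  eval-Eq (lam {s} {t} M) h =
    (λ σ e → eval-Eq M (extE-Eq (λ {u} x → Eq-mono u σ (h x)) e)) ,
    (λ σ ς e → Eq-trans t (eval-mono M ς (extE-Eq (λ {u} x → Eq-mono u σ (h x)) e))
       (eval-Eq M λ { vz → Eq-mono s ς (Eq-reflʳ s e) ; {u} (vs x) → mono-∘ u ς σ (Eq-reflʳ u (h x)) }))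

  eval-mono : (M : Tm Γ t) (σ : Ren Δ Θ) {ρ ρ' : Env Γ Δ} → EqE ρ ρ' →
              Eq t (mono t σ (eval M ρ)) (eval M (monoE σ ρ'))
  eval-mono (var x) σ h   = Eq-mono _ σ (h x)
  eval-mono (con c) σ h   = reflect-mono _ σ (con c)
  eval-mono (app {s} {t} M N) σ h =
    Eq-trans t (eval-Eq M h .proj₂ (λ x → x) σ (eval-Eq N h))
      (eval-mono M σ (λ {u} x → Eq-reflʳ u (h x)) .proj₁ (λ x → x) (eval-mono N σ (λ {u} x → Eq-reflʳ u (h x))))
  eval-mono (lam {s} {t} M) σ h = Eq-⇒ s t (Eq-mono (s ⇒ t) σ (eval-Eq (lam M) (λ {u} x → Eq-reflˡ u (h x))))
    (λ ς e → eval-Eq M (extE-Eq (λ {u} x → Eq-sym u (mono-∘ u ς σ (Eq-sym u (h x)))) e))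

eval-ren : (M : Tm Γ t) (r : Ren Γ Δ) {ρ : Env Δ Θ} {ρ' : Env Γ Θ} → EqE ρ ρ → EqE (λ x → ρ (r x)) ρ' →
           Eq t (eval (ren r M) ρ) (eval M ρ')
eval-ren (var x) r k h   = h x
eval-ren (con c) r k h   = reflect-Eq _ refl
eval-ren (app M N) r k h = eval-ren M r k h .proj₁ (λ x → x) (eval-ren N r k h)
eval-ren (lam {s} {t} M) r k h = Eq-⇒ s t (eval-Eq (lam (ren (liftR r) M)) k)
  (λ σ e → eval-ren M (liftR r) (extE-Eq (λ {u} x → Eq-mono u σ (k x)) (Eq-reflˡ s e))
             λ { vz → e ; {u} (vs x) → Eq-mono u σ (h x) })

eval-sub : (M : Tm Γ t) (θ : Sub Γ Δ) {ρ : Env Δ Θ} {ρ' : Env Γ Θ} → EqE ρ ρ →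
           (∀ {t} (x : Var Γ t) → Eq t (eval (θ x) ρ) (ρ' x)) → Eq t (eval (sub θ M) ρ) (eval M ρ')
eval-sub (var x) θ k h   = h x
eval-sub (con c) θ k h   = reflect-Eq _ refl
eval-sub (app M N) θ k h = eval-sub M θ k h .proj₁ (λ x → x) (eval-sub N θ k h)
eval-sub (lam {s} {t} M) θ k h = Eq-⇒ s t (eval-Eq (lam (sub (liftS θ) M)) k)
  (λ σ e → eval-sub M (liftS θ) (extE-Eq (λ {u} x → Eq-mono u σ (k x)) (Eq-reflˡ s e))
     λ { vz → e
       ; {u} (vs x) → Eq-trans u (eval-ren (θ x) vs (extE-Eq (λ {w} y → Eq-mono w σ (k y)) (Eq-reflˡ s e))
                                     (λ {w} y → Eq-mono w σ (k y)))
                      (Eq-trans u (Eq-sym u (eval-mono (θ x) σ k)) (Eq-mono u σ (h x))) })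

eval-≈ : {M N : Tm Γ t} → M ≈ N → {ρ ρ' : Env Γ Δ} → EqE ρ ρ' → Eq t (eval M ρ) (eval N ρ')
eval-≈ {t = t} (β {M = M} {N}) {ρ} {ρ'} h = Eq-sym t (eval-sub M (sub1 N) (λ {u} x → Eq-reflʳ u (h x))
  λ { vz → Eq-sym _ (eval-Eq N h) ; {u} (vs x) → Eq-sym u (mono-id u (h x)) })
eval-≈ (η {s = s} {t} {M}) {ρ} {ρ'} h = Eq-⇒ s t (eval-Eq M (λ {u} x → Eq-reflˡ u (h x)))
  λ σ e → Eq-trans t (eval-mono M σ h .proj₁ (λ x → x) (Eq-reflˡ s e))
    (Eq-sym t (eval-ren M vs (extE-Eq (λ {u} x → Eq-mono u σ (Eq-reflʳ u (h x))) (Eq-reflʳ s e))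
                       (λ {u} x → Eq-mono u σ (Eq-reflʳ u (h x))) .proj₁ (λ x → x) (Eq-sym s e)))
eval-≈ (≈refl {M = M}) h = eval-Eq M h
eval-≈ {t = t} (≈sym p) h     = Eq-sym t (eval-≈ p (λ {u} x → Eq-sym u (h x)))
eval-≈ {t = t} (≈trans p q) h = Eq-trans t (eval-≈ p h) (eval-≈ q (λ {u} x → Eq-reflʳ u (h x)))
eval-≈ (appc p q) h   = eval-≈ p h .proj₁ (λ x → x) (eval-≈ q h)
eval-≈ (lamc {s = s} {t} {M} {M'} p) h = Eq-⇒ s t (eval-Eq (lam M) (λ {u} x → Eq-reflˡ u (h x)))
  (λ σ e → eval-≈ p (extE-Eq (λ {u} x → Eq-mono u σ (h x)) e))

idE-Eq : EqE {Γ} idE idE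
idE-Eq {t = t} x = reflect-Eq t refl

nf-≈ : {M N : Tm Γ t} → M ≈ N → nf M ≡ nf N
nf-≈ {t = t} p = reify-Eq t (eval-≈ p idE-Eq)

nf-ren : (ρ : Ren Γ Δ) (M : Tm Γ t) → nf (ren ρ M) ≡ renNf ρ (nf M)
nf-ren {t = t} ρ M = trans
  (reify-Eq t (Eq-trans t (eval-ren M ρ idE-Eq (λ {u} x → Eq-sym u (reflect-mono u ρ (var x))))
                          (Eq-sym t (eval-mono M ρ idE-Eq))))
  (sym (reify-mono t ρ (eval-Eq M idE-Eq)))

-- A logical relation between terms and values: every term converts to its normal form

LR : ∀ t → Tm Γ t → Val t Γ → Set
LR nm M v = M ≈ embNe v
LR pr M v = M ≈ embNe v
LR ac M v = M ≈ embNe v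
LR {Γ} (s ⇒ t) M f = ∀ {Δ} (ρ : Ren Γ Δ) {N a} → LR s N a → LR t (app (ren ρ M) N) (f ρ a)

LR-≈ : ∀ t {M N : Tm Γ t} {v} → M ≈ N → LR t N v → LR t M v
LR-≈ nm p l = ≈trans p l
LR-≈ pr p l = ≈trans p l
LR-≈ ac p l = ≈trans p l
LR-≈ (s ⇒ t) p l ρ k = LR-≈ t (appc (ren-≈ ρ p) ≈refl) (l ρ k)

LR-mono : ∀ t (ρ : Ren Γ Δ) {M : Tm Γ t} {v} → LR t M v → LR t (ren ρ M) (mono t ρ v)
LR-mono nm ρ {v = v} l = ≈trans (ren-≈ ρ l) (≡⇒≈ (sym (embNe-ren ρ v)))
LR-mono pr ρ {v = v} l = ≈trans (ren-≈ ρ l) (≡⇒≈ (sym (embNe-ren ρ v)))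
LR-mono ac ρ {v = v} l = ≈trans (ren-≈ ρ l) (≡⇒≈ (sym (embNe-ren ρ v)))
LR-mono (s ⇒ t) ρ {M} l σ k =
  LR-≈ t (appc (≡⇒≈ (ren-ren (λ _ → refl) M)) ≈refl) (l (λ x → σ (ρ x)) k)

mutual
  LR-reflect : ∀ t {M : Tm Γ t} (n : Ne Γ t) → M ≈ embNe n → LR t M (reflect t n)
  LR-reflect nm n p = p
  LR-reflect pr n p = p
  LR-reflect ac n p = p
  LR-reflect (s ⇒ t) n p ρ k = LR-reflect t _
    (appc (≈trans (ren-≈ ρ p) (≡⇒≈ (sym (embNe-ren ρ n)))) (LR-reify s k))

  LR-reify : ∀ t {M : Tm Γ t} {v} → LR t M v → M ≈ embNf (reify t v)
  LR-reify nm l = l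
  LR-reify pr l = l
  LR-reify ac l = l
  LR-reify (s ⇒ t) l = ≈trans η (lamc (LR-reify t (l vs (LR-reflect s (var vz) ≈refl))))

LR-eval : (M : Tm Γ t) {θ : Sub Γ Δ} {ρ : Env Γ Δ} → (∀ {t} (x : Var Γ t) → LR t (θ x) (ρ x)) →
          LR t (sub θ M) (eval M ρ)
LR-eval (var x) h   = h x
LR-eval (con c) h   = LR-reflect _ (con c) ≈refl
LR-eval (app M N) {θ} h = LR-≈ _ (appc (≡⇒≈ (sym (trans (ren-as-sub (λ _ → refl) (sub θ M)) (sub-id (λ _ → refl) _)))) ≈refl)
  (LR-eval M h (λ x → x) (LR-eval N h))
LR-eval (lam {s} {t} M) {θ} h σ {N} k = LR-≈ t
  (≈trans β (≡⇒≈ (trans (sub-ren {ξ = λ x → sub1 N (liftR σ x)} (λ _ → refl) (sub (liftS θ) M))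
     (sub-sub {ζ = (λ x → ren σ (θ x)) ▸ N}
       (λ { vz → refl ; (vs x) → trans (sub-ren (λ _ → refl) (θ x)) (sym (ren-as-sub (λ _ → refl) (θ x))) }) M))))
  (LR-eval M λ { vz → k ; {u} (vs x) → LR-mono u σ (h x) })

≈-nf : (M : Tm Γ t) → M ≈ embNf (nf M)
≈-nf {t = t} M = ≈trans (≡⇒≈ (sym (sub-id (λ _ → refl) M)))
  (LR-reify t (LR-eval M (λ {u} x → LR-reflect u (var x) ≈refl)))

nf-injective : {M N : Tm Γ t} → nf M ≡ nf N → M ≈ N
nf-injective {M = M} {N} e = ≈trans (≈-nf M) (≈trans (≡⇒≈ (cong embNf e)) (≈sym (≈-nf N)))

-- Injectivity and disjointness of the constructors modulo βη

app-injective : {n n' : Ne Γ (s ⇒ t)} {m m' : Nf Γ s} → Ne.app n m ≡ app n' m' → n ≡ n' × m ≡ m'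
app-injective refl = refl , refl

prN-injective : {n n' : Ne Γ pr} → prN n ≡ prN n' → n ≡ n'
prN-injective refl = refl

acN-injective : {n n' : Ne Γ ac} → acN n ≡ acN n' → n ≡ n'
acN-injective refl = refl

-- Evaluating an application passes the identity renaming to `reflect`, so in the normal form of a
-- curried constant each earlier argument is wrapped in as many identity renamings as there are
-- arguments after it. This strips one of them.
renNf-id-injective : {a b : Nf Γ t} → renNf (λ x → x) a ≡ renNf (λ x → x) b → a ≡ b
renNf-id-injective {a = a} {b} e = trans (sym (renNf-id (λ _ → refl) a)) (trans e (renNf-id (λ _ → refl) b))

con1-injective : (c : Const (s ⇒ pr)) {M M' : Tm Γ s} → con c · M ≈ con c · M' → M ≈ M'
con1-injective c p = nf-injective (proj₂ (app-injective (prN-injective (nf-≈ p))))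

con2-injective : (c : Const (s ⇒ t ⇒ pr)) {M M' : Tm Γ s} {N N' : Tm Γ t} →
                 con c · M · N ≈ con c · M' · N' → M ≈ M' × N ≈ N'
con2-injective c p with app-injective (prN-injective (nf-≈ p))
... | q , r = nf-injective (renNf-id-injective (proj₂ (app-injective q))) , nf-injective r

con3-injective : (c : Const (s ⇒ t ⇒ u ⇒ pr)) {M M' : Tm Γ s} {N N' : Tm Γ t} {L L' : Tm Γ u} →
                 con c · M · N · L ≈ con c · M' · N' · L' → M ≈ M' × N ≈ N' × L ≈ L'
con3-injective c p with app-injective (prN-injective (nf-≈ p))
... | q , r with app-injective q
... | q' , r' = nf-injective (renNf-id-injective (renNf-id-injective (proj₂ (app-injective q')))) ,
                nf-injective (renNf-id-injective r') , nf-injective r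

label-injective : (c : Const (s ⇒ t ⇒ ac)) {M M' : Tm Γ s} {N N' : Tm Γ t} →
                con c · M · N ≈ con c · M' · N' → M ≈ M' × N ≈ N'
label-injective c p with app-injective (acN-injective (nf-≈ p))
... | q , r = nf-injective (renNf-id-injective (proj₂ (app-injective q))) , nf-injective r

-- Tags start at 1 because `headNe` gives 0 to variables; the same numbers reappear as the literal
-- indices of `ShapeOf`.
tag : Const t → ℕ
tag τA     = 1
tag ↓C     = 2
tag ↑C     = 3
tag zeroC  = 4
tag τC     = 5
tag outC   = 6
tag inC    = 7
tag plusC  = 8
tag parC   = 9
tag matchC = 10
tag nuC    = 11

headNe : Ne Γ t → ℕ
headNe (var x)   = 0
headNe (con c)   = tag c
headNe (app n m) = headNe n

headNf : Nf Γ t → ℕ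
headNf (nmN n) = headNe n
headNf (prN n) = headNe n
headNf (acN n) = headNe n
headNf (lam n) = 0

head-≈ : {M N : Tm Γ t} → M ≈ N → headNf (nf M) ≡ headNf (nf N)
head-≈ p = cong headNf (nf-≈ p)

var-injective : {x y : Var Γ nm} → Tm.var x ≈ var y → x ≡ y
var-injective p with nf-≈ p
... | refl = refl

fst₂ snd₂ : Sub (nm ∷ Γ) (nm ∷ nm ∷ Γ)
fst₂ = (λ x → var (vs (vs x))) ▸ var vz
snd₂ = (λ x → var (vs (vs x))) ▸ var (vs vz)

-- Two substitutions that differ only at the new variable detect every occurrence of it.
wk-invariant : {A : Tm Γ t} {N : Tm (nm ∷ Γ) t} → ren vs A ≈ N → sub fst₂ N ≈ sub snd₂ N
wk-invariant {A = A} p = ≈trans (≈sym (sub-≈ _ p)) (≈trans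
  (≡⇒≈ (trans (sub-ren (λ _ → refl) A) (sym (sub-ren (λ _ → refl) A)))) (sub-≈ _ p))

wk≉vz : {M : Tm Γ nm} → ¬ (ren vs M ≈ var vz)
wk≉vz {M = M} p with var-injective (wk-invariant {A = M} p)
... | ()

-- Substituting any term for the new variable undoes weakening. The argument `N` supplies one, since
-- `s` may be uninhabited over `Γ`.
wk-cancel : (N : Tm Γ s) {M M' : Tm Γ t} → ren (vs {s = s}) M ≈ ren vs M' → M ≈ M'
wk-cancel N {M} {M'} p = ≈trans (≡⇒≈ (sym (sub1-wk N M))) (≈trans (sub-≈ (sub1 N) p) (≡⇒≈ (sub1-wk N M')))

-- Here no term of type `s` need exist over `Γ`, so `wk-cancel` is out of reach; instead the normal
-- form is inspected, which can only be the constant.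
wk-τ : {A : Tm Γ ac} → ren (vs {s = s}) A ≈ τT → A ≈ τT
wk-τ {s = s} {A = A} p = nf-injective (strengthen (nf A) (trans (sym (nf-ren vs A)) (nf-≈ p)))
  where
  strengthen : (a : Nf _ ac) → renNf (vs {s = s}) a ≡ acN (con τA) → a ≡ acN (con τA)
  strengthen (acN (con τA)) e = refl

-- Decidability of βη at normal forms, which are written as words in prefix notation

index : Var Γ t → ℕ
index vz     = 0
index (vs x) = suc (index x)

index-injective : (x : Var Γ s) (y : Var Γ t) → index x ≡ index y → _≡_ {A = Σ Ty (Var Γ)} (s , x) (t , y)
index-injective vz     vz     e = refl
index-injective (vs x) (vs y) e with index-injective x y (suc-injective e)
... | refl = refl

untag : ℕ → Σ Ty Const
untag 1  = _ , τA
untag 2  = _ , ↓C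
untag 3  = _ , ↑C
untag 4  = _ , zeroC
untag 5  = _ , τC
untag 6  = _ , outC
untag 7  = _ , inC
untag 8  = _ , plusC
untag 9  = _ , parC
untag 10 = _ , matchC
untag _  = _ , nuC

untag-tag : (c : Const t) → untag (tag c) ≡ (t , c)
untag-tag τA     = refl
untag-tag ↓C     = refl
untag-tag ↑C     = refl
untag-tag zeroC  = refl
untag-tag τC     = refl
untag-tag outC   = refl
untag-tag inC    = refl
untag-tag plusC  = refl
untag-tag parC   = refl
untag-tag matchC = refl
untag-tag nuC    = refl

mutual
  codeNe : Ne Γ t → List ℕ → List ℕ
  codeNe (var x)   w = 0 ∷ index x ∷ w
  codeNe (con c)   w = 1 ∷ tag c ∷ w
  codeNe (app n m) w = 2 ∷ codeNe n (codeNf m w)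

  codeNf : Nf Γ t → List ℕ → List ℕ
  codeNf (nmN n) w = codeNe n w
  codeNf (prN n) w = codeNe n w
  codeNf (acN n) w = codeNe n w
  codeNf (lam n) w = codeNf n w

mutual
  -- A neutral determines its type through its head, whereas a normal form is decoded at a type
  -- already known. So neutrals are compared as dependent pairs, and `lam` leaves no mark in the
  -- code. The equality of the remaining words lets the decoding of an application go on with its
  -- argument.
  codeNe-injective : (n : Ne Γ s) (m : Ne Γ t) {w w' : List ℕ} → codeNe n w ≡ codeNe m w' →
                     _≡_ {A = Σ Ty (Ne Γ)} (s , n) (t , m) × w ≡ w'
  codeNe-injective (var x) (var y) e with ∷-injective (∷-injectiveʳ e)
  ... | q , r with index-injective x y q
  ... | refl = refl , r
  codeNe-injective (con c) (con d) e with ∷-injective (∷-injectiveʳ e)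
  ... | q , r with trans (sym (untag-tag c)) (trans (cong untag q) (untag-tag d))
  ... | refl = refl , r
  codeNe-injective (app n m) (app n' m') e with codeNe-injective n n' (∷-injectiveʳ e)
  ... | refl , q with codeNf-injective m m' q
  ... | refl , r = refl , r

  codeNf-injective : (n m : Nf Γ t) {w w' : List ℕ} → codeNf n w ≡ codeNf m w' → n ≡ m × w ≡ w'
  codeNf-injective (nmN n) (nmN m) e with codeNe-injective n m e
  ... | refl , r = refl , r
  codeNf-injective (prN n) (prN m) e with codeNe-injective n m e
  ... | refl , r = refl , r
  codeNf-injective (acN n) (acN m) e with codeNe-injective n m e
  ... | refl , r = refl , r
  codeNf-injective (lam n) (lam m) e with codeNf-injective n m e
  ... | refl , r = refl , r

_≈?_ : (M N : Tm Γ t) → Dec (M ≈ N)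
M ≈? N with ≡-dec _≟_ (codeNf (nf M) []) (codeNf (nf N) [])
... | yes e = yes (nf-injective (proj₁ (codeNf-injective (nf M) (nf N) e)))
... | no ¬e = no λ p → ¬e (cong (λ n → codeNf n []) (nf-≈ p))

-- The signature of the term model: a zero and a successor give infinitely many closed names.
G₀ : Ctx
G₀ = nm ∷ (nm ⇒ nm) ∷ []

wkL : (σ : Ctx) → Ren Γ (σ ++ Γ)
wkL []      x = x
wkL (s ∷ σ) x = vs (wkL σ x)

numeral : (σ : Ctx) → ℕ → Tm (σ ++ G₀) nm
numeral σ zero    = var (wkL σ vz)
numeral σ (suc k) = app (var (wkL σ (vs vz))) (numeral σ k)

depthNe : Ne Γ t → ℕ
depthNf : Nf Γ t → ℕ
depthNe (var x)   = 0
depthNe (con c)   = 0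
depthNe (app n m) = suc (depthNf m)
depthNf (nmN n) = depthNe n
depthNf (prN n) = depthNe n
depthNf (acN n) = depthNe n
depthNf (lam n) = depthNf n

depth-numeral : ∀ σ k → depthNf (nf (numeral σ k)) ≡ k
depth-numeral σ zero    = refl
depth-numeral σ (suc k) = cong suc (depth-numeral σ k)

bounded : (f : Fin n → ℕ) → ∃ λ b → ∀ i → f i < b
bounded {zero}  f = 0 , λ ()
bounded {suc n} f with bounded (λ i → f (suc i))
... | b , h = suc (f zero) ⊔ b ,
  λ { zero → m≤m⊔n (suc (f zero)) b ; (suc i) → ≤-trans (h i) (m≤n⊔m (suc (f zero)) b) }

-- Convertible terms have the same normal form and hence the same depth, so a numeral deeper than
-- all the known names converts to none of them, under any local variables.
freshName : (σ : Ctx) (e : Fin n → Tm (σ ++ G₀) nm) → ∃ λ T → ∀ i → ¬ (e i ≈ T)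
freshName σ e with bounded (λ i → depthNf (nf (e i)))
... | b , h = numeral σ b , λ i p → <-irrefl (trans (cong depthNf (nf-≈ p)) (depth-numeral σ b)) (h i)

-- Scoped processes, and their readings as processes and as terms

data Pr (n : ℕ) : Set where
  nil′ : Pr n
  out′ : Fin n → Fin n → Pr n → Pr n
  inp′ : Fin n → Pr (suc n) → Pr n
  tau′ : Pr n → Pr n
  res′ : Pr (suc n) → Pr n
  mat′ : Fin n → Fin n → Pr n → Pr n
  par′ sum′ : Pr n → Pr n → Pr n

_▹_ : ∀ {A : Set} → (Fin n → A) → A → Fin (suc n) → A
(f ▹ a) zero    = a
(f ▹ a) (suc i) = f i

liftF : (Fin n → Fin m) → Fin (suc n) → Fin (suc m)
liftF f = (λ i → suc (f i)) ▹ zero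

mapPr : (Fin n → Fin m) → Pr n → Pr m
mapPr f nil′         = nil′
mapPr f (out′ x y p) = out′ (f x) (f y) (mapPr f p)
mapPr f (inp′ x p)   = inp′ (f x) (mapPr (liftF f) p)
mapPr f (tau′ p)     = tau′ (mapPr f p)
mapPr f (res′ p)     = res′ (mapPr (liftF f) p)
mapPr f (mat′ x y p) = mat′ (f x) (f y) (mapPr f p)
mapPr f (par′ p q)   = par′ (mapPr f p) (mapPr f q)
mapPr f (sum′ p q)   = sum′ (mapPr f p) (mapPr f q)

wkPr : Pr n → Pr (suc n)
wkPr = mapPr suc

upNm : (Fin n → Nm k) → Fin (suc n) → Nm (suc k)
upNm f = (λ i → wkNm (f i)) ▹ bd zero

toP : (Fin n → Nm k) → Pr n → Proc k
toP f nil′         = nil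
toP f (out′ x y p) = out (f x) (f y) (toP f p)
toP f (inp′ x p)   = inp (f x) (toP (upNm f) p)
toP f (tau′ p)     = tau (toP f p)
toP f (res′ p)     = res (toP (upNm f) p)
toP f (mat′ x y p) = mat (f x) (f y) (toP f p)
toP f (par′ p q)   = par (toP f p) (toP f q)
toP f (sum′ p q)   = sum (toP f p) (toP f q)

upT : (Fin n → Tm Γ nm) → Fin (suc n) → Tm (nm ∷ Γ) nm
upT e = (λ i → ren vs (e i)) ▹ var vz

trT : (Fin n → Tm Γ nm) → Pr n → Tm Γ pr
trT e nil′         = con zeroC
trT e (out′ x y p) = outT (e x) (e y) (trT e p)
trT e (inp′ x p)   = inT (e x) (lam (trT (upT e) p))
trT e (tau′ p)     = τP (trT e p)
trT e (res′ p)     = νT (lam (trT (upT e) p))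
trT e (mat′ x y p) = matchT (e x) (e y) (trT e p)
trT e (par′ p q)   = trT e p ∥ trT e q
trT e (sum′ p q)   = trT e p ⊕ trT e q

Occ : Fin n → Pr n → Set
Occ i nil′         = ⊥
Occ i (out′ x y p) = i ≡ x ⊎ i ≡ y ⊎ Occ i p
Occ i (inp′ x p)   = i ≡ x ⊎ Occ (suc i) p
Occ i (tau′ p)     = Occ i p
Occ i (res′ p)     = Occ (suc i) p
Occ i (mat′ x y p) = i ≡ x ⊎ i ≡ y ⊎ Occ i p
Occ i (par′ p q)   = Occ i p ⊎ Occ i q
Occ i (sum′ p q)   = Occ i p ⊎ Occ i q

cong₃ : ∀ {A B C D : Set} (f : A → B → C → D) {a a' b b' c c'} → a ≡ a' → b ≡ b' → c ≡ c' → f a b c ≡ f a' b' c'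
cong₃ f refl refl refl = refl

up-map : (f : Fin m → Nm k) (g : Fin n → Fin m) {h : Fin n → Nm k} → (∀ i → f (g i) ≡ h i) →
         ∀ i → upNm f (liftF g i) ≡ upNm h i
up-map f g e zero    = refl
up-map f g e (suc i) = cong wkNm (e i)

toP-map : {f : Fin m → Nm k} {g : Fin n → Fin m} {h : Fin n → Nm k} → (∀ i → f (g i) ≡ h i) →
          (p : Pr n) → toP f (mapPr g p) ≡ toP h p
toP-map e nil′         = refl
toP-map e (out′ x y p) = cong₃ out (e x) (e y) (toP-map e p)
toP-map e (inp′ x p)   = cong₂ inp (e x) (toP-map (up-map _ _ e) p)
toP-map e (tau′ p)     = cong tau (toP-map e p)
toP-map e (res′ p)     = cong res (toP-map (up-map _ _ e) p)
toP-map e (mat′ x y p) = cong₃ mat (e x) (e y) (toP-map e p)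
toP-map e (par′ p q)   = cong₂ par (toP-map e p) (toP-map e q)
toP-map e (sum′ p q)   = cong₂ sum (toP-map e p) (toP-map e q)

liftNm-wk : (g : Nm k → Nm m) (x : Nm k) → liftNm g (wkNm x) ≡ wkNm (g x)
liftNm-wk g (fr a) = refl
liftNm-wk g (bd i) = refl

-- Agreement is required only where an index occurs: closing and renaming compare names, and an
-- index without occurrences may carry the very name that is being replaced.
mapP-toP : {g : Nm k → Nm m} {f : Fin n → Nm k} {h : Fin n → Nm m} (p : Pr n) →
           (∀ i → Occ i p → g (f i) ≡ h i) → mapP g (toP f p) ≡ toP h p

mapP-up : {g : Nm k → Nm m} {f : Fin n → Nm k} {h : Fin n → Nm m} (p : Pr (suc n)) →
          (∀ i → Occ (suc i) p → g (f i) ≡ h i) → mapP (liftNm g) (toP (upNm f) p) ≡ toP (upNm h) p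
mapP-up {g = g} {f} p e = mapP-toP p λ { zero o → refl ; (suc i) o → trans (liftNm-wk g (f i)) (cong wkNm (e i o)) }

mapP-toP nil′         e = refl
mapP-toP (out′ x y p) e = cong₃ out (e x (inj₁ refl)) (e y (inj₂ (inj₁ refl))) (mapP-toP p (λ i o → e i (inj₂ (inj₂ o))))
mapP-toP (inp′ x p)   e = cong₂ inp (e x (inj₁ refl)) (mapP-up p (λ i o → e i (inj₂ o)))
mapP-toP (tau′ p)     e = cong tau (mapP-toP p e)
mapP-toP (res′ p)     e = cong res (mapP-up p e)
mapP-toP (mat′ x y p) e = cong₃ mat (e x (inj₁ refl)) (e y (inj₂ (inj₁ refl))) (mapP-toP p (λ i o → e i (inj₂ (inj₂ o))))
mapP-toP (par′ p q)   e = cong₂ par (mapP-toP p (λ i o → e i (inj₁ o))) (mapP-toP q (λ i o → e i (inj₂ o)))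
mapP-toP (sum′ p q)   e = cong₂ sum (mapP-toP p (λ i o → e i (inj₁ o))) (mapP-toP q (λ i o → e i (inj₂ o)))

trT-map : {e : Fin m → Tm Γ nm} {g : Fin n → Fin m} {h : Fin n → Tm Γ nm} → (∀ i → e (g i) ≡ h i) →
          (p : Pr n) → trT e (mapPr g p) ≡ trT h p
trT-map q nil′         = refl
trT-map q (out′ x y p) = cong₃ outT (q x) (q y) (trT-map q p)
trT-map q (inp′ x p)   = cong₂ inT (q x) (cong lam (trT-map (λ { zero → refl ; (suc i) → cong (ren vs) (q i) }) p))
trT-map q (tau′ p)     = cong τP (trT-map q p)
trT-map q (res′ p)     = cong νT (cong lam (trT-map (λ { zero → refl ; (suc i) → cong (ren vs) (q i) }) p))
trT-map q (mat′ x y p) = cong₃ matchT (q x) (q y) (trT-map q p)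
trT-map q (par′ p r)   = cong₂ _∥_ (trT-map q p) (trT-map q r)
trT-map q (sum′ p r)   = cong₂ _⊕_ (trT-map q p) (trT-map q r)

sub-trT : {θ : Sub Γ Δ} {e : Fin n → Tm Γ nm} {h : Fin n → Tm Δ nm} → (∀ i → sub θ (e i) ≡ h i) →
          (p : Pr n) → sub θ (trT e p) ≡ trT h p
sub-trT q nil′         = refl
sub-trT q (out′ x y p) = cong₃ outT (q x) (q y) (sub-trT q p)
sub-trT {θ = θ} {e} q (inp′ x p) = cong₂ inT (q x) (cong lam (sub-trT (λ { zero → refl ; (suc i) → trans (sub-wk θ (e i)) (cong (ren vs) (q i)) }) p))
sub-trT q (tau′ p)     = cong τP (sub-trT q p)
sub-trT {θ = θ} {e} q (res′ p)   = cong νT (cong lam (sub-trT (λ { zero → refl ; (suc i) → trans (sub-wk θ (e i)) (cong (ren vs) (q i)) }) p))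
sub-trT q (mat′ x y p) = cong₃ matchT (q x) (q y) (sub-trT q p)
sub-trT q (par′ p r)   = cong₂ _∥_ (sub-trT q p) (sub-trT q r)
sub-trT q (sum′ p r)   = cong₂ _⊕_ (sub-trT q p) (sub-trT q r)

ren-trT : {ρ : Ren Γ Δ} {e : Fin n → Tm Γ nm} {h : Fin n → Tm Δ nm} → (∀ i → ren ρ (e i) ≡ h i) →
          (p : Pr n) → ren ρ (trT e p) ≡ trT h p
ren-trT {ρ = ρ} {e} q p = trans (ren-as-sub (λ _ → refl) (trT e p))
  (sub-trT (λ i → trans (sym (ren-as-sub (λ _ → refl) (e i))) (q i)) p)

trT-≈ : {e h : Fin n → Tm Γ nm} → (∀ i → e i ≈ h i) → (p : Pr n) → trT e p ≈ trT h p
trT-≈ q nil′         = ≈refl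
trT-≈ q (out′ x y p) = appc (appc (appc ≈refl (q x)) (q y)) (trT-≈ q p)
trT-≈ q (inp′ x p)   = appc (appc ≈refl (q x)) (lamc (trT-≈ (λ { zero → ≈refl ; (suc i) → ren-≈ vs (q i) }) p))
trT-≈ q (tau′ p)     = appc ≈refl (trT-≈ q p)
trT-≈ q (res′ p)     = appc ≈refl (lamc (trT-≈ (λ { zero → ≈refl ; (suc i) → ren-≈ vs (q i) }) p))
trT-≈ q (mat′ x y p) = appc (appc (appc ≈refl (q x)) (q y)) (trT-≈ q p)
trT-≈ q (par′ p r)   = appc (appc ≈refl (trT-≈ q p)) (trT-≈ q r)
trT-≈ q (sum′ p r)   = appc (appc ≈refl (trT-≈ q p)) (trT-≈ q r)

-- The clauses of D_π as a transition system on scoped processes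

data Act′ (n : ℕ) : Set where
  τ′   : Act′ n
  out′ : Fin n → Fin n → Act′ n

wkAct : Act′ n → Act′ (suc n)
wkAct τ′         = τ′
wkAct (out′ x y) = out′ (suc x) (suc y)

data Dir : Set where
  dn up : Dir

opp : Dir → Dir
opp dn = up
opp up = dn

inst : Fin n → Pr (suc n) → Pr n
inst y = mapPr ((λ i → i) ▹ y)

swap : Fin (suc (suc n)) → Fin (suc (suc n))
swap zero          = suc zero
swap (suc zero)    = zero
swap (suc (suc i)) = suc (suc i)

mutual
  -- A bound transition has as its target an abstraction in `Pr (suc n)`, as in the clauses for
  -- `onep`. No bound name is ever chosen, so the rules carry no freshness conditions; these arise
  -- only in the comparison with the named transitions.
  data Step {n : ℕ} : Pr n → Act′ n → Pr n → Set where
    tau  : ∀ {p} → Step (tau′ p) τ′ p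
    out  : ∀ {x y p} → Step (out′ x y p) (out′ x y) p
    mat  : ∀ {x p α p'} → Step p α p' → Step (mat′ x x p) α p'
    sumL : ∀ {p q α p'} → Step p α p' → Step (sum′ p q) α p'
    sumR : ∀ {p q α q'} → Step q α q' → Step (sum′ p q) α q'
    parL : ∀ {p q α p'} → Step p α p' → Step (par′ p q) α (par′ p' q)
    parR : ∀ {p q α q'} → Step q α q' → Step (par′ p q) α (par′ p q')
    res  : ∀ {p α p'} → Step p (wkAct α) p' → Step (res′ p) α (res′ p')
    close : ∀ d {p q x m m'} → Stepp p d x m → Stepp q (opp d) x m' → Step (par′ p q) τ′ (res′ (par′ m m'))
    comL : ∀ {p q x y m q'} → Stepp p dn x m → Step q (out′ x y) q' → Step (par′ p q) τ′ (par′ (inst y m) q')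
    comR : ∀ {p q x y p' m} → Step p (out′ x y) p' → Stepp q dn x m → Step (par′ p q) τ′ (par′ p' (inst y m))

  data Stepp {n : ℕ} : Pr n → Dir → Fin n → Pr (suc n) → Set where
    inp  : ∀ {x m} → Stepp (inp′ x m) dn x m
    mat  : ∀ {x p d z m} → Stepp p d z m → Stepp (mat′ x x p) d z m
    sumL : ∀ {p q d x m} → Stepp p d x m → Stepp (sum′ p q) d x m
    sumR : ∀ {p q d x m} → Stepp q d x m → Stepp (sum′ p q) d x m
    parL : ∀ {p q d x m} → Stepp p d x m → Stepp (par′ p q) d x (par′ m (wkPr q))
    parR : ∀ {p q d x m} → Stepp q d x m → Stepp (par′ p q) d x (par′ (wkPr p) m)
    -- In `m` the transmitted name is index 0 and the restricted one index 1; under `res′` they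
    -- stand in the opposite order.
    res  : ∀ {p d x m} → Stepp p d (suc x) m → Stepp (res′ p) d x (res′ (mapPr swap m))
    open′ : ∀ {p x m} → Step p (out′ (suc x) zero) m → Stepp (res′ p) up x m

OccA : Fin n → Act′ n → Set
OccA i τ′         = ⊥
OccA i (out′ x y) = i ≡ x ⊎ i ≡ y

OccA-wk : ∀ {i : Fin n} α → OccA i α → OccA (suc i) (wkAct α)
OccA-wk (out′ x y) (inj₁ refl) = inj₁ refl
OccA-wk (out′ x y) (inj₂ refl) = inj₂ refl

Occ-map : (f : Fin n → Fin m) (p : Pr n) {j : Fin m} → Occ j (mapPr f p) → ∃ λ i → Occ i p × f i ≡ j

Occ-lift : (f : Fin n → Fin m) (p : Pr (suc n)) {j : Fin m} → Occ (suc j) (mapPr (liftF f) p) → ∃ λ i → Occ (suc i) p × f i ≡ j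
Occ-lift f p o with Occ-map (liftF f) p o
... | suc i , o' , refl = i , o' , refl

Occ-map f (out′ x y p) (inj₁ refl)        = x , inj₁ refl , refl
Occ-map f (out′ x y p) (inj₂ (inj₁ refl)) = y , inj₂ (inj₁ refl) , refl
Occ-map f (out′ x y p) (inj₂ (inj₂ o))    = map₂ (map₁ (λ o' → inj₂ (inj₂ o'))) (Occ-map f p o)
Occ-map f (inp′ x p)   (inj₁ refl)        = x , inj₁ refl , refl
Occ-map f (inp′ x p)   (inj₂ o)           = map₂ (map₁ inj₂) (Occ-lift f p o)
Occ-map f (tau′ p)     o                  = Occ-map f p o
Occ-map f (res′ p)     o                  = Occ-lift f p o
Occ-map f (mat′ x y p) (inj₁ refl)        = x , inj₁ refl , refl
Occ-map f (mat′ x y p) (inj₂ (inj₁ refl)) = y , inj₂ (inj₁ refl) , refl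
Occ-map f (mat′ x y p) (inj₂ (inj₂ o))    = map₂ (map₁ (λ o' → inj₂ (inj₂ o'))) (Occ-map f p o)
Occ-map f (par′ p q)   (inj₁ o)           = map₂ (map₁ inj₁) (Occ-map f p o)
Occ-map f (par′ p q)   (inj₂ o)           = map₂ (map₁ inj₂) (Occ-map f q o)
Occ-map f (sum′ p q)   (inj₁ o)           = map₂ (map₁ inj₁) (Occ-map f p o)
Occ-map f (sum′ p q)   (inj₂ o)           = map₂ (map₁ inj₂) (Occ-map f q o)

Occ-wk : (q : Pr n) {i : Fin n} → Occ (suc i) (wkPr q) → Occ i q
Occ-wk q o with Occ-map suc q o
... | i , o' , refl = o'

Occ-swap : (m : Pr (suc (suc n))) {i : Fin n} → Occ (suc (suc i)) (mapPr swap m) → Occ (suc (suc i)) m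
Occ-swap m o with Occ-map swap m o
... | suc (suc i) , o' , refl = o'

mutual
  Step-label : {p p' : Pr n} {α : Act′ n} → Step p α p' → ∀ {i} → OccA i α → Occ i p
  Step-label out (inj₁ refl)   = inj₁ refl
  Step-label out (inj₂ refl)   = inj₂ (inj₁ refl)
  Step-label (mat s) o         = inj₂ (inj₂ (Step-label s o))
  Step-label (sumL s) o        = inj₁ (Step-label s o)
  Step-label (sumR s) o        = inj₂ (Step-label s o)
  Step-label (parL s) o        = inj₁ (Step-label s o)
  Step-label (parR s) o        = inj₂ (Step-label s o)
  Step-label (res {α = α} s) o = Step-label s (OccA-wk α o)

  -- Transitions invent no names. This carries injectivity of a naming, and freshness of a name,
  -- from a process to its derivatives.
  Step-occ : {p p' : Pr n} {α : Act′ n} → Step p α p' → ∀ {i} → Occ i p' → Occ i p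
  Step-occ tau o             = o
  Step-occ out o             = inj₂ (inj₂ o)
  Step-occ (mat s) o         = inj₂ (inj₂ (Step-occ s o))
  Step-occ (sumL s) o        = inj₁ (Step-occ s o)
  Step-occ (sumR s) o        = inj₂ (Step-occ s o)
  Step-occ (parL s) (inj₁ o) = inj₁ (Step-occ s o)
  Step-occ (parL s) (inj₂ o) = inj₂ o
  Step-occ (parR s) (inj₁ o) = inj₁ o
  Step-occ (parR s) (inj₂ o) = inj₂ (Step-occ s o)
  Step-occ (res s) o         = Step-occ s o
  Step-occ (close d s r) (inj₁ o) = inj₁ (Stepp-occ s o)
  Step-occ (close d s r) (inj₂ o) = inj₂ (Stepp-occ r o)
  Step-occ (comL {m = m} s r) (inj₁ o) with Occ-map _ m o
  ... | zero  , o' , refl = inj₂ (Step-label r (inj₂ refl))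
  ... | suc i , o' , refl = inj₁ (Stepp-occ s o')
  Step-occ (comL s r) (inj₂ o) = inj₂ (Step-occ r o)
  Step-occ (comR s r) (inj₁ o) = inj₁ (Step-occ s o)
  Step-occ (comR {m = m} s r) (inj₂ o) with Occ-map _ m o
  ... | zero  , o' , refl = inj₁ (Step-label s (inj₂ refl))
  ... | suc i , o' , refl = inj₂ (Stepp-occ r o')

  Stepp-label : {p : Pr n} {d : Dir} {x : Fin n} {m : Pr (suc n)} → Stepp p d x m → Occ x p
  Stepp-label inp       = inj₁ refl
  Stepp-label (mat s)   = inj₂ (inj₂ (Stepp-label s))
  Stepp-label (sumL s)  = inj₁ (Stepp-label s)
  Stepp-label (sumR s)  = inj₂ (Stepp-label s)
  Stepp-label (parL s)  = inj₁ (Stepp-label s)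
  Stepp-label (parR s)  = inj₂ (Stepp-label s)
  Stepp-label (res s)   = Stepp-label s
  Stepp-label (open′ s) = Step-label s (inj₁ refl)

  Stepp-occ : {p : Pr n} {d : Dir} {x : Fin n} {m : Pr (suc n)} → Stepp p d x m → ∀ {i} → Occ (suc i) m → Occ i p
  Stepp-occ inp o              = inj₂ o
  Stepp-occ (mat s) o          = inj₂ (inj₂ (Stepp-occ s o))
  Stepp-occ (sumL s) o         = inj₁ (Stepp-occ s o)
  Stepp-occ (sumR s) o         = inj₂ (Stepp-occ s o)
  Stepp-occ (parL s) (inj₁ o)  = inj₁ (Stepp-occ s o)
  Stepp-occ (parL {q = q} s) (inj₂ o) = inj₂ (Occ-wk q o)
  Stepp-occ (parR {p = p} s) (inj₁ o) = inj₁ (Occ-wk p o)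
  Stepp-occ (parR s) (inj₂ o)  = inj₂ (Stepp-occ s o)
  Stepp-occ (res {m = m} s) o  = Stepp-occ s (Occ-swap m o)
  Stepp-occ (open′ s) o        = Step-occ s o

-- Scoped processes against the transition relation of Milner, Parrow and Walker

wkNm-fr : (x : Nm k) {a : ℕ} → wkNm x ≡ fr a → x ≡ fr a
wkNm-fr (fr b) refl = refl

fnNm-fr : (x : Nm k) {a : ℕ} → a ∈ fnNm x → x ≡ fr a
fnNm-fr (fr b) (here refl) = refl

fr-fnNm : {x : Nm k} {a : ℕ} → x ≡ fr a → a ∈ fnNm x
fr-fnNm refl = here refl

fn-toP⁻ : {f : Fin n → Nm k} (p : Pr n) {a : ℕ} → a ∈ fn (toP f p) → ∃ λ i → Occ i p × f i ≡ fr a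

fn-up⁻ : {f : Fin n → Nm k} (p : Pr (suc n)) {a : ℕ} → a ∈ fn (toP (upNm f) p) → ∃ λ i → Occ (suc i) p × f i ≡ fr a
fn-up⁻ {f = f} p h with fn-toP⁻ p h
... | suc i , o , e = i , o , wkNm-fr (f i) e

fn-toP⁻ {f = f} (out′ x y p) h with ∈-++⁻ (fnNm (f x)) h
... | inj₁ h' = x , inj₁ refl , fnNm-fr (f x) h'
... | inj₂ h' with ∈-++⁻ (fnNm (f y)) h'
... | inj₁ h″ = y , inj₂ (inj₁ refl) , fnNm-fr (f y) h″
... | inj₂ h″ = map₂ (map₁ (λ o → inj₂ (inj₂ o))) (fn-toP⁻ p h″)
fn-toP⁻ {f = f} (inp′ x p) h with ∈-++⁻ (fnNm (f x)) h
... | inj₁ h' = x , inj₁ refl , fnNm-fr (f x) h'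
... | inj₂ h' = map₂ (map₁ inj₂) (fn-up⁻ p h')
fn-toP⁻ (tau′ p) h = fn-toP⁻ p h
fn-toP⁻ (res′ p) h = fn-up⁻ p h
fn-toP⁻ {f = f} (mat′ x y p) h with ∈-++⁻ (fnNm (f x)) h
... | inj₁ h' = x , inj₁ refl , fnNm-fr (f x) h'
... | inj₂ h' with ∈-++⁻ (fnNm (f y)) h'
... | inj₁ h″ = y , inj₂ (inj₁ refl) , fnNm-fr (f y) h″
... | inj₂ h″ = map₂ (map₁ (λ o → inj₂ (inj₂ o))) (fn-toP⁻ p h″)
fn-toP⁻ {f = f} (par′ p q) h with ∈-++⁻ (fn (toP f p)) h
... | inj₁ h' = map₂ (map₁ inj₁) (fn-toP⁻ p h')
... | inj₂ h' = map₂ (map₁ inj₂) (fn-toP⁻ q h')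
fn-toP⁻ {f = f} (sum′ p q) h with ∈-++⁻ (fn (toP f p)) h
... | inj₁ h' = map₂ (map₁ inj₁) (fn-toP⁻ p h')
... | inj₂ h' = map₂ (map₁ inj₂) (fn-toP⁻ q h')

fn-toP⁺ : {f : Fin n → Nm k} (p : Pr n) {i : Fin n} {a : ℕ} → Occ i p → f i ≡ fr a → a ∈ fn (toP f p)
fn-toP⁺ (out′ x y p) (inj₁ refl) e = ∈-++⁺ˡ (fr-fnNm e)
fn-toP⁺ {f = f} (out′ x y p) (inj₂ (inj₁ refl)) e = ∈-++⁺ʳ (fnNm (f x)) (∈-++⁺ˡ (fr-fnNm e))
fn-toP⁺ {f = f} (out′ x y p) (inj₂ (inj₂ o)) e = ∈-++⁺ʳ (fnNm (f x)) (∈-++⁺ʳ (fnNm (f y)) (fn-toP⁺ p o e))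
fn-toP⁺ (inp′ x p) (inj₁ refl) e = ∈-++⁺ˡ (fr-fnNm e)
fn-toP⁺ {f = f} (inp′ x p) (inj₂ o) e = ∈-++⁺ʳ (fnNm (f x)) (fn-toP⁺ p o (cong wkNm e))
fn-toP⁺ (tau′ p) o e = fn-toP⁺ p o e
fn-toP⁺ (res′ p) o e = fn-toP⁺ p o (cong wkNm e)
fn-toP⁺ (mat′ x y p) (inj₁ refl) e = ∈-++⁺ˡ (fr-fnNm e)
fn-toP⁺ {f = f} (mat′ x y p) (inj₂ (inj₁ refl)) e = ∈-++⁺ʳ (fnNm (f x)) (∈-++⁺ˡ (fr-fnNm e))
fn-toP⁺ {f = f} (mat′ x y p) (inj₂ (inj₂ o)) e = ∈-++⁺ʳ (fnNm (f x)) (∈-++⁺ʳ (fnNm (f y)) (fn-toP⁺ p o e))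
fn-toP⁺ (par′ p q) (inj₁ o) e = ∈-++⁺ˡ (fn-toP⁺ p o e)
fn-toP⁺ {f = f} (par′ p q) (inj₂ o) e = ∈-++⁺ʳ (fn (toP f p)) (fn-toP⁺ q o e)
fn-toP⁺ (sum′ p q) (inj₁ o) e = ∈-++⁺ˡ (fn-toP⁺ p o e)
fn-toP⁺ {f = f} (sum′ p q) (inj₂ o) e = ∈-++⁺ʳ (fn (toP f p)) (fn-toP⁺ q o e)

nameP : (Fin n → ℕ) → Pr n → Proc 0
nameP ν p = toP (λ i → fr (ν i)) p

nameUp : (Fin n → ℕ) → Pr (suc n) → Proc 1
nameUp ν b = toP (upNm (λ i → fr (ν i))) b

fr-injective : {a b : ℕ} → fr {k} a ≡ fr b → a ≡ b
fr-injective refl = refl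

∉-fn : {ν : Fin n → ℕ} (p : Pr n) {a : ℕ} → a ∉ fn (nameP ν p) → ∀ i → Occ i p → ν i ≢ a
∉-fn p h i o e = h (fn-toP⁺ p o (cong fr e))

fn-∉ : {ν : Fin n → ℕ} (p : Pr n) {a : ℕ} → (∀ i → Occ i p → ν i ≢ a) → a ∉ fn (nameP ν p)
fn-∉ p h a∈ with fn-toP⁻ p a∈
... | i , o , e = h i o (fr-injective e)

∉-fnUp : {ν : Fin n → ℕ} (b : Pr (suc n)) {a : ℕ} → a ∉ fn (nameUp ν b) → ∀ i → Occ (suc i) b → ν i ≢ a
∉-fnUp b h i o e = h (fn-toP⁺ b o (cong fr e))

fnUp-∉ : {ν : Fin n → ℕ} (b : Pr (suc n)) {a : ℕ} → (∀ i → Occ (suc i) b → ν i ≢ a) → a ∉ fn (nameUp ν b)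
fnUp-∉ b h a∈ with fn-toP⁻ b a∈
... | suc i , o , e = h i o (fr-injective (wkNm-fr (fr _) e))

fresh : (ν : Fin n → ℕ) → ∃ λ y → ∀ i → ν i ≢ y
fresh ν with bounded ν
... | b , h = b , λ i e → <-irrefl e (h i)

if-≡ : {A : Set} {x y : A} (a : ℕ) → (if a ≡ᵇ a then x else y) ≡ x
if-≡ a with a ≡ᵇ a | ≡⇒≡ᵇ a a refl
... | true | _ = refl

if-≢ : {A : Set} {x y : A} {a b : ℕ} → a ≢ b → (if a ≡ᵇ b then x else y) ≡ y
if-≢ {a = a} {b} h with a ≡ᵇ b in eq
... | true  = ⊥-elim (h (≡ᵇ⇒≡ a b (subst T (sym eq) tt)))
... | false = refl

open-name : (ν : Fin n → ℕ) (y : ℕ) (b : Pr (suc n)) → openP y (nameUp ν b) ≡ nameP (ν ▹ y) b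
open-name ν y b = mapP-toP b λ { zero o → refl ; (suc i) o → refl }

close-name : (ν : Fin n → ℕ) (y : ℕ) (b : Pr (suc n)) → (∀ i → Occ (suc i) b → ν i ≢ y) →
             closeP y (nameP (ν ▹ y) b) ≡ nameUp ν b
close-name ν y b h = mapP-toP b λ { zero o → if-≡ y ; (suc i) o → if-≢ (h i o) }

subst-name : (ν : Fin n → ℕ) (y z : ℕ) (b : Pr (suc n)) → (∀ i → Occ (suc i) b → ν i ≢ z) →
             nameP (ν ▹ z) b [ y / z ] ≡ nameP (ν ▹ y) b
subst-name ν y z b h = mapP-toP b λ { zero o → if-≡ z ; (suc i) o → if-≢ (h i o) }

name-inst : (ν : Fin n → ℕ) (y : Fin n) (b : Pr (suc n)) → nameP ν (inst y b) ≡ nameP (ν ▹ ν y) b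
name-inst ν y b = toP-map (λ { zero → refl ; (suc i) → refl }) b

name-wk : (ν : Fin n → ℕ) (w : ℕ) (p : Pr n) → nameP (ν ▹ w) (wkPr p) ≡ nameP ν p
name-wk ν w p = toP-map (λ _ → refl) p

-- The named counterpart of the exchange in the rule for restriction: closing `y`, which sits at
-- index 1, turns it into the innermost bound name, while `w` at index 0 stays free.
close-swap : (ν : Fin n → ℕ) (y w : ℕ) (b : Pr (suc (suc n))) → (∀ i → Occ (suc (suc i)) b → ν i ≢ y) → w ≢ y →
             closeP y (nameP ((ν ▹ y) ▹ w) b) ≡ nameUp (ν ▹ w) (mapPr swap b)
close-swap ν y w b h w≢y = trans
  (mapP-toP b λ { zero o → if-≢ w≢y ; (suc zero) o → if-≡ y ; (suc (suc i)) o → if-≢ (h i o) })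
  (sym (toP-map {h = λ { zero → fr w ; (suc zero) → bd zero ; (suc (suc i)) → fr (ν i) }}
     (λ { zero → refl ; (suc zero) → refl ; (suc (suc i)) → refl }) b))

actOf : (Fin n → ℕ) → Act′ n → Act
actOf ν τ′         = τ
actOf ν (out′ x y) = fout (ν x) (ν y)

bAct : Dir → ℕ → ℕ → Act
bAct dn = bin
bAct up = bout

actOf-wk : (ν : Fin n → ℕ) (y : ℕ) (α : Act′ n) → actOf (ν ▹ y) (wkAct α) ≡ actOf ν α
actOf-wk ν y τ′         = refl
actOf-wk ν y (out′ _ _) = refl

∉-act : {ν : Fin n → ℕ} {y : ℕ} → (∀ i → ν i ≢ y) → (α : Act′ n) → y ∉ nAct (actOf ν α)
∉-act h (out′ x y) (here e)         = h x (sym e)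
∉-act h (out′ x y) (there (here e)) = h y (sym e)

∉-bAct : ∀ d {x w y} → x ≢ y → w ≢ y → y ∉ nAct (bAct d x w)
∉-bAct dn h k (here e)         = h (sym e)
∉-bAct dn h k (there (here e)) = k (sym e)
∉-bAct up h k (here e)         = h (sym e)
∉-bAct up h k (there (here e)) = k (sym e)

BnFresh-act : (ν : Fin n → ℕ) (α : Act′ n) (Q : Proc 0) → BnFresh (actOf ν α) Q
BnFresh-act ν τ′ Q ()
BnFresh-act ν (out′ _ _) Q ()

BnFresh-bAct : ∀ d Q {x w} → w ∉ fn Q → BnFresh (bAct d x w) Q
BnFresh-bAct dn Q h (here refl) = h
BnFresh-bAct up Q h (here refl) = h

bAct-BnFresh : ∀ d Q {x w} → BnFresh (bAct d x w) Q → w ∉ fn Q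
bAct-BnFresh dn Q h = h (here refl)
bAct-BnFresh up Q h = h (here refl)

⟶-subst : ∀ {P P₁ α α₁ P' P'₁} → P ≡ P₁ → α ≡ α₁ → P' ≡ P'₁ → P ─ α ⟶ P' → P₁ ─ α₁ ⟶ P'₁
⟶-subst refl refl refl d = d

mutual
  -- Valid for every naming: equal indices have equal names, so matches and communications survive,
  -- and the bound names are chosen fresh for the whole of `ν`.
  Step⇒⟶ : (ν : Fin n → ℕ) {p p' : Pr n} {α : Act′ n} → Step p α p' → nameP ν p ─ actOf ν α ⟶ nameP ν p'
  Step⇒⟶ ν tau      = TAU
  Step⇒⟶ ν out      = OUT
  Step⇒⟶ ν (mat s)  = MATCH (Step⇒⟶ ν s)
  Step⇒⟶ ν (sumL s) = SUML (Step⇒⟶ ν s)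
  Step⇒⟶ ν (sumR s) = SUMR (Step⇒⟶ ν s)
  Step⇒⟶ ν (parL {q = q} {α} s) = PARL (Step⇒⟶ ν s) (BnFresh-act ν α (nameP ν q))
  Step⇒⟶ ν (parR {p} {α = α} s) = PARR (Step⇒⟶ ν s) (BnFresh-act ν α (nameP ν p))
  Step⇒⟶ ν (res {p = b} {α} {b'} s) with fresh ν
  ... | y , h = ⟶-subst refl refl (cong res (close-name ν y b' (λ i _ → h i)))
    (RES (fnUp-∉ b (λ i _ → h i))
         (⟶-subst (sym (open-name ν y b)) (actOf-wk ν y α) refl (Step⇒⟶ (ν ▹ y) s)) (∉-act h α))
  Step⇒⟶ ν (close d {p} {q} {m = m} {m'} s r) with fresh ν
  ... | w , h = ⟶-subst refl refl (cong res (close-name ν w (par′ m m') (λ i _ → h i)))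
    (rule d (Stepp⇒⟶ ν s (fn-∉ p (λ i _ → h i))) (Stepp⇒⟶ ν r (fn-∉ q (λ i _ → h i))))
    where
    rule : ∀ d {P Q P' Q' x w} → P ─ bAct d x w ⟶ P' → Q ─ bAct (opp d) x w ⟶ Q' →
           par P Q ─ τ ⟶ res (closeP w (par P' Q'))
    rule dn = CLOSER
    rule up = CLOSEL
  Step⇒⟶ ν (comL {p} {y = y} {m = m} s r) with fresh ν
  ... | z , h = ⟶-subst refl refl
    (cong (λ P → par P _) (trans (subst-name ν (ν y) z m (λ i _ → h i)) (sym (name-inst ν y m))))
    (COMR (Stepp⇒⟶ ν s (fn-∉ p (λ i _ → h i))) (Step⇒⟶ ν r))
  Step⇒⟶ ν (comR {q = q} {y = y} {m = m} s r) with fresh ν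
  ... | z , h = ⟶-subst refl refl
    (cong (par _) (trans (subst-name ν (ν y) z m (λ i _ → h i)) (sym (name-inst ν y m))))
    (COML (Step⇒⟶ ν s) (Stepp⇒⟶ ν r (fn-∉ q (λ i _ → h i))))

  -- The bound name `w` is prescribed from outside, by the bisimulation clause or by the partner in
  -- a closing communication; it has to be fresh only for the source.
  Stepp⇒⟶ : (ν : Fin n → ℕ) {p : Pr n} {d : Dir} {x : Fin n} {m : Pr (suc n)} {w : ℕ} →
             Stepp p d x m → w ∉ fn (nameP ν p) → nameP ν p ─ bAct d (ν x) w ⟶ nameP (ν ▹ w) m
  Stepp⇒⟶ ν {w = w} (inp {x} {m}) w∉ =
    ⟶-subst refl refl (open-name ν w m) (IN (λ w∈ → w∉ (∈-++⁺ʳ (ν x ∷ []) w∈)))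
  Stepp⇒⟶ ν (mat {x} s) w∉ = MATCH (Stepp⇒⟶ ν s (λ w∈ → w∉ (there (there w∈))))
  Stepp⇒⟶ ν (sumL s) w∉ = SUML (Stepp⇒⟶ ν s (λ w∈ → w∉ (∈-++⁺ˡ w∈)))
  Stepp⇒⟶ ν (sumR {p} s) w∉ = SUMR (Stepp⇒⟶ ν s (λ w∈ → w∉ (∈-++⁺ʳ (fn (nameP ν p)) w∈)))
  Stepp⇒⟶ ν {w = w} (parL {p} {q} {d} s) w∉ = ⟶-subst refl refl (cong (par _) (sym (name-wk ν w q)))
    (PARL (Stepp⇒⟶ ν s (λ w∈ → w∉ (∈-++⁺ˡ w∈))) (BnFresh-bAct d (nameP ν q) (λ w∈ → w∉ (∈-++⁺ʳ (fn (nameP ν p)) w∈))))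
  Stepp⇒⟶ ν {w = w} (parR {p} {d = d} s) w∉ = ⟶-subst refl refl (cong (λ P → par P _) (sym (name-wk ν w p)))
    (PARR (Stepp⇒⟶ ν s (λ w∈ → w∉ (∈-++⁺ʳ (fn (nameP ν p)) w∈))) (BnFresh-bAct d (nameP ν p) (λ w∈ → w∉ (∈-++⁺ˡ w∈))))
  -- The name given to the restricted index must avoid `w` too, being neither part of the label nor
  -- captured.
  Stepp⇒⟶ ν {w = w} (res {p = b} {d} {x} {m} s) w∉ with fresh (ν ▹ w)
  ... | y , h = ⟶-subst refl refl (cong res (close-swap ν y w m (λ i _ → h (suc i)) (h zero)))
    (RES (fnUp-∉ b (λ i _ → h (suc i)))
      (⟶-subst (sym (open-name ν y b)) refl refl
        (Stepp⇒⟶ (ν ▹ y) s (fn-∉ b λ { zero _ e → h zero (sym e) ; (suc i) o → ∉-fnUp b w∉ i o })))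
      (∉-bAct d (h (suc x)) (h zero)))
  Stepp⇒⟶ ν {w = w} (open′ {b} {x} {m} s) w∉ with fresh (ν ▹ w)
  ... | y , h = ⟶-subst refl refl (subst-name ν w y m (λ i _ → h (suc i)))
    (OPEN (fnUp-∉ b (λ i _ → h (suc i))) (⟶-subst (sym (open-name ν y b)) refl refl (Step⇒⟶ (ν ▹ y) s))
      (λ e → h (suc x) (sym e))
      (subst (λ P → w ∉ fn P) (sym (close-name ν y m (λ i _ → h (suc i))))
        (fnUp-∉ m (λ i o → ∉-fnUp b w∉ i (Step-occ s o)))))

-- Transitions of a named process come from its scoped process

-- Restricted to occurring indices, because a name received later may coincide with that of an index
-- which has disappeared from both processes.
InjOn : (Fin n → ℕ) → Pr n → Set
InjOn ν p = ∀ {i j} → Occ i p → Occ j p → ν i ≡ ν j → i ≡ j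

data Reflects (ν : Fin n → ℕ) (p : Pr n) (α : Act) (P' : Proc 0) : Set where
  freeR  : ∀ {a p'} → Step p a p' → α ≡ actOf ν a → P' ≡ nameP ν p' → Reflects ν p α P'
  boundR : ∀ {d x m w} → Stepp p d x m → (∀ i → Occ (suc i) m → ν i ≢ w) →
          α ≡ bAct d (ν x) w → P' ≡ nameP (ν ▹ w) m → Reflects ν p α P'

bin-inv : ∀ d {x z x' w} → bin x z ≡ bAct d x' w → d ≡ dn × x ≡ x' × z ≡ w
bin-inv dn refl = refl , refl , refl

bout-inv : ∀ d {x z x' w} → bout x z ≡ bAct d x' w → d ≡ up × x ≡ x' × z ≡ w
bout-inv up refl = refl , refl , refl

fout-inv : {ν : Fin n → ℕ} (a : Act′ n) {x y : ℕ} → fout x y ≡ actOf ν a → ∃ λ i → ∃ λ j → a ≡ out′ i j × x ≡ ν i × y ≡ ν j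
fout-inv (out′ i j) refl = i , j , refl , refl , refl

bin≢actOf : {ν : Fin n → ℕ} (a : Act′ n) {x z : ℕ} → bin x z ≢ actOf ν a
bin≢actOf τ′ ()
bin≢actOf (out′ _ _) ()

bout≢actOf : {ν : Fin n → ℕ} (a : Act′ n) {x z : ℕ} → bout x z ≢ actOf ν a
bout≢actOf τ′ ()
bout≢actOf (out′ _ _) ()

fout≢bAct : ∀ d {x y x' w} → fout x y ≢ bAct d x' w
fout≢bAct dn ()
fout≢bAct up ()

record ReflectsOut (ν : Fin n → ℕ) (p : Pr n) (x y : ℕ) (P' : Proc 0) : Set where
  constructor reflectsOut
  field
    {i j}  : Fin n
    {p'}   : Pr n
    step   : Step p (out′ i j) p'
    subj   : x ≡ ν i
    obj    : y ≡ ν j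
    target : P' ≡ nameP ν p'

record ReflectsBound (ν : Fin n → ℕ) (p : Pr n) (d : Dir) (x w : ℕ) (P' : Proc 0) : Set where
  constructor reflectsBound
  field
    {i}    : Fin n
    {b}    : Pr (suc n)
    step   : Stepp p d i b
    fr∉    : ∀ i → Occ (suc i) b → ν i ≢ w
    subj   : x ≡ ν i
    target : P' ≡ nameP (ν ▹ w) b

asOut : {ν : Fin n → ℕ} {p : Pr n} {x y : ℕ} {P' : Proc 0} → Reflects ν p (fout x y) P' → ReflectsOut ν p x y P'
asOut (freeR {a} s e e') with fout-inv a e
... | i , j , refl , q , r = reflectsOut s q r e'
asOut (boundR {d} s h e e') = ⊥-elim (fout≢bAct d e)

asBound : ∀ d {ν : Fin n → ℕ} {p : Pr n} {x w : ℕ} {P' : Proc 0} → Reflects ν p (bAct d x w) P' → ReflectsBound ν p d x w P'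
asBound dn (freeR {a} s e e') = ⊥-elim (bin≢actOf a e)
asBound up (freeR {a} s e e') = ⊥-elim (bout≢actOf a e)
asBound dn (boundR {d} s h e e') with bin-inv d e
... | refl , q , refl = reflectsBound s h q e'
asBound up (boundR {d} s h e e') with bout-inv d e
... | refl , q , refl = reflectsBound s h q e'

match-inv : {x y : Nm 0} {P P' : Proc 0} {α : Act} → mat x y P ─ α ⟶ P' → x ≡ y × P ─ α ⟶ P'
match-inv (MATCH d) = refl , d

▹-injOn : {ν : Fin n → ℕ} (b : Pr (suc n)) {y : ℕ} → InjOn ν (res′ b) → (∀ i → Occ (suc i) b → ν i ≢ y) → InjOn (ν ▹ y) b
▹-injOn b h k {zero}  {zero}  o o' e = refl
▹-injOn b h k {zero}  {suc j} o o' e = ⊥-elim (k j o' (sym e))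
▹-injOn b h k {suc i} {zero}  o o' e = ⊥-elim (k i o e)
▹-injOn b h k {suc i} {suc j} o o' e = cong suc (h o o' e)

unwkAct : (ν : Fin n → ℕ) (y : ℕ) (a : Act′ (suc n)) → y ∉ nAct (actOf (ν ▹ y) a) → ∃ λ b → a ≡ wkAct b
unwkAct ν y τ′                     h = τ′ , refl
unwkAct ν y (out′ zero j)          h = ⊥-elim (h (here refl))
unwkAct ν y (out′ (suc i) zero)    h = ⊥-elim (h (there (here refl)))
unwkAct ν y (out′ (suc i) (suc j)) h = out′ i j , refl

-- Injectivity acts at matches and at the four communication rules, where two indices with the same
-- name have to be the same index; a naming that merges two indices could enable transitions that
-- the scoped process lacks.
reflects : (ν : Fin n → ℕ) (p : Pr n) {P' : Proc 0} {α : Act} → InjOn ν p → nameP ν p ─ α ⟶ P' → Reflects ν p α P'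
reflects ν (out′ x y p) inj OUT = freeR out refl refl
reflects ν (inp′ x p) inj (IN {w = w} w∉) = boundR inp (∉-fnUp p w∉) refl (open-name ν w p)
reflects ν (tau′ p) inj TAU = freeR tau refl refl
reflects ν (mat′ x y p) inj D with match-inv D
... | q , d with inj {x} {y} (inj₁ refl) (inj₂ (inj₁ refl)) (fr-injective q)
... | refl with reflects ν p (λ o o' → inj (inj₂ (inj₂ o)) (inj₂ (inj₂ o'))) d
... | freeR s q' r = freeR (mat s) q' r
... | boundR s h q' r = boundR (mat s) h q' r
reflects ν (sum′ p q) inj (SUML d) with reflects ν p (λ o o' → inj (inj₁ o) (inj₁ o')) d
... | freeR s q' r = freeR (sumL s) q' r
... | boundR s h q' r = boundR (sumL s) h q' r
reflects ν (sum′ p q) inj (SUMR d) with reflects ν q (λ o o' → inj (inj₂ o) (inj₂ o')) d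
... | freeR s q' r = freeR (sumR s) q' r
... | boundR s h q' r = boundR (sumR s) h q' r
reflects ν (par′ p q) inj (PARL d f) with reflects ν p (λ o o' → inj (inj₁ o) (inj₁ o')) d
... | freeR s e refl = freeR (parL s) e refl
... | boundR {d} {m = m} {w} s h refl refl = boundR (parL s)
  (λ { i (inj₁ o) → h i o ; i (inj₂ o) → ∉-fn {ν = ν} q (bAct-BnFresh d (nameP ν q) f) i (Occ-wk q o) })
  refl (cong (par _) (sym (name-wk ν w q)))
reflects ν (par′ p q) inj (PARR d f) with reflects ν q (λ o o' → inj (inj₂ o) (inj₂ o')) d
... | freeR s e refl = freeR (parR s) e refl
... | boundR {d} {m = m} {w} s h refl refl = boundR (parR s)
  (λ { i (inj₂ o) → h i o ; i (inj₁ o) → ∉-fn {ν = ν} p (bAct-BnFresh d (nameP ν p) f) i (Occ-wk p o) })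
  refl (cong (λ P → par P _) (sym (name-wk ν w p)))
reflects ν (par′ p q) inj (COML {y = y} {z} d d')
  with asOut (reflects ν p (λ o o' → inj (inj₁ o) (inj₁ o')) d)
     | asBound dn (reflects ν q (λ o o' → inj (inj₂ o) (inj₂ o')) d')
... | reflectsOut {i} {j} s e refl refl | reflectsBound {i'} {m} r h e' refl
  with inj {i} {i'} (inj₁ (Step-label s (inj₁ refl))) (inj₂ (Stepp-label r)) (trans (sym e) e')
... | refl = freeR (comR s r) refl (cong (par _) (trans (subst-name ν y z m h) (sym (name-inst ν j m))))
reflects ν (par′ p q) inj (COMR {y = y} {z} d d')
  with asBound dn (reflects ν p (λ o o' → inj (inj₁ o) (inj₁ o')) d)
     | asOut (reflects ν q (λ o o' → inj (inj₂ o) (inj₂ o')) d')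
... | reflectsBound {i'} {m} r h e' refl | reflectsOut {i} {j} s e refl refl
  with inj {i} {i'} (inj₂ (Step-label s (inj₁ refl))) (inj₁ (Stepp-label r)) (trans (sym e) e')
... | refl = freeR (comL r s) refl (cong (λ P → par P _) (trans (subst-name ν y z m h) (sym (name-inst ν j m))))
reflects ν (par′ p q) inj (CLOSEL {w = w} d d')
  with asBound up (reflects ν p (λ o o' → inj (inj₁ o) (inj₁ o')) d)
     | asBound dn (reflects ν q (λ o o' → inj (inj₂ o) (inj₂ o')) d')
... | reflectsBound {i} {m} s h e refl | reflectsBound {i'} {m'} r h' e' refl
  with inj {i} {i'} (inj₁ (Stepp-label s)) (inj₂ (Stepp-label r)) (trans (sym e) e')
... | refl = freeR (close up s r) refl (cong res (close-name ν w (par′ m m') λ { i (inj₁ o) → h i o ; i (inj₂ o) → h' i o }))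
reflects ν (par′ p q) inj (CLOSER {w = w} d d')
  with asBound dn (reflects ν p (λ o o' → inj (inj₁ o) (inj₁ o')) d)
     | asBound up (reflects ν q (λ o o' → inj (inj₂ o) (inj₂ o')) d')
... | reflectsBound {i} {m} s h e refl | reflectsBound {i'} {m'} r h' e' refl
  with inj {i} {i'} (inj₁ (Stepp-label s)) (inj₂ (Stepp-label r)) (trans (sym e) e')
... | refl = freeR (close dn s r) refl (cong res (close-name ν w (par′ m m') λ { i (inj₁ o) → h i o ; i (inj₂ o) → h' i o }))
reflects ν (res′ b) inj (RES {y = y} y∉ D y∉α)
  with reflects (ν ▹ y) b (▹-injOn b inj (∉-fnUp b y∉)) (⟶-subst (open-name ν y b) refl refl D)
... | freeR {a} {b'} s refl refl with unwkAct ν y a y∉α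
... | a' , refl = freeR (res s) (actOf-wk ν y a') (cong res (close-name ν y b' (λ i o → ∉-fnUp b y∉ i (Step-occ s o))))
reflects ν (res′ b) inj (RES {y = y} y∉ D y∉α)
    | boundR {dn} {zero} s h refl refl = ⊥-elim (y∉α (here refl))
reflects ν (res′ b) inj (RES {y = y} y∉ D y∉α)
    | boundR {up} {zero} s h refl refl = ⊥-elim (y∉α (here refl))
reflects ν (res′ b) inj (RES {y = y} y∉ D y∉α)
    | boundR {d} {suc x} {m} {w} s h refl refl =
  boundR (res s) (λ i o → h (suc i) (Occ-swap m o)) refl
    (cong res (close-swap ν y w m (λ i o → ∉-fnUp b y∉ i (Stepp-occ s o)) (λ e → y∉α (last d e))))
  where
  last : ∀ d {x w y} → w ≡ y → y ∈ nAct (bAct d x w)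
  last dn refl = there (here refl)
  last up refl = there (here refl)
reflects ν (res′ b) inj (OPEN {x = x} {y} {w} y∉ d y≢x w∉)
  with asOut (reflects (ν ▹ y) b (▹-injOn b inj (∉-fnUp b y∉)) (⟶-subst (open-name ν y b) refl refl d))
-- The subject is not the restricted name by `y≢x`, and the object must be it: an outer index named
-- `y` would make `y` free in the body.
... | reflectsOut {zero} {j} s e e' refl = ⊥-elim (y≢x (sym e))
... | reflectsOut {suc i} {suc j} s e e' refl = ⊥-elim (∉-fnUp b y∉ j (Step-label s (inj₂ refl)) (sym e'))
... | reflectsOut {suc i} {zero} {m} s refl e' refl = boundR (open′ s)
  (∉-fnUp m (subst (λ P → w ∉ fn P) (close-name ν y m keep) w∉)) refl (subst-name ν w y m keep)
  where
  keep : ∀ i → Occ (suc i) m → ν i ≢ y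
  keep i o = ∉-fnUp b y∉ i (Step-occ s o)

-- Substitutions in formulas and judgments

argsSub : {θ : Sub Δ Θ} {ξ : Sub Γ Δ} {ζ : Sub Γ Θ} → (∀ {t} (x : Var Γ t) → sub θ (ξ x) ≡ ζ x) →
          {ts : List Ty} (as : All (Tm Γ) ts) → All.map (sub θ) (All.map (sub ξ) as) ≡ All.map (sub ζ) as
argsSub h []       = refl
argsSub h (a ∷ as) = cong₂ _∷_ (sub-sub h a) (argsSub h as)

argsId : {θ : Sub Γ Γ} → (∀ {t} (x : Var Γ t) → θ x ≡ var x) → {ts : List Ty} (as : All (Tm Γ) ts) → All.map (sub θ) as ≡ as
argsId h []       = refl
argsId h (a ∷ as) = cong₂ _∷_ (sub-id h a) (argsId h as)

argsRen : {ρ : Ren Γ Δ} {θ : Sub Γ Δ} → (∀ {t} (x : Var Γ t) → var (ρ x) ≡ θ x) →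
          {ts : List Ty} (as : All (Tm Γ) ts) → All.map (ren ρ) as ≡ All.map (sub θ) as
argsRen h []       = refl
argsRen h (a ∷ as) = cong₂ _∷_ (ren-as-sub h a) (argsRen h as)

liftS-∘ : {θ : Sub Δ Θ} {ξ : Sub Γ Δ} {ζ : Sub Γ Θ} → (∀ {t} (x : Var Γ t) → sub θ (ξ x) ≡ ζ x) →
          (x : Var (s ∷ Γ) t) → sub (liftS θ) (liftS ξ x) ≡ liftS ζ x
liftS-∘ {θ = θ} {ξ} h x = trans (liftS-⊙ θ ξ x) (liftS-cong h x)

subF-sub : {θ : Sub Δ Θ} {ξ : Sub Γ Δ} {ζ : Sub Γ Θ} → (∀ {t} (x : Var Γ t) → sub θ (ξ x) ≡ ζ x) →
           (B : Fm Γ) → subF θ (subF ξ B) ≡ subF ζ B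
subF-sub h (atom q ts) = cong (atom q) (argsSub h ts)
subF-sub h ⊤'          = refl
subF-sub h ⊥'          = refl
subF-sub h (A ∧' B)    = cong₂ _∧'_ (subF-sub h A) (subF-sub h B)
subF-sub h (A ∨' B)    = cong₂ _∨'_ (subF-sub h A) (subF-sub h B)
subF-sub h (A ⊃' B)    = cong₂ _⊃'_ (subF-sub h A) (subF-sub h B)
subF-sub h (∀' t B)    = cong (∀' t) (subF-sub (liftS-∘ h) B)
subF-sub h (∃' t B)    = cong (∃' t) (subF-sub (liftS-∘ h) B)
subF-sub h (∇' t B)    = cong (∇' t) (subF-sub (liftS-∘ h) B)

subF-id : {θ : Sub Γ Γ} → (∀ {t} (x : Var Γ t) → θ x ≡ var x) → (B : Fm Γ) → subF θ B ≡ B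
subF-id h (atom q ts) = cong (atom q) (argsId h ts)
subF-id h ⊤'          = refl
subF-id h ⊥'          = refl
subF-id h (A ∧' B)    = cong₂ _∧'_ (subF-id h A) (subF-id h B)
subF-id h (A ∨' B)    = cong₂ _∨'_ (subF-id h A) (subF-id h B)
subF-id h (A ⊃' B)    = cong₂ _⊃'_ (subF-id h A) (subF-id h B)
subF-id h (∀' t B)    = cong (∀' t) (subF-id (liftS-id h) B)
subF-id h (∃' t B)    = cong (∃' t) (subF-id (liftS-id h) B)
subF-id h (∇' t B)    = cong (∇' t) (subF-id (liftS-id h) B)

renF-as-sub : {ρ : Ren Γ Δ} {θ : Sub Γ Δ} → (∀ {t} (x : Var Γ t) → var (ρ x) ≡ θ x) → (B : Fm Γ) → renF ρ B ≡ subF θ B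
renF-as-sub h (atom q ts) = cong (atom q) (argsRen h ts)
renF-as-sub h ⊤'          = refl
renF-as-sub h ⊥'          = refl
renF-as-sub h (A ∧' B)    = cong₂ _∧'_ (renF-as-sub h A) (renF-as-sub h B)
renF-as-sub h (A ∨' B)    = cong₂ _∨'_ (renF-as-sub h A) (renF-as-sub h B)
renF-as-sub h (A ⊃' B)    = cong₂ _⊃'_ (renF-as-sub h A) (renF-as-sub h B)
renF-as-sub h (∀' t B)    = cong (∀' t) (renF-as-sub (liftR-S h) B)
renF-as-sub h (∃' t B)    = cong (∃' t) (renF-as-sub (liftR-S h) B)
renF-as-sub h (∇' t B)    = cong (∇' t) (renF-as-sub (liftR-S h) B)

underS-∘ : (σ : Ctx) {θ : Sub Δ Θ} {ξ : Sub Γ Δ} {ζ : Sub Γ Θ} → (∀ {t} (x : Var Γ t) → sub θ (ξ x) ≡ ζ x) →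
           (x : Var (σ ++ Γ) t) → sub (underS σ θ) (underS σ ξ x) ≡ underS σ ζ x
underS-∘ []      h x = h x
underS-∘ (s ∷ σ) h x = liftS-∘ (underS-∘ σ h) x

act : (σ : Ctx) → Sub Γ Δ → Tm (σ ++ Γ) t → Tm (σ ++ Δ) t
act σ ξ = sub (underS σ ξ)

underS-cong≈ : (σ : Ctx) {θ ξ : Sub Γ Δ} → (∀ {t} (x : Var Γ t) → θ x ≈ ξ x) → (x : Var (σ ++ Γ) t) → underS σ θ x ≈ underS σ ξ x
underS-cong≈ []      h x = h x
underS-cong≈ (s ∷ σ) h x = liftS-cong≈ (underS-cong≈ σ h) x

underS-id : (σ : Ctx) {θ : Sub Γ Γ} → (∀ {t} (x : Var Γ t) → θ x ≡ var x) → (x : Var (σ ++ Γ) t) → underS σ θ x ≡ var x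
underS-id []      h x = h x
underS-id (s ∷ σ) h x = liftS-id (underS-id σ h) x

underR-S : (σ : Ctx) {ρ : Ren Γ Δ} {θ : Sub Γ Δ} → (∀ {t} (x : Var Γ t) → var (ρ x) ≡ θ x) →
           (x : Var (σ ++ Γ) t) → var (underR σ ρ x) ≡ underS σ θ x
underR-S []      h x = h x
underR-S (s ∷ σ) h x = liftR-S (underR-S σ h) x

subJ-sub : {θ : Sub Δ Θ} {ξ : Sub Γ Δ} {ζ : Sub Γ Θ} → (∀ {t} (x : Var Γ t) → sub θ (ξ x) ≡ ζ x) →
           (J : Judg Γ) → subJ θ (subJ ξ J) ≡ subJ ζ J
subJ-sub h (σ , B) = cong (σ ,_) (subF-sub (underS-∘ σ h) B)

subJ-id : {θ : Sub Γ Γ} → (∀ {t} (x : Var Γ t) → θ x ≡ var x) → (J : Judg Γ) → subJ θ J ≡ J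
subJ-id h (σ , B) = cong (σ ,_) (subF-id (underS-id σ h) B)

renJ-wk : (J : Judg Γ) → renJ (vs {s = s}) J ≡ subJ wkS J
renJ-wk (σ , B) = cong (σ ,_) (renF-as-sub (underR-S σ (λ _ → refl)) B)

ArgsEq-refl : {ts : List Ty} (as : All (Tm Γ) ts) → ArgsEq as as
ArgsEq-refl []       = []
ArgsEq-refl (a ∷ as) = ≈refl ∷ ArgsEq-refl as

ArgsEq-sym : {ts : List Ty} {as bs : All (Tm Γ) ts} → ArgsEq as bs → ArgsEq bs as
ArgsEq-sym []       = []
ArgsEq-sym (p ∷ ps) = ≈sym p ∷ ArgsEq-sym ps

ArgsEq-trans : {ts : List Ty} {as bs cs : All (Tm Γ) ts} → ArgsEq as bs → ArgsEq bs cs → ArgsEq as cs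
ArgsEq-trans []       []       = []
ArgsEq-trans (p ∷ ps) (q ∷ qs) = ≈trans p q ∷ ArgsEq-trans ps qs

ArgsEq-sub : (θ : Sub Γ Δ) {ts : List Ty} {as bs : All (Tm Γ) ts} → ArgsEq as bs →
             ArgsEq (All.map (sub θ) as) (All.map (sub θ) bs)
ArgsEq-sub θ []       = []
ArgsEq-sub θ (p ∷ ps) = sub-≈ θ p ∷ ArgsEq-sub θ ps

ArgsEq-cong : {θ ξ : Sub Γ Δ} → (∀ {t} (x : Var Γ t) → θ x ≈ ξ x) → {ts : List Ty} (as : All (Tm Γ) ts) →
              ArgsEq (All.map (sub θ) as) (All.map (sub ξ) as)
ArgsEq-cong h []       = []
ArgsEq-cong h (a ∷ as) = sub-cong≈ h a ∷ ArgsEq-cong h as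

≈F-refl : (B : Fm Γ) → B ≈F B
≈F-refl (atom q ts) = atomc (ArgsEq-refl ts)
≈F-refl ⊤'          = ⊤c
≈F-refl ⊥'          = ⊥c
≈F-refl (A ∧' B)    = ∧c (≈F-refl A) (≈F-refl B)
≈F-refl (A ∨' B)    = ∨c (≈F-refl A) (≈F-refl B)
≈F-refl (A ⊃' B)    = ⊃c (≈F-refl A) (≈F-refl B)
≈F-refl (∀' t B)    = ∀c (≈F-refl B)
≈F-refl (∃' t B)    = ∃c (≈F-refl B)
≈F-refl (∇' t B)    = ∇c (≈F-refl B)

-- Raised eigenvariables

_,*_ : {σ : Ctx} → All (Tm Δ) σ → Sub Γ Δ → Sub (σ ++ Γ) Δ
([] ,* δ) x            = δ x
((N ∷ Ns) ,* δ) vz     = N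
((N ∷ Ns) ,* δ) (vs x) = (Ns ,* δ) x

toEnd : (σ : Ctx) → Ren (s ∷ (σ ++ Γ)) (σ ++ (s ∷ Γ))
toEnd σ vz     = hVar σ
toEnd σ (vs x) = underR σ vs x

-- `raiseTy` takes the innermost local type as its first argument, so the innermost variable gets
-- the outermost `lam`; `toEnd` moves it past `σ` to the place where that `lam` binds it.
abstr : (σ : Ctx) → Tm (σ ++ Γ) t → Tm Γ (raiseTy σ t)
abstr []      T = T
abstr (s ∷ σ) T = lam (abstr σ (ren (toEnd σ) T))

appAll-≈ : (σ : Ctx) {M M' : Tm Δ (raiseTy σ t)} (Ns : All (Tm Δ) σ) → M ≈ M' → appAll σ M Ns ≈ appAll σ M' Ns
appAll-≈ []      []       p = p
appAll-≈ (s ∷ σ) (N ∷ Ns) p = appAll-≈ σ Ns (appc p ≈refl)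

,*-toEnd : (σ : Ctx) (Ns : All (Tm Δ) σ) (N : Tm Δ s) (δ : Sub Γ Δ) (x : Var (s ∷ (σ ++ Γ)) t) →
           (Ns ,* (δ ▸ N)) (toEnd σ x) ≡ ((N ∷ Ns) ,* δ) x
,*-toEnd []      []       N δ vz          = refl
,*-toEnd []      []       N δ (vs x)      = refl
,*-toEnd (s ∷ σ) (M ∷ Ms) N δ vz          = ,*-toEnd σ Ms N δ vz
,*-toEnd (s ∷ σ) (M ∷ Ms) N δ (vs vz)     = refl
,*-toEnd (s ∷ σ) (M ∷ Ms) N δ (vs (vs x)) = ,*-toEnd σ Ms N δ (vs x)

abstr-β : (σ : Ctx) (T : Tm (σ ++ Γ) t) (δ : Sub Γ Δ) (Ns : All (Tm Δ) σ) →
          appAll σ (sub δ (abstr σ T)) Ns ≈ sub (Ns ,* δ) T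
abstr-β []      T δ []       = ≡⇒≈ (sub-cong (λ _ → refl) T)
abstr-β (s ∷ σ) T δ (N ∷ Ns) = ≈trans
  (appAll-≈ σ Ns (≈trans β (≡⇒≈ (sub-sub {ζ = δ ▸ N} (λ { vz → refl ; (vs x) → sub1-wk N (δ x) }) (abstr σ (ren (toEnd σ) T))))))
  (≈trans (abstr-β σ (ren (toEnd σ) T) (δ ▸ N) Ns) (≡⇒≈ (sub-ren (,*-toEnd σ Ns N δ) T)))

sub-appAll : (θ : Sub Γ Δ) (σ : Ctx) (M : Tm Γ (raiseTy σ t)) (Ns : All (Tm Γ) σ) →
             sub θ (appAll σ M Ns) ≡ appAll σ (sub θ M) (All.map (sub θ) Ns)
sub-appAll θ []      M []       = refl
sub-appAll θ (s ∷ σ) M (N ∷ Ns) = sub-appAll θ σ (app M N) Ns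

map-wk-lift : (θ : Sub Γ Δ) {ts : List Ty} (as : All (Tm Γ) ts) →
              All.map (sub (liftS {s = s} θ)) (All.map (ren vs) as) ≡ All.map (ren vs) (All.map (sub θ) as)
map-wk-lift θ []       = refl
map-wk-lift θ (a ∷ as) = cong₂ _∷_ (sub-wk θ a) (map-wk-lift θ as)

sub-locals : (σ : Ctx) (γ : Sub Γ Δ) → All.map (act σ γ) (locals σ) ≡ locals σ
sub-locals []      γ = refl
sub-locals (s ∷ σ) γ = cong (var vz ∷_) (trans (map-wk-lift (underS σ γ) (locals σ)) (cong (All.map (ren vs)) (sub-locals σ γ)))

underS-hVar : (σ : Ctx) (γ : Sub (t ∷ Γ) Δ) → underS σ γ (hVar σ) ≡ ren (wkL σ) (γ vz)
underS-hVar []      γ = sym (trans (ren-as-sub (λ _ → refl) (γ vz)) (sub-id (λ _ → refl) (γ vz)))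
underS-hVar (s ∷ σ) γ = trans (cong (ren vs) (underS-hVar σ γ)) (ren-ren (λ _ → refl) (γ vz))

underS-vs : (σ : Ctx) (γ : Sub Γ Δ) (h : Tm Δ s) (x : Var (σ ++ Γ) t) → underS σ (γ ▸ h) (underR σ vs x) ≡ underS σ γ x
underS-vs []      γ h x      = refl
underS-vs (s ∷ σ) γ h vz     = refl
underS-vs (s ∷ σ) γ h (vs x) = cong (ren vs) (underS-vs σ γ h x)

map-wk-,* : (σ : Ctx) {ts : Ctx} (Ns : All (Tm Δ) ts) (δ : Sub Γ Δ) (x : Var (ts ++ Γ) t) →
            (All.map (ren (vs {s = s})) Ns ,* (λ y → ren vs (δ y))) x ≡ ren vs ((Ns ,* δ) x)
map-wk-,* σ []       δ x      = refl
map-wk-,* σ (N ∷ Ns) δ vz     = refl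
map-wk-,* σ (N ∷ Ns) δ (vs x) = map-wk-,* σ Ns δ x

locals-,* : (σ : Ctx) (x : Var (σ ++ Γ) t) → (locals σ ,* (λ y → var (wkL σ y))) x ≡ var x
locals-,* []      x      = refl
locals-,* (s ∷ σ) vz     = refl
locals-,* (s ∷ σ) (vs x) = trans (map-wk-,* σ (locals σ) (λ y → var (wkL σ y)) x) (cong (ren vs) (locals-,* σ x))

-- The eigenvariable applied to all local variables recovers `T` once it is instantiated by the
-- abstraction of `T`. The validity of ∀R and ∃L rests on this, since their quantifier ranges over
-- terms that may contain local variables.
abstr-raise : (σ : Ctx) (γ : Sub Γ Δ) (T : Tm (σ ++ Δ) t) →
              act σ (γ ▸ abstr σ T) (raiseSub σ vz) ≈ T
abstr-raise σ γ T = ≈trans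
  (≡⇒≈ (trans (sub-appAll (underS σ γ') σ (var (hVar σ)) (locals σ))
    (cong₂ (appAll σ) (trans (underS-hVar σ γ') (ren-as-sub (λ _ → refl) (abstr σ T))) (sub-locals σ γ'))))
  (≈trans (abstr-β σ T (λ y → var (wkL σ y)) (locals σ))
    (≡⇒≈ (sub-id (locals-,* σ) T)))
  where γ' = γ ▸ abstr σ T

-- The term model: closed terms over G₀, ∇ read as a new local variable, one and onep read as
-- inductive predicates, lbisim as the least fixed point of its clause.

mutual
  data Atom (q : Pred) (σ : Ctx) (as : All (Tm (σ ++ G₀)) (arity q)) : Set where
    fold : (c : Clause) → Dpi c → (ξ : Sub (cvars c) (σ ++ G₀)) →
           atom q as ≈F atom (cpred c) (All.map (sub ξ) (chead c)) → Pos (cbody c) σ ξ → Atom q σ as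

  -- The connectives that occur in the clauses for transitions and equality, all of which keep the
  -- definition strictly positive. The body of the `lbisim` clause contains implications, so
  -- `Atom lbisim` is empty and that predicate is interpreted by `Bis`.
  data Pos : Fm Γ → (σ : Ctx) → Sub Γ (σ ++ G₀) → Set where
    ⊤p : ∀ {σ} {θ : Sub Γ (σ ++ G₀)} → Pos ⊤' σ θ
    ∧p : ∀ {σ A B} {θ : Sub Γ (σ ++ G₀)} → Pos A σ θ → Pos B σ θ → Pos (A ∧' B) σ θ
    ∃p : ∀ {σ t B} {θ : Sub Γ (σ ++ G₀)} (T : Tm (σ ++ G₀) t) → Pos B σ (θ ▸ T) → Pos (∃' t B) σ θ
    ∇p : ∀ {σ t B} {θ : Sub Γ (σ ++ G₀)} → Pos B (t ∷ σ) (liftS θ) → Pos (∇' t B) σ θ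
    atomp : ∀ {σ q ts} {θ : Sub Γ (σ ++ G₀)} → Atom q σ (All.map (sub θ) ts) → Pos (atom q ts) σ θ

One? : (σ : Ctx) → Tm (σ ++ G₀) pr → Tm (σ ++ G₀) ac → Tm (σ ++ G₀) pr → Set
One? σ P A Q = Atom one σ (P ∷ A ∷ Q ∷ [])

Onep? : (σ : Ctx) → Tm (σ ++ G₀) pr → Tm (σ ++ G₀) (nm ⇒ ac) → Tm (σ ++ G₀) (nm ⇒ pr) → Set
Onep? σ P A M = Atom onep σ (P ∷ A ∷ M ∷ [])

-- Only transitions stand to the left of an arrow, and they are already defined: this is the
-- stratification of the definition.
data Bis : (σ : Ctx) → Tm (σ ++ G₀) pr → Tm (σ ++ G₀) pr → Set where
  bis : ∀ {σ P Q} →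
    (∀ A P' → One? σ P A P' → Σ _ λ Q' → One? σ Q A Q' × Bis σ P' Q') ×
    (∀ A Q' → One? σ Q A Q' → Σ _ λ P' → One? σ P A P' × Bis σ Q' P') ×
    (∀ X P' → Onep? σ P (↓T X) P' → Σ _ λ Q' → Onep? σ Q (↓T X) Q' × (∀ w → Bis σ (P' · w) (Q' · w))) ×
    (∀ X Q' → Onep? σ Q (↓T X) Q' → Σ _ λ P' → Onep? σ P (↓T X) P' × (∀ w → Bis σ (Q' · w) (P' · w))) ×
    (∀ X P' → Onep? σ P (↑T X) P' → Σ _ λ Q' → Onep? σ Q (↑T X) Q' × Bis (nm ∷ σ) (ren vs P' · var vz) (ren vs Q' · var vz)) ×
    (∀ X Q' → Onep? σ Q (↑T X) Q' → Σ _ λ P' → Onep? σ P (↑T X) P' × Bis (nm ∷ σ) (ren vs Q' · var vz) (ren vs P' · var vz)) →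
    Bis σ P Q

SatA : (q : Pred) (σ : Ctx) → All (Tm (σ ++ G₀)) (arity q) → Set
SatA one    σ as           = Atom one σ as
SatA onep   σ as           = Atom onep σ as
SatA lbisim σ (P ∷ Q ∷ []) = Bis σ P Q
SatA (eq t) σ as           = Atom (eq t) σ as

Sat : Fm Γ → (σ : Ctx) → Sub Γ (σ ++ G₀) → Set
Sat (atom q ts) σ θ = SatA q σ (All.map (sub θ) ts)
Sat ⊤'          σ θ = ⊤
Sat ⊥'          σ θ = ⊥
Sat (A ∧' B)    σ θ = Sat A σ θ × Sat B σ θ
Sat (A ∨' B)    σ θ = Sat A σ θ ⊎ Sat B σ θ
Sat (A ⊃' B)    σ θ = Sat A σ θ → Sat B σ θ
Sat (∀' t B)    σ θ = (T : Tm (σ ++ G₀) t) → Sat B σ (θ ▸ T)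
Sat (∃' t B)    σ θ = Σ (Tm (σ ++ G₀) t) λ T → Sat B σ (θ ▸ T)
Sat (∇' t B)    σ θ = Sat B (t ∷ σ) (liftS θ)

atomF-≈ : ∀ {q q'} {as bs : All (Tm Γ) (arity q)} {cs : All (Tm Γ) (arity q')} → ArgsEq bs as →
          atom q as ≈F atom q' cs → atom q bs ≈F atom q' cs
atomF-≈ p (atomc e) = atomc (ArgsEq-trans p e)

Atom-≈ : ∀ {q σ} {as bs : All (Tm (σ ++ G₀)) (arity q)} → ArgsEq as bs → Atom q σ as → Atom q σ bs
Atom-≈ e (fold c d ξ h b) = fold c d ξ (atomF-≈ (ArgsEq-sym e) h) b

One?-≈ : ∀ {σ P P₁ A Q} → P ≈ P₁ → One? σ P A Q → One? σ P₁ A Q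
One?-≈ p = Atom-≈ (p ∷ ≈refl ∷ ≈refl ∷ [])

Onep?-≈ : ∀ {σ P P₁ A M} → P ≈ P₁ → Onep? σ P A M → Onep? σ P₁ A M
Onep?-≈ p = Atom-≈ (p ∷ ≈refl ∷ ≈refl ∷ [])

Bis-≈ : ∀ {σ P P₁ Q Q₁} → P ≈ P₁ → Q ≈ Q₁ → Bis σ P Q → Bis σ P₁ Q₁
Bis-≈ p q (bis (a , b , c , d , e , f)) = bis
  ( (λ A P' o → let Q' , o' , r = a A P' (One?-≈ (≈sym p) o) in Q' , One?-≈ q o' , r)
  , (λ A P' o → let Q' , o' , r = b A P' (One?-≈ (≈sym q) o) in Q' , One?-≈ p o' , r)
  , (λ X P' o → let Q' , o' , r = c X P' (Onep?-≈ (≈sym p) o) in Q' , Onep?-≈ q o' , r)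
  , (λ X P' o → let Q' , o' , r = d X P' (Onep?-≈ (≈sym q) o) in Q' , Onep?-≈ p o' , r)
  , (λ X P' o → let Q' , o' , r = e X P' (Onep?-≈ (≈sym p) o) in Q' , Onep?-≈ q o' , r)
  , (λ X P' o → let Q' , o' , r = f X P' (Onep?-≈ (≈sym q) o) in Q' , Onep?-≈ p o' , r))

SatA-≈ : ∀ q {σ} {as bs : All (Tm (σ ++ G₀)) (arity q)} → ArgsEq as bs → SatA q σ as → SatA q σ bs
SatA-≈ one    e a = Atom-≈ e a
SatA-≈ onep   e a = Atom-≈ e a
SatA-≈ (eq t) e a = Atom-≈ e a
SatA-≈ lbisim {as = _ ∷ _ ∷ []} {_ ∷ _ ∷ []} (p ∷ q ∷ []) a = Bis-≈ p q a

▸-≈ : {θ : Sub Δ Θ} {ξ : Sub Γ Δ} {ζ : Sub Γ Θ} {T : Tm Θ s} → (∀ {t} (x : Var Γ t) → sub θ (ξ x) ≈ ζ x) →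
      (x : Var (s ∷ Γ) t) → sub (θ ▸ T) (liftS ξ x) ≈ (ζ ▸ T) x
▸-≈ h vz = ≈refl
▸-≈ {ξ = ξ} h (vs x) = ≈trans (≡⇒≈ (sub-ren (λ _ → refl) (ξ x))) (h x)

lift-≈ : {θ : Sub Δ Θ} {ξ : Sub Γ Δ} {ζ : Sub Γ Θ} → (∀ {t} (x : Var Γ t) → sub θ (ξ x) ≈ ζ x) →
         (x : Var (s ∷ Γ) t) → sub (liftS θ) (liftS ξ x) ≈ liftS ζ x
lift-≈ h vz = ≈refl
lift-≈ {θ = θ} {ξ} h (vs x) = ≈trans (≡⇒≈ (sub-wk θ (ξ x))) (ren-≈ vs (h x))

args-≈ : {θ : Sub Δ Θ} {ξ : Sub Γ Δ} {ζ : Sub Γ Θ} → (∀ {t} (x : Var Γ t) → sub θ (ξ x) ≈ ζ x) →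
         {ts : List Ty} (as : All (Tm Γ) ts) → ArgsEq (All.map (sub θ) (All.map (sub ξ) as)) (All.map (sub ζ) as)
args-≈ h []       = []
args-≈ h (a ∷ as) = ≈trans (≡⇒≈ (sub-sub (λ _ → refl) a)) (sub-cong≈ h a) ∷ args-≈ h as

mutual
  -- A substitution lemma up to βη, because an instantiated eigenvariable yields the intended term
  -- only up to conversion. It is proved together with its converse as implication is contravariant.
  Sat-sub : ∀ {σ} {θ : Sub Δ (σ ++ G₀)} {ξ : Sub Γ Δ} {ζ : Sub Γ (σ ++ G₀)} →
            (∀ {t} (x : Var Γ t) → sub θ (ξ x) ≈ ζ x) → (B : Fm Γ) → Sat (subF ξ B) σ θ → Sat B σ ζ
  Sat-sub h (atom q ts) a        = SatA-≈ q (args-≈ h ts) a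
  Sat-sub h ⊤'          a        = a
  Sat-sub h (A ∧' B)    (a , b)  = Sat-sub h A a , Sat-sub h B b
  Sat-sub h (A ∨' B)    (inj₁ a) = inj₁ (Sat-sub h A a)
  Sat-sub h (A ∨' B)    (inj₂ b) = inj₂ (Sat-sub h B b)
  Sat-sub h (A ⊃' B)    f        = λ a → Sat-sub h B (f (Sat-sub⁻ h A a))
  Sat-sub h (∀' t B)    f        = λ T → Sat-sub (▸-≈ h) B (f T)
  Sat-sub h (∃' t B)    (T , b)  = T , Sat-sub (▸-≈ h) B b
  Sat-sub h (∇' t B)    b        = Sat-sub (lift-≈ h) B b

  Sat-sub⁻ : ∀ {σ} {θ : Sub Δ (σ ++ G₀)} {ξ : Sub Γ Δ} {ζ : Sub Γ (σ ++ G₀)} →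
             (∀ {t} (x : Var Γ t) → sub θ (ξ x) ≈ ζ x) → (B : Fm Γ) → Sat B σ ζ → Sat (subF ξ B) σ θ
  Sat-sub⁻ h (atom q ts) a        = SatA-≈ q (ArgsEq-sym (args-≈ h ts)) a
  Sat-sub⁻ h ⊤'          a        = a
  Sat-sub⁻ h (A ∧' B)    (a , b)  = Sat-sub⁻ h A a , Sat-sub⁻ h B b
  Sat-sub⁻ h (A ∨' B)    (inj₁ a) = inj₁ (Sat-sub⁻ h A a)
  Sat-sub⁻ h (A ∨' B)    (inj₂ b) = inj₂ (Sat-sub⁻ h B b)
  Sat-sub⁻ h (A ⊃' B)    f        = λ a → Sat-sub⁻ h B (f (Sat-sub h A a))
  Sat-sub⁻ h (∀' t B)    f        = λ T → Sat-sub⁻ (▸-≈ h) B (f T)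
  Sat-sub⁻ h (∃' t B)    (T , b)  = T , Sat-sub⁻ (▸-≈ h) B b
  Sat-sub⁻ h (∇' t B)    b        = Sat-sub⁻ (lift-≈ h) B b

≈F-sym : {A B : Fm Γ} → A ≈F B → B ≈F A
≈F-sym (atomc e) = atomc (ArgsEq-sym e)
≈F-sym ⊤c        = ⊤c
≈F-sym ⊥c        = ⊥c
≈F-sym (∧c p q)  = ∧c (≈F-sym p) (≈F-sym q)
≈F-sym (∨c p q)  = ∨c (≈F-sym p) (≈F-sym q)
≈F-sym (⊃c p q)  = ⊃c (≈F-sym p) (≈F-sym q)
≈F-sym (∀c p)    = ∀c (≈F-sym p)
≈F-sym (∃c p)    = ∃c (≈F-sym p)
≈F-sym (∇c p)    = ∇c (≈F-sym p)

Sat-≈F : ∀ {σ} {θ : Sub Γ (σ ++ G₀)} {A B : Fm Γ} → A ≈F B → Sat A σ θ → Sat B σ θ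
Sat-≈F {θ = θ} (atomc {q = q} e) a = SatA-≈ q (ArgsEq-sub θ e) a
Sat-≈F ⊤c       a        = a
Sat-≈F (∧c p q) (a , b)  = Sat-≈F p a , Sat-≈F q b
Sat-≈F (∨c p q) (inj₁ a) = inj₁ (Sat-≈F p a)
Sat-≈F (∨c p q) (inj₂ b) = inj₂ (Sat-≈F q b)
Sat-≈F (⊃c p q) f        = λ a → Sat-≈F q (f (Sat-≈F (≈F-sym p) a))
Sat-≈F (∀c p)   f        = λ T → Sat-≈F p (f T)
Sat-≈F (∃c p)   (T , b)  = T , Sat-≈F p b
Sat-≈F (∇c p)   b        = Sat-≈F p b

lbisimClause : Clause
lbisimClause = clause (pr ∷ pr ∷ []) lbisim (v1 ∷ v0 ∷ []) lbisimBody

no-lbisim : ∀ {σ as} → ¬ Atom lbisim σ as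
no-lbisim (fold _ c-lbisim ξ e (∧p () _))

Pos⇒Sat : ∀ {σ} {θ : Sub Γ (σ ++ G₀)} {B : Fm Γ} → Pos B σ θ → Sat B σ θ
Pos⇒Sat ⊤p       = tt
Pos⇒Sat (∧p a b) = Pos⇒Sat a , Pos⇒Sat b
Pos⇒Sat (∃p T b) = T , Pos⇒Sat b
Pos⇒Sat (∇p b)   = Pos⇒Sat b
Pos⇒Sat (atomp {q = one} a)    = a
Pos⇒Sat (atomp {q = onep} a)   = a
Pos⇒Sat (atomp {q = eq t} a)   = a
Pos⇒Sat (atomp {q = lbisim} a) = ⊥-elim (no-lbisim a)

Positive : Fm Γ → Set
Positive (atom lbisim _)  = ⊥
Positive (atom _ _)       = ⊤
Positive ⊤'               = ⊤
Positive (A ∧' B)         = Positive A × Positive B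
Positive (∃' t B)         = Positive B
Positive (∇' t B)         = Positive B
Positive _                = ⊥

Sat⇒Pos : ∀ {σ} {θ : Sub Γ (σ ++ G₀)} (B : Fm Γ) → Positive B → Sat B σ θ → Pos B σ θ
Sat⇒Pos (atom one _)    p a       = atomp a
Sat⇒Pos (atom onep _)   p a       = atomp a
Sat⇒Pos (atom (eq t) _) p a       = atomp a
Sat⇒Pos ⊤'              p a       = ⊤p
Sat⇒Pos (A ∧' B) (p , q)  (a , b) = ∧p (Sat⇒Pos A p a) (Sat⇒Pos B q b)
Sat⇒Pos (∃' t B) p        (T , b) = ∃p T (Sat⇒Pos B p b)
Sat⇒Pos (∇' t B) p        b       = ∇p (Sat⇒Pos B p b)

clauses-positive : {c : Clause} → Dpi c → c ≡ lbisimClause ⊎ Positive (cbody c)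
clauses-positive c-tau    = inj₂ _
clauses-positive c-in     = inj₂ _
clauses-positive c-out    = inj₂ _
clauses-positive c-match  = inj₂ _
clauses-positive c-matchp = inj₂ _
clauses-positive c-sumL   = inj₂ _
clauses-positive c-sumR   = inj₂ _
clauses-positive c-sumLp  = inj₂ _
clauses-positive c-sumRp  = inj₂ _
clauses-positive c-parL   = inj₂ _
clauses-positive c-parR   = inj₂ _
clauses-positive c-parLp  = inj₂ _
clauses-positive c-parRp  = inj₂ _
clauses-positive c-res    = inj₂ _
clauses-positive c-resp   = inj₂ _
clauses-positive c-open   = inj₂ _
clauses-positive c-closeL = inj₂ _
clauses-positive c-closeR = inj₂ _
clauses-positive c-comL   = inj₂ _
clauses-positive c-comR   = inj₂ _
clauses-positive c-lbisim = inj₁ refl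
clauses-positive (c-eq t) = inj₂ _

Atom⇒SatA : ∀ q {σ as} → Atom q σ as → SatA q σ as
Atom⇒SatA one    a = a
Atom⇒SatA onep   a = a
Atom⇒SatA (eq t) a = a
Atom⇒SatA lbisim a = ⊥-elim (no-lbisim a)

-- Closure of the model under every clause, as `defR` requires; `Sat-unfold` is the converse, as
-- `defL` requires.
Sat-fold : ∀ {c σ} → Dpi c → (ξ : Sub (cvars c) (σ ++ G₀)) → Sat (cbody c) σ ξ → Sat (atom (cpred c) (chead c)) σ ξ
Sat-fold {c} d ξ b with clauses-positive d
... | inj₁ refl = bis b
... | inj₂ p    = Atom⇒SatA (cpred c) (fold c d ξ (≈F-refl _) (Sat⇒Pos (cbody c) p b))

record Unfolding (q : Pred) (σ : Ctx) (as : All (Tm (σ ++ G₀)) (arity q)) : Set where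
  field
    c    : Clause
    d    : Dpi c
    ξ    : Sub (cvars c) (σ ++ G₀)
    head : atom q as ≈F atom (cpred c) (All.map (sub ξ) (chead c))
    body : Sat (cbody c) σ ξ

Sat-unfold : ∀ q {σ as} → SatA q σ as → Unfolding q σ as
Sat-unfold one    (fold c d ξ h b) = record { d = d ; head = h ; body = Pos⇒Sat b }
Sat-unfold onep   (fold c d ξ h b) = record { d = d ; head = h ; body = Pos⇒Sat b }
Sat-unfold (eq t) (fold c d ξ h b) = record { d = d ; head = h ; body = Pos⇒Sat b }
Sat-unfold lbisim {as = P ∷ Q ∷ []} (bis b) =
  record { d = c-lbisim ; ξ = (emp ▸ P) ▸ Q ; head = ≈F-refl _ ; body = b }

-- Validity of sequents in the term model

SatJ : Sub G G₀ → Judg G → Set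
SatJ γ (σ , B) = Sat B σ (underS σ γ)

underS-∘≈ : (σ : Ctx) {θ : Sub Δ Θ} {ξ : Sub Γ Δ} {ζ : Sub Γ Θ} → (∀ {t} (x : Var Γ t) → sub θ (ξ x) ≈ ζ x) →
            (x : Var (σ ++ Γ) t) → act σ θ (underS σ ξ x) ≈ underS σ ζ x
underS-∘≈ []      h x = h x
underS-∘≈ (s ∷ σ) h x = lift-≈ (underS-∘≈ σ h) x

SatJ-sub : {γ : Sub Δ G₀} {ξ : Sub G Δ} {γ' : Sub G G₀} → (∀ {t} (x : Var G t) → sub γ (ξ x) ≈ γ' x) →
           (J : Judg G) → SatJ γ (subJ ξ J) → SatJ γ' J
SatJ-sub h (σ , B) = Sat-sub (underS-∘≈ σ h) B

SatJ-sub⁻ : {γ : Sub Δ G₀} {ξ : Sub G Δ} {γ' : Sub G G₀} → (∀ {t} (x : Var G t) → sub γ (ξ x) ≈ γ' x) →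
            (J : Judg G) → SatJ γ' J → SatJ γ (subJ ξ J)
SatJ-sub⁻ h (σ , B) = Sat-sub⁻ (underS-∘≈ σ h) B

SatJ-wk : {γ : Sub G G₀} {h : Tm G₀ s} (J : Judg G) → SatJ γ J → SatJ (γ ▸ h) (renJ vs J)
SatJ-wk {γ = γ} {h} J a = subst (SatJ (γ ▸ h)) (sym (renJ-wk J)) (SatJ-sub⁻ (λ _ → ≈refl) J a)

SatJ-wk⁻ : {γ : Sub G G₀} {h : Tm G₀ s} (J : Judg G) → SatJ (γ ▸ h) (renJ vs J) → SatJ γ J
SatJ-wk⁻ {γ = γ} {h} J a = SatJ-sub (λ _ → ≈refl) J (subst (SatJ (γ ▸ h)) (renJ-wk J) a)

All-map : ∀ {A B : Set} {P : A → Set} {Q : B → Set} {f : A → B} → (∀ a → P a → Q (f a)) → {as : List A} → All P as → All Q (map f as)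
All-map h []       = []
All-map h (p ∷ ps) = h _ p ∷ All-map h ps

raise-≈ : (σ : Ctx) (γ : Sub G G₀) (T : Tm (σ ++ G₀) t) (x : Var (t ∷ (σ ++ G)) u) →
          act σ (γ ▸ abstr σ T) (raiseSub σ x) ≈ (underS σ γ ▸ T) x
raise-≈ σ γ T vz     = abstr-raise σ γ T
raise-≈ σ γ T (vs x) = ≡⇒≈ (underS-vs σ γ (abstr σ T) x)

inst-≈ : (σ : Ctx) (γ : Sub G G₀) (T : Tm (σ ++ G) t) (x : Var (t ∷ (σ ++ G)) u) →
         act σ γ (sub1 T x) ≈ (underS σ γ ▸ act σ γ T) x
inst-≈ σ γ T vz     = ≈refl
inst-≈ σ γ T (vs x) = ≈refl

sound : {Γ : List (Judg G)} {C : Judg G} → G ⊢ Γ ⊢ C → (γ : Sub G G₀) → All (SatJ γ) Γ → SatJ γ C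
sound (init e) γ (a ∷ []) = Sat-≈F e a
sound (cut {Δ = Δ} d d') γ as = sound d' γ (sound d γ (AllP.++⁻ˡ Δ as) ∷ AllP.++⁻ʳ Δ as)
sound (exch p d) γ as = sound d γ (All-resp-↭ (↭-sym p) as)
sound (contr d) γ (a ∷ as) = sound d γ (a ∷ a ∷ as)
sound (weak d) γ (a ∷ as) = sound d γ as
sound ⊥L γ (() ∷ as)
sound ⊤R γ as = tt
sound (∧L₁ d) γ ((a , b) ∷ as) = sound d γ (a ∷ as)
sound (∧L₂ d) γ ((a , b) ∷ as) = sound d γ (b ∷ as)
sound (∧R d d') γ as = sound d γ as , sound d' γ as
sound (∨L d d') γ (inj₁ a ∷ as) = sound d γ (a ∷ as)
sound (∨L d d') γ (inj₂ a ∷ as) = sound d' γ (a ∷ as)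
sound (∨R₁ d) γ as = inj₁ (sound d γ as)
sound (∨R₂ d) γ as = inj₂ (sound d γ as)
sound (⊃L {Δ = Δ} d d') γ (f ∷ as) = sound d' γ (f (sound d γ (AllP.++⁻ˡ Δ as)) ∷ AllP.++⁻ʳ Δ as)
sound (⊃R d) γ as = λ a → sound d γ (a ∷ as)
sound (∀L {σ} {B = B} T d) γ (f ∷ as) = sound d γ (Sat-sub⁻ (inst-≈ σ γ T) B (f (act σ γ T)) ∷ as)
sound (∀R {σ} {B = B} d) γ as = λ T → Sat-sub (raise-≈ σ γ T) B (sound d (γ ▸ abstr σ T) (All-map SatJ-wk as))
sound (∃L {σ} {B = B} {C = C} d) γ ((T , b) ∷ as) =
  SatJ-wk⁻ C (sound d (γ ▸ abstr σ T) (Sat-sub⁻ (raise-≈ σ γ T) B b ∷ All-map SatJ-wk as))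
sound (∃R {σ} {B = B} T d) γ as = act σ γ T , Sat-sub (inst-≈ σ γ T) B (sound d γ as)
sound (∇L d) γ (a ∷ as) = sound d γ (a ∷ as)
sound (∇R d) γ as = sound d γ as
sound (defR {σ} c d ξ e p) γ as = Sat-≈F e (Sat-sub⁻ {ξ = ξ} (λ _ → ≈refl) (atom (cpred c) (chead c))
  (Sat-fold d _ (Sat-sub {ξ = ξ} (λ _ → ≈refl) (cbody c) (sound p γ as))))
sound {G} (defL {σ} {q} {ts} {C = C} csu ps) γ (a ∷ as) with Sat-unfold q a
... | record { c = c ; d = d ; ξ = ξ ; head = h ; body = b }
  -- The clause instance that makes the atom true, together with the valuation `γ`, is a unifier
  -- into `G₀`. By completeness it factors through some unifier of the rule, and the premise for
  -- that one is used under the factor `ζ`.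
  with complete (csu c d) (record { G' = G₀ ; ρ = γ ; θ = ξ ; unifies = h })
... | i , ζ , r₁ , r₂ = SatJ-sub r₁ C (sound (ps c d i) ζ (Sat-sub⁻ r₂ (cbody c) b ∷ All-map (SatJ-sub⁻ r₁) as))

-- Labels and abstractions as terms

trA : (Fin n → Tm Γ nm) → Act′ n → Tm Γ ac
trA e τ′         = τT
trA e (out′ x y) = ↑T2 (e x) (e y)

dirT : Dir → Tm Γ nm → Tm Γ (nm ⇒ ac)
dirT dn = ↓T
dirT up = ↑T

trM : (Fin n → Tm Γ nm) → Pr (suc n) → Tm Γ (nm ⇒ pr)
trM e m = lam (trT (upT e) m)

trA-≈ : {e h : Fin n → Tm Γ nm} → (∀ i → e i ≈ h i) → (α : Act′ n) → trA e α ≈ trA h α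
trA-≈ q τ′         = ≈refl
trA-≈ q (out′ x y) = appc (appc ≈refl (q x)) (q y)

upT-≈ : {e h : Fin n → Tm Γ nm} → (∀ i → e i ≈ h i) → ∀ i → upT e i ≈ upT h i
upT-≈ q zero    = ≈refl
upT-≈ q (suc i) = ren-≈ vs (q i)

sub-upT : (θ : Sub Γ Δ) (e : Fin n → Tm Γ nm) → ∀ i → sub (liftS θ) (upT e i) ≡ upT (λ j → sub θ (e j)) i
sub-upT θ e zero    = refl
sub-upT θ e (suc i) = sub-wk θ (e i)

trM-≈ : {e h : Fin n → Tm Γ nm} → (∀ i → e i ≈ h i) → (m : Pr (suc n)) → trM e m ≈ trM h m
trM-≈ q m = lamc (trT-≈ (upT-≈ q) m)

sub-trM : (θ : Sub Γ Δ) (e : Fin n → Tm Γ nm) (m : Pr (suc n)) → sub θ (trM e m) ≡ trM (λ i → sub θ (e i)) m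
sub-trM θ e m = cong lam (sub-trT (sub-upT θ e) m)

dirT-≈ : ∀ d {M N : Tm Γ nm} → M ≈ N → dirT d M ≈ dirT d N
dirT-≈ dn p = appc ≈refl p
dirT-≈ up p = appc ≈refl p

sub-dirT : (θ : Sub Γ Δ) → ∀ d {M : Tm Γ nm} → sub θ (dirT d M) ≡ dirT d (sub θ M)
sub-dirT θ dn = refl
sub-dirT θ up = refl

-- These labels are partial applications; applied to a new variable they become full labels of type
-- `ac`, to which injectivity of constants applies.
dirT-injective : ∀ d d' {M N : Tm Γ nm} → dirT d M ≈ dirT d' N → d ≡ d' × M ≈ N
dirT-injective {Γ} d d' {M} {N} p = go d d' (appc (ren-≈ (vs {s = nm}) p) (≈refl {M = var vz}))
  where
  go : ∀ d d' → app (ren vs (dirT d M)) (var vz) ≈ app (ren vs (dirT d' N)) (var vz) → d ≡ d' × M ≈ N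
  go dn dn q = refl , wk-cancel M (proj₁ (label-injective ↓C q))
  go up up q = refl , wk-cancel M (proj₁ (label-injective ↑C q))
  go dn up q with head-≈ q
  ... | ()
  go up dn q with head-≈ q
  ... | ()

apply-wk : {M : Tm Γ (s ⇒ t)} {B : Tm (s ∷ Γ) t} → M ≈ lam B → app (ren vs M) (var vz) ≈ B
apply-wk {B = B} p = ≈trans (appc (ren-≈ vs p) ≈refl) (wkβ B)

η-lam : {M : Tm Γ (s ⇒ t)} {B : Tm (s ∷ Γ) t} → app (ren vs M) (var vz) ≈ B → M ≈ lam B
η-lam p = ≈trans η (lamc p)

trT-wk : (e : Fin n → Tm Γ nm) (p : Pr n) → trT (upT e) (wkPr p) ≡ ren vs (trT e p)
trT-wk e p = trans (trT-map (λ _ → refl) p) (sym (ren-trT (λ _ → refl) p))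

trA-wk : (e : Fin n → Tm Γ nm) (α : Act′ n) → trA (upT e) (wkAct α) ≡ ren vs (trA e α)
trA-wk e τ′         = refl
trA-wk e (out′ x y) = refl

inst-β : (e : Fin n → Tm Γ nm) (y : Fin n) (m : Pr (suc n)) → app (trM e m) (e y) ≈ trT e (inst y m)
inst-β e y m = ≈trans β (≡⇒≈ (trans
  (sub-trT {h = e ▹ e y} (λ { zero → refl ; (suc i) → sub1-wk (e y) (e i) }) m)
  (sym (trT-map (λ { zero → refl ; (suc i) → refl }) m))))

swapS : Sub (s ∷ t ∷ Γ) (t ∷ s ∷ Γ)
swapS = ((λ x → var (vs (vs x))) ▸ var vz) ▸ var (vs vz)

-- In the `onep` clause for ν the abstraction is applied to n and m below the binders of m and n, in
-- this order, whereas in its own body m is innermost. The β-steps therefore exchange two variables.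
swap-β : (X : Tm (s ∷ t ∷ Γ) u) →
         app (app (ren vs (ren vs (lam (lam X)))) (var vz)) (var (vs vz)) ≈ sub swapS X
swap-β {s} {t} {Γ} X = ≈trans (appc β ≈refl) (≈trans β (≡⇒≈ (trans (sub-sub ζ≡ (ren r₂ (ren r₁ X)))
    (trans (cong (sub ζ) (ren-ren {ρ'' = r₁₂} ρ≡ X)) (sub-ren {ξ = swapS} ξ≡ X)))))
  where
  r₁ : Ren (s ∷ t ∷ Γ) (s ∷ t ∷ s ∷ Γ)
  r₁ = liftR (liftR vs)
  r₂ : Ren (s ∷ t ∷ s ∷ Γ) (s ∷ t ∷ t ∷ s ∷ Γ)
  r₂ = liftR (liftR vs)
  r₁₂ : Ren (s ∷ t ∷ Γ) (s ∷ t ∷ t ∷ s ∷ Γ)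
  r₁₂ = liftR (liftR (λ x → vs (vs x)))
  ζ : Sub (s ∷ t ∷ t ∷ s ∷ Γ) (t ∷ s ∷ Γ)
  ζ = (var ▸ var vz) ▸ var (vs vz)
  ζ≡ : ∀ {v} (x : Var (s ∷ t ∷ t ∷ s ∷ Γ) v) → sub (sub1 (var (vs vz))) (liftS (sub1 (var vz)) x) ≡ ζ x
  ζ≡ vz          = refl
  ζ≡ (vs vz)     = refl
  ζ≡ (vs (vs x)) = refl
  ρ≡ : ∀ {v} (x : Var (s ∷ t ∷ Γ) v) → r₂ (r₁ x) ≡ r₁₂ x
  ρ≡ vz          = refl
  ρ≡ (vs vz)     = refl
  ρ≡ (vs (vs x)) = refl
  ξ≡ : ∀ {v} (x : Var (s ∷ t ∷ Γ) v) → ζ (r₁₂ x) ≡ swapS x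
  ξ≡ vz          = refl
  ξ≡ (vs vz)     = refl
  ξ≡ (vs (vs x)) = refl

swap-trT : (e : Fin n → Tm Γ nm) (m : Pr (suc (suc n))) →
           sub swapS (trT (upT (upT e)) m) ≡ trT (upT (upT e)) (mapPr swap m)
swap-trT e m = trans (sub-trT {h = λ i → upT (upT e) (swap i)} (λ { zero → refl ; (suc zero) → refl ; (suc (suc i)) → h≡ i }) m)
  (sym (trT-map (λ _ → refl) m))
  where
  h≡ : ∀ i → sub swapS (ren vs (ren vs (e i))) ≡ ren vs (ren vs (e i))
  h≡ i = trans (cong (sub swapS) (ren-ren (λ _ → refl) (e i)))
    (trans (sub-ren (λ _ → refl) (e i)) (trans (sym (ren-as-sub (λ _ → refl) (e i))) (sym (ren-ren (λ _ → refl) (e i)))))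

swap-target : {e : Fin n → Tm Γ nm} {M : Tm Γ (nm ⇒ nm ⇒ pr)} (m : Pr (suc (suc n))) → M ≈ lam (trM (upT e) m) →
              lam (νT (lam (app (app (ren vs (ren vs M)) (var vz)) (var (vs vz))))) ≈ trM e (res′ (mapPr swap m))
swap-target {e = e} m p = lamc (appc ≈refl (lamc (≈trans
  (appc (appc (ren-≈ vs (ren-≈ vs p)) ≈refl) ≈refl)
  (≈trans (swap-β _) (≡⇒≈ (swap-trT e m))))))

-- Derivability of transitions

mutual
  -- Each transition rule is an application of `defR` to the matching clause. The arguments are
  -- given up to βη so that the redexes in the clause heads and bodies are absorbed by the
  -- conversions.
  Step-R : {p p' : Pr n} {α : Act′ n} → Step p α p' → ∀ {σ Γ} (e : Fin n → Tm (σ ++ G) nm) {P A Q} →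
           P ≈ trT e p → A ≈ trA e α → Q ≈ trT e p' → G ⊢ Γ ⊢ (σ , One P A Q)
  Step-R (tau {p}) e hP hA hQ = defR _ c-tau (emp ▸ trT e p) (atomc (≈sym hP ∷ ≈sym hA ∷ ≈sym hQ ∷ [])) ⊤R
  Step-R (out {x} {y} {p}) e hP hA hQ =
    defR _ c-out (((emp ▸ e x) ▸ e y) ▸ trT e p) (atomc (≈sym hP ∷ ≈sym hA ∷ ≈sym hQ ∷ [])) ⊤R
  Step-R (mat {x} {p} s) e {A = A} {Q} hP hA hQ =
    defR _ c-match ((((emp ▸ e x) ▸ trT e p) ▸ A) ▸ Q) (atomc (≈sym hP ∷ ≈refl ∷ ≈refl ∷ [])) (Step-R s e ≈refl hA hQ)
  Step-R (sumL {p} {q} s) e {A = A} {Q} hP hA hQ =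
    defR _ c-sumL ((((emp ▸ trT e p) ▸ trT e q) ▸ A) ▸ Q) (atomc (≈sym hP ∷ ≈refl ∷ ≈refl ∷ [])) (Step-R s e ≈refl hA hQ)
  Step-R (sumR {p} {q} s) e {A = A} {Q} hP hA hQ =
    defR _ c-sumR ((((emp ▸ trT e p) ▸ trT e q) ▸ A) ▸ Q) (atomc (≈sym hP ∷ ≈refl ∷ ≈refl ∷ [])) (Step-R s e ≈refl hA hQ)
  Step-R (parL {p} {q} {p' = p'} s) e {A = A} hP hA hQ =
    defR _ c-parL ((((emp ▸ trT e p) ▸ trT e q) ▸ A) ▸ trT e p') (atomc (≈sym hP ∷ ≈refl ∷ ≈sym hQ ∷ [])) (Step-R s e ≈refl hA ≈refl)
  Step-R (parR {p} {q} {q' = q'} s) e {A = A} hP hA hQ =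
    defR _ c-parR ((((emp ▸ trT e p) ▸ trT e q) ▸ A) ▸ trT e q') (atomc (≈sym hP ∷ ≈refl ∷ ≈sym hQ ∷ [])) (Step-R s e ≈refl hA ≈refl)
  Step-R (res {b} {α} {b'} s) e {A = A} hP hA hQ =
    defR _ c-res (((emp ▸ trM e b) ▸ A) ▸ trM e b')
      (atomc (≈trans (appc ≈refl (≈sym η)) (≈sym hP) ∷ ≈refl ∷ ≈trans (appc ≈refl (≈sym η)) (≈sym hQ) ∷ []))
      (∇R (Step-R s (upT e) (wkβ _) (≈trans (ren-≈ vs hA) (≡⇒≈ (sym (trA-wk e α)))) (wkβ _)))
  Step-R (close dn {p} {q} {x} {m} {m'} s r) e hP hA hQ =
    defR _ c-closeL ((((emp ▸ trT e p) ▸ trT e q) ▸ trM e m) ▸ trM e m')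
      (atomc (≈sym hP ∷ ≈sym hA ∷ ≈trans (appc ≈refl (lamc (appc (appc ≈refl (wkβ _)) (wkβ _)))) (≈sym hQ) ∷ []))
      (∃R (e x) (∧R (Stepp-R s e (≡⇒≈ (sub1-wk _ _)) ≈refl (≡⇒≈ (sub1-wk (e x) (trM e m))))
                    (Stepp-R r e (≡⇒≈ (sub1-wk _ _)) ≈refl (≡⇒≈ (sub1-wk (e x) (trM e m'))))))
  Step-R (close up {p} {q} {x} {m} {m'} s r) e hP hA hQ =
    defR _ c-closeR ((((emp ▸ trT e p) ▸ trT e q) ▸ trM e m) ▸ trM e m')
      (atomc (≈sym hP ∷ ≈sym hA ∷ ≈trans (appc ≈refl (lamc (appc (appc ≈refl (wkβ _)) (wkβ _)))) (≈sym hQ) ∷ []))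
      (∃R (e x) (∧R (Stepp-R s e (≡⇒≈ (sub1-wk _ _)) ≈refl (≡⇒≈ (sub1-wk (e x) (trM e m))))
                    (Stepp-R r e (≡⇒≈ (sub1-wk _ _)) ≈refl (≡⇒≈ (sub1-wk (e x) (trM e m'))))))
  Step-R (comL {p} {q} {x} {y} {m} {q'} s r) e hP hA hQ =
    defR _ c-comL (((((emp ▸ trT e p) ▸ trT e q) ▸ trM e m) ▸ e y) ▸ trT e q')
      (atomc (≈sym hP ∷ ≈sym hA ∷ ≈trans (appc (appc ≈refl (inst-β e y m)) ≈refl) (≈sym hQ) ∷ []))
      (∃R (e x) (∧R (Stepp-R s e (≡⇒≈ (sub1-wk _ _)) ≈refl (≡⇒≈ (sub1-wk (e x) (trM e m))))
                    (Step-R r e (≡⇒≈ (sub1-wk _ _)) (appc ≈refl (≡⇒≈ (sub1-wk (e x) (e y)))) (≡⇒≈ (sub1-wk _ _)))))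
  Step-R (comR {p} {q} {x} {y} {p'} {m} s r) e hP hA hQ =
    defR _ c-comR (((((emp ▸ trT e p) ▸ trT e q) ▸ trT e p') ▸ trM e m) ▸ e y)
      (atomc (≈sym hP ∷ ≈sym hA ∷ ≈trans (appc (appc ≈refl ≈refl) (inst-β e y m)) (≈sym hQ) ∷ []))
      (∃R (e x) (∧R (Step-R s e (≡⇒≈ (sub1-wk _ _)) (appc ≈refl (≡⇒≈ (sub1-wk (e x) (e y)))) (≡⇒≈ (sub1-wk _ _)))
                    (Stepp-R r e (≡⇒≈ (sub1-wk _ _)) ≈refl (≡⇒≈ (sub1-wk (e x) (trM e m))))))

  Stepp-R : {p : Pr n} {d : Dir} {x : Fin n} {m : Pr (suc n)} → Stepp p d x m → ∀ {σ Γ} (e : Fin n → Tm (σ ++ G) nm) {P A M} →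
            P ≈ trT e p → A ≈ dirT d (e x) → M ≈ trM e m → G ⊢ Γ ⊢ (σ , Onep P A M)
  Stepp-R (inp {x} {m}) e hP hA hM =
    defR _ c-in ((emp ▸ trM e m) ▸ e x) (atomc (≈sym hP ∷ ≈sym hA ∷ ≈sym hM ∷ [])) ⊤R
  Stepp-R (mat {x} {p} s) e {A = A} {M} hP hA hM =
    defR _ c-matchp ((((emp ▸ e x) ▸ trT e p) ▸ A) ▸ M) (atomc (≈sym hP ∷ ≈refl ∷ ≈refl ∷ [])) (Stepp-R s e ≈refl hA hM)
  Stepp-R (sumL {p} {q} s) e {A = A} {M} hP hA hM =
    defR _ c-sumLp ((((emp ▸ trT e p) ▸ trT e q) ▸ A) ▸ M) (atomc (≈sym hP ∷ ≈refl ∷ ≈refl ∷ [])) (Stepp-R s e ≈refl hA hM)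
  Stepp-R (sumR {p} {q} s) e {A = A} {M} hP hA hM =
    defR _ c-sumRp ((((emp ▸ trT e p) ▸ trT e q) ▸ A) ▸ M) (atomc (≈sym hP ∷ ≈refl ∷ ≈refl ∷ [])) (Stepp-R s e ≈refl hA hM)
  Stepp-R (parL {p} {q} {m = m} s) e {A = A} hP hA hM =
    defR _ c-parLp ((((emp ▸ trT e p) ▸ trT e q) ▸ A) ▸ trM e m)
      (atomc (≈sym hP ∷ ≈refl ∷ ≈trans (lamc (appc (appc ≈refl (wkβ _)) (≡⇒≈ (sym (trT-wk e q))))) (≈sym hM) ∷ []))
      (Stepp-R s e ≈refl hA ≈refl)
  Stepp-R (parR {p} {q} {m = m} s) e {A = A} hP hA hM =
    defR _ c-parRp ((((emp ▸ trT e p) ▸ trT e q) ▸ A) ▸ trM e m)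
      (atomc (≈sym hP ∷ ≈refl ∷ ≈trans (lamc (appc (appc ≈refl (≡⇒≈ (sym (trT-wk e p)))) (wkβ _))) (≈sym hM) ∷ []))
      (Stepp-R s e ≈refl hA ≈refl)
  Stepp-R (res {b} {d} {x} {m} s) e {A = A} hP hA hM =
    defR _ c-resp (((emp ▸ trM e b) ▸ A) ▸ lam (trM (upT e) m))
      (atomc (≈trans (appc ≈refl (≈sym η)) (≈sym hP) ∷ ≈refl ∷ ≈trans (swap-target m ≈refl) (≈sym hM) ∷ []))
      (∇R (Stepp-R s (upT e) (wkβ _) (≈trans (ren-≈ vs hA) (≡⇒≈ (ren-dirT d))) (wkβ _)))
    where
    ren-dirT : ∀ d {Γ} {M : Tm Γ nm} → ren (vs {s = nm}) (dirT d M) ≡ dirT d (ren vs M)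
    ren-dirT dn = refl
    ren-dirT up = refl
  Stepp-R (open′ {b} {x} {m} s) e hP hA hM =
    defR _ c-open (((emp ▸ trM e b) ▸ e x) ▸ trM e m)
      (atomc (≈trans (appc ≈refl (≈sym η)) (≈sym hP) ∷ ≈sym hA ∷ ≈sym hM ∷ []))
      (∇R (Step-R s (upT e) (wkβ _) ≈refl (wkβ _)))

-- Left analysis of hypotheses on transitions, for sequents and for the term model at once

-- `K ξ Γ` stands for: a fixed goal over `G`, instantiated by `ξ`, follows from the additional
-- hypotheses `Γ`. The fields are the left rules that the analysis applies; `semantic` and
-- `sequents` are the two instances.
record LeftFamily (G : Ctx) : Set₂ where
  field
    K      : ∀ {H} → Sub G H → List (Judg H) → Set₁
    K-ext  : ∀ {H} {ξ ξ' : Sub G H} {Γ} → (∀ {t} (x : Var G t) → ξ x ≡ ξ' x) → K ξ Γ → K ξ' Γ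
    K-weak : ∀ {H} {ξ : Sub G H} {J Γ} → K ξ Γ → K ξ (J ∷ Γ)
    K-∧    : ∀ {H} {ξ : Sub G H} {σ A B Γ} → K ξ ((σ , A) ∷ (σ , B) ∷ Γ) → K ξ ((σ , A ∧' B) ∷ Γ)
    K-∧ˢ   : ∀ {H} {ξ : Sub G H} {σ A B Γ} → K ξ ((σ , B) ∷ (σ , A) ∷ Γ) → K ξ ((σ , A ∧' B) ∷ Γ)
    K-∃    : ∀ {H} {ξ : Sub G H} {σ t B Γ} →
             K (wkS ⊙ ξ) ((σ , subF (raiseSub σ) B) ∷ map (subJ wkS) Γ) → K ξ ((σ , ∃' t B) ∷ Γ)
    K-∇    : ∀ {H} {ξ : Sub G H} {σ t B Γ} → K ξ ((t ∷ σ , B) ∷ Γ) → K ξ ((σ , ∇' t B) ∷ Γ)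
    K-defL : ∀ {H} {ξ : Sub G H} {σ q as Γ} →
             ((c : Clause) → Dpi c → (u : Unifier H σ q as c) →
                K (Unifier.ρ u ⊙ ξ) ((σ , subF (Unifier.θ u) (cbody c)) ∷ map (subJ (Unifier.ρ u)) Γ)) →
             K ξ ((σ , atom q as) ∷ Γ)

raise-wk : (σ : Ctx) (M : Tm (σ ++ G) t) → sub (raiseSub {t = s} σ) (ren vs M) ≡ act σ wkS M
raise-wk σ M = sub-ren (λ x → underR-S σ (λ _ → refl) x) M

-- In the clause for ν the action lies outside the ∇ and so cannot contain the local variable. This
-- is the side condition y ∉ n(α) of the rule RES.
wkAct-inv : {e : Fin n → Tm Γ nm} {A : Tm Γ ac} (α : Act′ (suc n)) → ren vs A ≈ trA (upT e) α →
            ∃ λ δ → α ≡ wkAct δ × A ≈ trA e δ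
wkAct-inv τ′ p = τ′ , refl , wk-τ p
wkAct-inv {e = e} (out′ (suc x) (suc y)) p = out′ x y , refl , wk-cancel (e x) p
wkAct-inv {A = A} (out′ zero y) p with var-injective (proj₁ (label-injective ↑C (wk-invariant {A = A} p)))
... | ()
wkAct-inv {A = A} (out′ (suc x) zero) p with var-injective (proj₂ (label-injective ↑C (wk-invariant {A = A} p)))
... | ()

wkDir-inv : {e : Fin n → Tm Γ nm} {A : Tm Γ (nm ⇒ ac)} (d : Dir) (x : Fin (suc n)) → ren vs A ≈ dirT d (upT e x) →
            ∃ λ y → x ≡ suc y × A ≈ dirT d (e y)
wkDir-inv {e = e} dn (suc x) p = x , refl , wk-cancel (e x) p
wkDir-inv {e = e} up (suc x) p = x , refl , wk-cancel (e x) p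
wkDir-inv {A = A} d zero p
  with var-injective (proj₂ (dirT-injective d d (subst₂ _≈_ (sub-dirT fst₂ d) (sub-dirT snd₂ d) (wk-invariant {A = A} p))))
... | ()

-- The scoping of the opening clause again: the object is the local variable and the subject cannot
-- be, which is the condition y ≠ x of the rule OPEN.
open-inv : {e : Fin n → Tm Γ nm} {X : Tm Γ nm} (α : Act′ (suc n)) → ↑T2 (ren vs X) (var vz) ≈ trA (upT e) α →
           ∃ λ x → α ≡ out′ (suc x) zero × X ≈ e x
open-inv τ′ p with head-≈ p
... | ()
open-inv {e = e} (out′ (suc x) zero) p = x , refl , wk-cancel (e x) (proj₁ (label-injective ↑C p))
open-inv (out′ zero y) p = ⊥-elim (wk≉vz (proj₁ (label-injective ↑C p)))
open-inv (out′ (suc x) (suc y)) p = ⊥-elim (wk≉vz (≈sym (proj₂ (label-injective ↑C p))))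

shape : Pr n → ℕ
shape nil′         = tag zeroC
shape (out′ _ _ _) = tag outC
shape (inp′ _ _)   = tag inC
shape (tau′ _)     = tag τC
shape (res′ _)     = tag nuC
shape (mat′ _ _ _) = tag matchC
shape (par′ _ _)   = tag parC
shape (sum′ _ _)   = tag plusC

head-shape : (e : Fin n → Tm Γ nm) (p : Pr n) → headNf (nf (trT e p)) ≡ shape p
head-shape e nil′         = refl
head-shape e (out′ _ _ _) = refl
head-shape e (inp′ _ _)   = refl
head-shape e (tau′ _)     = refl
head-shape e (res′ _)     = refl
head-shape e (mat′ _ _ _) = refl
head-shape e (par′ _ _)   = refl
head-shape e (sum′ _ _)   = refl

data ShapeOf {n : ℕ} : ℕ → Pr n → Set where
  isTau : ∀ p → ShapeOf 5 (tau′ p)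
  isOut : ∀ x y p → ShapeOf 6 (out′ x y p)
  isInp : ∀ x p → ShapeOf 7 (inp′ x p)
  isSum : ∀ p q → ShapeOf 8 (sum′ p q)
  isPar : ∀ p q → ShapeOf 9 (par′ p q)
  isMat : ∀ x y p → ShapeOf 10 (mat′ x y p)
  isRes : ∀ p → ShapeOf 11 (res′ p)
  isNil : ShapeOf 4 nil′

shapeOf : (p : Pr n) → ShapeOf (shape p) p
shapeOf nil′         = isNil
shapeOf (out′ x y p) = isOut x y p
shapeOf (inp′ x p)   = isInp x p
shapeOf (tau′ p)     = isTau p
shapeOf (res′ p)     = isRes p
shapeOf (mat′ x y p) = isMat x y p
shapeOf (par′ p q)   = isPar p q
shapeOf (sum′ p q)   = isSum p q

-- When `M` is the process in a clause head, `headNf (nf M)` computes to a literal, so a match on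
-- the view leaves just the constructor that this clause is about.
view : (e : Fin n → Tm Γ nm) (p : Pr n) {M : Tm Γ pr} → trT e p ≈ M → ShapeOf (headNf (nf M)) p
view e p q = subst (λ k → ShapeOf k p) (trans (sym (head-shape e p)) (head-≈ q)) (shapeOf p)

νpar : Tm Γ (nm ⇒ pr) → Tm Γ (nm ⇒ pr) → Tm Γ pr
νpar M N = νT (lam (app (ren vs M) (var vz) ∥ app (ren vs N) (var vz)))

sub-νpar : (θ : Sub Γ Δ) (M N : Tm Γ (nm ⇒ pr)) → sub θ (νpar M N) ≡ νpar (sub θ M) (sub θ N)
sub-νpar θ M N = cong₂ (λ M N → νT (lam (app M (var vz) ∥ app N (var vz)))) (sub-wk θ M) (sub-wk θ N)

νpar-≈ : {e : Fin n → Tm Γ nm} {M N : Tm Γ (nm ⇒ pr)} (m m' : Pr (suc n)) → M ≈ trM e m → N ≈ trM e m' →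
         νpar M N ≈ trT e (res′ (par′ m m'))
νpar-≈ m m' p q = appc ≈refl (lamc (appc (appc ≈refl (apply-wk p)) (apply-wk q)))

shifted : (σ : Ctx) {e : Fin n → Tm (σ ++ G) nm} (p : Pr n) (ξ : Sub G H) {P : Tm (σ ++ G) pr} → P ≈ trT e p →
          act σ ξ P ≈ trT (λ i → act σ ξ (e i)) p
shifted σ p ξ q = ≈trans (sub-≈ _ q) (≡⇒≈ (sub-trT (λ _ → refl) p))

raised : (σ : Ctx) {e : Fin n → Tm (σ ++ G) nm} (p : Pr n) {P : Tm (σ ++ G) pr} → P ≈ trT e p →
         sub (raiseSub {t = s} σ) (ren vs P) ≈ trT (λ i → act σ wkS (e i)) p
raised σ p {P} q = ≈trans (≡⇒≈ (raise-wk σ P)) (shifted σ p wkS q)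

beside : (σ : Ctx) (ξ : Sub G H) {e : Fin n → Tm (σ ++ G) nm} (p : Pr n) {P : Tm (σ ++ G) pr} → P ≈ trT e p →
         sub (liftS (underS σ ξ)) (ren vs P) ≈ trT (upT (λ i → act σ ξ (e i))) (wkPr p)
beside σ ξ p {P} q = ≈trans (≡⇒≈ (sub-wk (underS σ ξ) P))
  (≈trans (ren-≈ vs (shifted σ p ξ q)) (≡⇒≈ (sym (trT-wk _ p))))

map-subJ : {θ : Sub Δ Θ} {ξ : Sub Γ Δ} → (Js : List (Judg Γ)) → map (subJ (θ ⊙ ξ)) Js ≡ map (subJ θ) (map (subJ ξ) Js)
map-subJ []       = refl
map-subJ (J ∷ Js) = cong₂ _∷_ (sym (subJ-sub (λ _ → refl) J)) (map-subJ Js)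

map-subJ-id : (Js : List (Judg Γ)) → map (subJ var) Js ≡ Js
map-subJ-id []       = refl
map-subJ-id (J ∷ Js) = cong₂ _∷_ (subJ-id (λ _ → refl) J) (map-subJ-id Js)

∘-eq : (σ : Ctx) {ζ : Sub Γ Δ} (ξ : Sub Δ Θ) (M : Tm (σ ++ Γ) t) →
       act σ (ξ ⊙ ζ) M ≡ act σ ξ (act σ ζ M)
∘-eq σ ξ M = sym (sub-sub (underS-∘ σ (λ _ → refl)) M)

id-eq : (σ : Ctx) (M : Tm (σ ++ Γ) t) → act σ var M ≡ M
id-eq σ M = sub-id (underS-id σ (λ _ → refl)) M

upT-apart : {σ : Ctx} (e : Fin n → Tm (σ ++ G) nm) (ξ : Sub G H) {X : Set₁} →
            (∀ {i j} → i ≢ j → act σ ξ (e i) ≈ act σ ξ (e j) → X) →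
            ∀ {i j} → i ≢ j → act (nm ∷ σ) ξ (upT e i) ≈ act (nm ∷ σ) ξ (upT e j) → X
upT-apart e ξ h {zero} {zero} i≢j p = ⊥-elim (i≢j refl)
upT-apart {σ = σ} e ξ h {zero} {suc j} i≢j p = ⊥-elim (wk≉vz (≈sym (≈trans p (≡⇒≈ (sub-wk (underS σ ξ) (e j))))))
upT-apart {σ = σ} e ξ h {suc i} {zero} i≢j p = ⊥-elim (wk≉vz (≈trans (≡⇒≈ (sym (sub-wk (underS σ ξ) (e i)))) p))
upT-apart {σ = σ} e ξ h {suc i} {suc j} i≢j p = h (λ { refl → i≢j refl })
  (wk-cancel (act σ ξ (e i)) (≈trans (≡⇒≈ (sym (sub-wk (underS σ ξ) (e i))))
    (≈trans p (≡⇒≈ (sub-wk (underS σ ξ) (e j))))))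

-- The effect on a term of entering the scope of an ∃ and then instantiating twice; the second form
-- is the one in which the terms of the body of the ∃ appear.
along along′ : (σ : Ctx) {H H' : Ctx} → Sub (raiseTy σ nm ∷ G) H → Sub H H' → Tm (σ ++ G) t → Tm (σ ++ H') t
along  σ ξ ξ' M = act σ ξ' (act σ ξ (act σ wkS M))
along′ σ ξ ξ' M = act σ ξ' (act σ ξ (sub (raiseSub {t = nm} σ) (ren vs M)))

along-≈ : (σ : Ctx) {H H' : Ctx} (ξ : Sub (raiseTy σ nm ∷ G) H) (ξ' : Sub H H') (M : Tm (σ ++ G) t) → along σ ξ ξ' M ≈ along′ σ ξ ξ' M
along-≈ σ ξ ξ' M = ≡⇒≈ (cong (λ L → act σ ξ' (act σ ξ L)) (sym (raise-wk σ M)))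

module Left {G₁ : Ctx} (F : LeftFamily G₁) where
  open LeftFamily F

  -- K must hold in every instance that identifies two names, so that only transitions of the
  -- process with distinct names remain to be considered.
  record Apart {σ : Ctx} (ζ : Sub G₁ G) (e : Fin n → Tm (σ ++ G) nm) : Set₁ where
    constructor apart
    field
      refute : ∀ {H} (ξ : Sub G H) {i j : Fin n} → i ≢ j →
               act σ ξ (e i) ≈ act σ ξ (e j) → ∀ Γ → K (ξ ⊙ ζ) Γ

  -- The analysis is in continuation-passing form. The two hypotheses of a communication are
  -- analysed one after the other and each definition step may instantiate eigenvariables again, so
  -- the continuation has to accept every later instance `ξ`.
  record Cont1 {σ : Ctx} (ζ : Sub G₁ G) (e : Fin n → Tm (σ ++ G) nm) (p : Pr n)
               (A : Tm (σ ++ G) ac) (T : Tm (σ ++ G) pr) (Γ : List (Judg G)) : Set₁ where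
    constructor cont1
    field
      run1 : ∀ {H} (ξ : Sub G H) {α p'} → Step p α p' →
             act σ ξ A ≈ trA (λ i → act σ ξ (e i)) α →
             act σ ξ T ≈ trT (λ i → act σ ξ (e i)) p' → K (ξ ⊙ ζ) (map (subJ ξ) Γ)

  record Contp {σ : Ctx} (ζ : Sub G₁ G) (e : Fin n → Tm (σ ++ G) nm) (p : Pr n)
               (A : Tm (σ ++ G) (nm ⇒ ac)) (M : Tm (σ ++ G) (nm ⇒ pr)) (Γ : List (Judg G)) : Set₁ where
    constructor contp
    field
      runp : ∀ {H} (ξ : Sub G H) {d x m} → Stepp p d x m →
             act σ ξ A ≈ dirT d (act σ ξ (e x)) →
             act σ ξ M ≈ trM (λ i → act σ ξ (e i)) m → K (ξ ⊙ ζ) (map (subJ ξ) Γ)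

  open Apart
  open Cont1
  open Contp

  assoc : (ξ' : Sub Δ Θ) (ξ : Sub Γ Δ) (ζ : Sub G₁ Γ) (x : Var G₁ t) → ((ξ' ⊙ ξ) ⊙ ζ) x ≡ (ξ' ⊙ (ξ ⊙ ζ)) x
  assoc ξ' ξ ζ x = sym (sub-sub (λ _ → refl) (ζ x))

  apart-shift : ∀ {σ} {ζ : Sub G₁ G} {e : Fin n → Tm (σ ++ G) nm} → Apart {σ = σ} ζ e → (χ : Sub G H) →
                Apart {σ = σ} (χ ⊙ ζ) (λ i → act σ χ (e i))
  apart-shift {σ = σ} {ζ} {e} ap χ = apart λ ξ {i} {j} i≢j p Γ → K-ext (assoc ξ χ ζ) (refute ap (ξ ⊙ χ) i≢j
    (≈trans (≡⇒≈ (∘-eq σ ξ (e i))) (≈trans p (≡⇒≈ (sym (∘-eq σ ξ (e j)))))) Γ)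

  apart-up : ∀ {σ} {ζ : Sub G₁ G} {e : Fin n → Tm (σ ++ G) nm} → Apart {σ = σ} ζ e → Apart {σ = nm ∷ σ} ζ (upT e)
  apart-up {ζ = ζ} {e} ap = apart λ ξ i≢j p Γ → upT-apart e ξ (λ i≢j q → refute ap ξ i≢j q Γ) i≢j p

  cont1-shift : ∀ {σ} {ζ : Sub G₁ G} {e : Fin n → Tm (σ ++ G) nm} {p A T Γ} → Cont1 {σ = σ} ζ e p A T Γ → (χ : Sub G H) →
    Cont1 {σ = σ} (χ ⊙ ζ) (λ i → act σ χ (e i)) p (act σ χ A) (act σ χ T) (map (subJ χ) Γ)
  cont1-shift {σ = σ} {ζ} {e} {A = A} {T} {Γ} k χ = cont1 λ ξ {α} {p'} s a t → K-ext (assoc ξ χ ζ) (subst (K _) (map-subJ Γ)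
    (run1 k (ξ ⊙ χ) s
      (≈trans (≡⇒≈ (∘-eq σ ξ A)) (≈trans a (trA-≈ (λ i → ≡⇒≈ (sym (∘-eq σ ξ (e i)))) α)))
      (≈trans (≡⇒≈ (∘-eq σ ξ T)) (≈trans t (trT-≈ (λ i → ≡⇒≈ (sym (∘-eq σ ξ (e i)))) p')))))

  contp-shift : ∀ {σ} {ζ : Sub G₁ G} {e : Fin n → Tm (σ ++ G) nm} {p A M Γ} → Contp {σ = σ} ζ e p A M Γ → (χ : Sub G H) →
    Contp {σ = σ} (χ ⊙ ζ) (λ i → act σ χ (e i)) p (act σ χ A) (act σ χ M) (map (subJ χ) Γ)
  contp-shift {σ = σ} {ζ} {e} {A = A} {M} {Γ} k χ = contp λ ξ {d} {x} {m} s a t → K-ext (assoc ξ χ ζ) (subst (K _) (map-subJ Γ)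
    (runp k (ξ ⊙ χ) s
      (≈trans (≡⇒≈ (∘-eq σ ξ A)) (≈trans a (dirT-≈ d (≡⇒≈ (sym (∘-eq σ ξ (e x)))))))
      (≈trans (≡⇒≈ (∘-eq σ ξ M)) (≈trans t (trM-≈ (λ i → ≡⇒≈ (sym (∘-eq σ ξ (e i)))) m)))))

  cont1-here : ∀ {σ} {ζ : Sub G₁ G} {e : Fin n → Tm (σ ++ G) nm} {p A T Γ} → Cont1 {σ = σ} ζ e p A T Γ →
    ∀ {α p'} → Step p α p' → A ≈ trA e α → T ≈ trT e p' → K ζ Γ
  cont1-here {σ = σ} {ζ} {e} {A = A} {T} {Γ} k {α} {p'} s a t =
    K-ext (λ x → sub-id (λ _ → refl) (ζ x)) (subst (K _) (map-subJ-id Γ) (run1 k var s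
      (≈trans (≡⇒≈ (id-eq σ A)) (≈trans a (trA-≈ (λ i → ≡⇒≈ (sym (id-eq σ (e i)))) α)))
      (≈trans (≡⇒≈ (id-eq σ T)) (≈trans t (trT-≈ (λ i → ≡⇒≈ (sym (id-eq σ (e i)))) p')))))

  contp-here : ∀ {σ} {ζ : Sub G₁ G} {e : Fin n → Tm (σ ++ G) nm} {p A M Γ} → Contp {σ = σ} ζ e p A M Γ →
    ∀ {d x m} → Stepp p d x m → A ≈ dirT d (e x) → M ≈ trM e m → K ζ Γ
  contp-here {σ = σ} {ζ} {e} {A = A} {M} {Γ} k {d} {x} {m} s a t =
    K-ext (λ x → sub-id (λ _ → refl) (ζ x)) (subst (K _) (map-subJ-id Γ) (runp k var s
      (≈trans (≡⇒≈ (id-eq σ A)) (≈trans a (dirT-≈ d (≡⇒≈ (sym (id-eq σ (e x)))))))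
      (≈trans (≡⇒≈ (id-eq σ M)) (≈trans t (trM-≈ (λ i → ≡⇒≈ (sym (id-eq σ (e i)))) m)))))

  apart-here : ∀ {σ} {ζ : Sub G₁ G} {e : Fin n → Tm (σ ++ G) nm} → Apart {σ = σ} ζ e → ∀ {i j} → i ≢ j → e i ≈ e j → ∀ Γ → K ζ Γ
  apart-here {σ = σ} {ζ} {e} ap {i} {j} i≢j p Γ = K-ext (λ x → sub-id (λ _ → refl) (ζ x))
    (refute ap var i≢j (≈trans (≡⇒≈ (id-eq σ (e i))) (≈trans p (≡⇒≈ (sym (id-eq σ (e j)))))) Γ)

  mutual
    -- By recursion on `p`: the bodies of the clauses speak only of transitions of immediate
    -- subprocesses.
    one-left : (p : Pr n) (ζ : Sub G₁ G) {σ : Ctx} {e : Fin n → Tm (σ ++ G) nm} {P : Tm (σ ++ G) pr} {A : Tm (σ ++ G) ac}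
               {T : Tm (σ ++ G) pr} {Γ : List (Judg G)} →
               Apart {σ = σ} ζ e → P ≈ trT e p → Cont1 {σ = σ} ζ e p A T Γ → K ζ ((σ , One P A T) ∷ Γ)
    one-left p ζ {σ} {e} ap hP k = K-defL λ c d u →
      one-clause p (Unifier.ρ u ⊙ ζ) {σ} (apart-shift ap (Unifier.ρ u)) d (Unifier.θ u)
        (atomF-≈ (≈sym (shifted σ p (Unifier.ρ u) hP) ∷ ≈refl ∷ ≈refl ∷ []) (Unifier.unifies u)) (cont1-shift k (Unifier.ρ u))

    onep-left : (p : Pr n) (ζ : Sub G₁ G) {σ : Ctx} {e : Fin n → Tm (σ ++ G) nm} {P : Tm (σ ++ G) pr} {A : Tm (σ ++ G) (nm ⇒ ac)}
                {M : Tm (σ ++ G) (nm ⇒ pr)} {Γ : List (Judg G)} →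
                Apart {σ = σ} ζ e → P ≈ trT e p → Contp {σ = σ} ζ e p A M Γ → K ζ ((σ , Onep P A M) ∷ Γ)
    onep-left p ζ {σ} {e} ap hP k = K-defL λ c d u →
      onep-clause p (Unifier.ρ u ⊙ ζ) {σ} (apart-shift ap (Unifier.ρ u)) d (Unifier.θ u)
        (atomF-≈ (≈sym (shifted σ p (Unifier.ρ u) hP) ∷ ≈refl ∷ ≈refl ∷ []) (Unifier.unifies u)) (contp-shift k (Unifier.ρ u))

    one-clause : (p : Pr n) (ζ : Sub G₁ G) {σ : Ctx} {e : Fin n → Tm (σ ++ G) nm} {A : Tm (σ ++ G) ac}
               {T : Tm (σ ++ G) pr} {Γ : List (Judg G)} → Apart {σ = σ} ζ e →
               {c : Clause} → Dpi c → (θ : Sub (cvars c) (σ ++ G)) →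
               atom one (trT e p ∷ A ∷ T ∷ []) ≈F atom (cpred c) (All.map (sub θ) (chead c)) →
               Cont1 {σ = σ} ζ e p A T Γ → K ζ ((σ , subF θ (cbody c)) ∷ Γ)
    one-clause p ζ {e = e} ap c-tau θ (atomc (q ∷ ha ∷ ht ∷ [])) k with view e p q
    ... | isTau p₀ = K-weak (cont1-here k tau ha (≈trans ht (≈sym (con1-injective τC q))))
    one-clause p ζ {e = e} ap c-out θ (atomc (q ∷ ha ∷ ht ∷ [])) k with view e p q
    ... | isOut x y p₀ with con3-injective outC q
    ... | qx , qy , qp = K-weak (cont1-here k out (≈trans ha (appc (appc ≈refl (≈sym qx)) (≈sym qy))) (≈trans ht (≈sym qp)))
    one-clause p ζ {e = e} ap c-match θ (atomc (q ∷ ha ∷ ht ∷ [])) k with view e p q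
    ... | isMat x y p₀ with con3-injective matchC q
    ... | qx , qy , qp with x Fin.≟ y
    -- The unifier has merged the names of two different indices; `Apart` discharges such an
    -- instance.
    ... | no x≢y = apart-here ap x≢y (≈trans qx (≈sym qy)) _
    ... | yes refl = one-left p₀ ζ ap (≈sym qp) (cont1 λ ξ s a t → run1 k ξ (mat s) (≈trans (sub-≈ _ ha) a) (≈trans (sub-≈ _ ht) t))
    one-clause p ζ {e = e} ap c-sumL θ (atomc (q ∷ ha ∷ ht ∷ [])) k with view e p q
    ... | isSum p₁ p₂ = one-left p₁ ζ ap (≈sym (proj₁ (con2-injective plusC q)))
      (cont1 λ ξ s a t → run1 k ξ (sumL s) (≈trans (sub-≈ _ ha) a) (≈trans (sub-≈ _ ht) t))
    one-clause p ζ {e = e} ap c-sumR θ (atomc (q ∷ ha ∷ ht ∷ [])) k with view e p q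
    ... | isSum p₁ p₂ = one-left p₂ ζ ap (≈sym (proj₂ (con2-injective plusC q)))
      (cont1 λ ξ s a t → run1 k ξ (sumR s) (≈trans (sub-≈ _ ha) a) (≈trans (sub-≈ _ ht) t))
    one-clause p ζ {e = e} ap c-parL θ (atomc (q ∷ ha ∷ ht ∷ [])) k with view e p q
    ... | isPar p₁ p₂ with con2-injective parC q
    ... | q₁ , q₂ = one-left p₁ ζ ap (≈sym q₁) (cont1 λ ξ s a t → run1 k ξ (parL s) (≈trans (sub-≈ _ ha) a)
      (≈trans (sub-≈ _ ht) (appc (appc ≈refl t) (≈trans (sub-≈ _ (≈sym q₂)) (≡⇒≈ (sub-trT (λ _ → refl) p₂))))))
    one-clause p ζ {e = e} ap c-parR θ (atomc (q ∷ ha ∷ ht ∷ [])) k with view e p q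
    ... | isPar p₁ p₂ with con2-injective parC q
    ... | q₁ , q₂ = one-left p₂ ζ ap (≈sym q₂) (cont1 λ ξ s a t → run1 k ξ (parR s) (≈trans (sub-≈ _ ha) a)
      (≈trans (sub-≈ _ ht) (appc (appc ≈refl (≈trans (sub-≈ _ (≈sym q₁)) (≡⇒≈ (sub-trT (λ _ → refl) p₁)))) t)))
    one-clause p ζ {σ} {e} {T = T} {Γ} ap c-res θ (atomc (q ∷ ha ∷ ht ∷ [])) k with view e p q
    ... | isRes b = K-∇ (one-left b ζ (apart-up ap) (≈sym (lam-inj (con1-injective nuC q))) (cont1 λ ξ {α} {p'} s a t →
      res-cont ξ s (wkAct-inv {e = λ i → act σ ξ (e i)} {A = act σ ξ (θ (vs vz))} α
          (≈trans (≡⇒≈ (sym (sub-wk (underS σ ξ) (θ (vs vz)))))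
          (≈trans a (trA-≈ (λ i → ≡⇒≈ (sub-upT (underS σ ξ) e i)) α))))
        (≈trans (sub-≈ _ ht) (appc ≈refl (lamc (≈trans t (trT-≈ (λ i → ≡⇒≈ (sub-upT (underS σ ξ) e i)) p')))))))
      where
      res-cont : ∀ {H} (ξ : Sub _ H) {α p'} → Step b α p' →
                 (∃ λ δ → α ≡ wkAct δ × act σ ξ (θ (vs vz)) ≈ trA (λ i → act σ ξ (e i)) δ) →
                 act σ ξ T ≈ trT (λ i → act σ ξ (e i)) (res′ p') → K (ξ ⊙ ζ) (map (subJ ξ) Γ)
      res-cont ξ s (δ , refl , a) t = run1 k ξ (res s) (≈trans (sub-≈ _ ha) a) t
    one-clause p ζ {σ} {e} ap c-closeL θ (atomc (q ∷ ha ∷ ht ∷ [])) k with view e p q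
    ... | isPar p₁ p₂ with con2-injective parC q
    ... | q₁ , q₂ = close-left p₁ p₂ dn ζ ap (≈sym q₁) (≈sym q₂) ha ht k
    one-clause p ζ {σ} {e} ap c-closeR θ (atomc (q ∷ ha ∷ ht ∷ [])) k with view e p q
    ... | isPar p₁ p₂ with con2-injective parC q
    ... | q₁ , q₂ = close-left p₁ p₂ up ζ ap (≈sym q₁) (≈sym q₂) ha ht k
    one-clause p ζ {σ} {e} ap c-comL θ (atomc (q ∷ ha ∷ ht ∷ [])) k with view e p q
    ... | isPar p₁ p₂ with con2-injective parC q
    ... | q₁ , q₂ = K-∃ (K-∧ (com-left p₁ p₂ ζ (θ (vs (vs vz))) (θ (vs vz)) (θ vz) ap (≈sym q₁) (≈sym q₂) λ ξ ξ' s r hm hq →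
      run1 (cont1-shift (cont1-shift k wkS) ξ) ξ' (comL s r) (sub-≈ _ (sub-≈ _ (sub-≈ _ ha)))
        (≈trans (sub-≈ _ (sub-≈ _ (sub-≈ _ ht))) (appc (appc ≈refl hm) hq))))
    one-clause p ζ {σ} {e} ap c-comR θ (atomc (q ∷ ha ∷ ht ∷ [])) k with view e p q
    ... | isPar p₁ p₂ with con2-injective parC q
    ... | q₁ , q₂ = K-∃ (K-∧ˢ (com-left p₂ p₁ ζ (θ (vs vz)) (θ vz) (θ (vs (vs vz))) ap (≈sym q₂) (≈sym q₁) λ ξ ξ' s r hm hq →
      run1 (cont1-shift (cont1-shift k wkS) ξ) ξ' (comR r s) (sub-≈ _ (sub-≈ _ (sub-≈ _ ha)))
        (≈trans (sub-≈ _ (sub-≈ _ (sub-≈ _ ht))) (appc (appc ≈refl hq) hm))))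

    close-left : (p₁ p₂ : Pr n) (d : Dir) (ζ : Sub G₁ G) {σ : Ctx} {e : Fin n → Tm (σ ++ G) nm} {P Q : Tm (σ ++ G) pr}
                 {A : Tm (σ ++ G) ac} {T : Tm (σ ++ G) pr} {M N : Tm (σ ++ G) (nm ⇒ pr)} {Γ : List (Judg G)} → Apart {σ = σ} ζ e →
                 P ≈ trT e p₁ → Q ≈ trT e p₂ → A ≈ τT → T ≈ νpar M N →
                 Cont1 {σ = σ} ζ e (par′ p₁ p₂) A T Γ →
                 K ζ ((σ , ∃' nm (Onep (ren vs P) (dirT d v0) (ren vs M) ∧' Onep (ren vs Q) (dirT (opp d) v0) (ren vs N))) ∷ Γ)
    close-left p₁ p₂ d ζ {σ} {e} {P} {Q} {A} {T} {M} {N} {Γ} ap hP hQ hA hT k =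
      K-∃ (K-∧ (onep-left p₁ (wkS ⊙ ζ) (apart-shift ap wkS) (raised σ p₁ hP) (contp λ ξ s a t →
        onep-left p₂ (ξ ⊙ (wkS ⊙ ζ)) (apart-shift (apart-shift ap wkS) ξ) (shifted σ p₂ ξ (raised σ p₂ hQ)) (contp λ ξ' r a' t' →
          final ξ ξ' s r (dirT-injective d _ (≈trans (≡⇒≈ (sym (dir₂ d ξ))) a)) (dirT-injective (opp d) _ (≈trans (≡⇒≈ (sym (dir₃ (opp d) ξ ξ'))) a'))
            (≈trans (sub-≈ _ t) (≡⇒≈ (sub-trM (underS σ ξ') _ _))) t'))))
      where
      X = raiseSub {t = nm} σ vz
      dir₂ : ∀ d {H} (ξ : Sub _ H) → act σ ξ (sub (raiseSub {t = nm} σ) (dirT d v0)) ≡ dirT d (act σ ξ X)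
      dir₂ d ξ = trans (cong (act σ ξ) (sub-dirT (raiseSub σ) d)) (sub-dirT (underS σ ξ) d)
      dir₃ : ∀ d {H H'} (ξ : Sub _ H) (ξ' : Sub H H') →
             act σ ξ' (act σ ξ (sub (raiseSub {t = nm} σ) (dirT d v0))) ≡ dirT d (act σ ξ' (act σ ξ X))
      dir₃ d ξ ξ' = trans (cong (act σ ξ') (dir₂ d ξ)) (sub-dirT (underS σ ξ') d)
      final : ∀ {H H'} (ξ : Sub _ H) (ξ' : Sub H H') {d₁ d₂ x x' m m'} → Stepp p₁ d₁ x m → Stepp p₂ d₂ x' m' →
              d ≡ d₁ × act σ ξ X ≈ act σ ξ (act σ wkS (e x)) →
              opp d ≡ d₂ × act σ ξ' (act σ ξ X) ≈ along σ ξ ξ' (e x') →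
              along′ σ ξ ξ' M ≈ trM (λ i → along σ ξ ξ' (e i)) m →
              along′ σ ξ ξ' N ≈ trM (λ i → along σ ξ ξ' (e i)) m' →
              K (ξ' ⊙ (ξ ⊙ (wkS ⊙ ζ))) (map (subJ ξ') (map (subJ ξ) (map (subJ wkS) Γ)))
      final ξ ξ' {x = x} {x'} s r (refl , ax) (refl , ax') hM hN with x Fin.≟ x'
      -- Both channels equal the witness of the existential quantifier, so different indices would
      -- have been merged.
      ... | no x≢x' = refute (apart-shift (apart-shift ap wkS) ξ) ξ' x≢x' (≈trans (sub-≈ _ (≈sym ax)) ax') _
      ... | yes refl = run1 (cont1-shift (cont1-shift k wkS) ξ) ξ' (close d s r)
        (sub-≈ _ (sub-≈ _ (sub-≈ _ hA)))
        (≈trans (sub-≈ _ (sub-≈ _ (sub-≈ _ hT)))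
          (≈trans (≡⇒≈ (trans (cong (act σ ξ') (trans (cong (act σ ξ) (sub-νpar (underS σ wkS) M N)) (sub-νpar (underS σ ξ) (act σ wkS M) (act σ wkS N)))) (sub-νpar (underS σ ξ') (act σ ξ (act σ wkS M)) (act σ ξ (act σ wkS N)))))
            (νpar-≈ _ _ (≈trans (along-≈ σ ξ ξ' M) hM)
                        (≈trans (along-≈ σ ξ ξ' N) hN))))

    -- Serves both clauses for free communication: the inputting partner is always analysed first,
    -- and `K-∧ˢ` exchanges the conjuncts when it is the right-hand component.
    com-left : (pᵢ pₒ : Pr n) (ζ : Sub G₁ G) {σ : Ctx} {e : Fin n → Tm (σ ++ G) nm} {P Q : Tm (σ ++ G) pr}
               (M : Tm (σ ++ G) (nm ⇒ pr)) (Y : Tm (σ ++ G) nm) (Q' : Tm (σ ++ G) pr) {Γ : List (Judg G)} →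
               Apart {σ = σ} ζ e → P ≈ trT e pᵢ → Q ≈ trT e pₒ →
               (∀ {H H'} (ξ : Sub (raiseTy σ nm ∷ G) H) (ξ' : Sub H H') {x y m q'} → Stepp pᵢ dn x m → Step pₒ (out′ x y) q' →
                  app (along σ ξ ξ' M) (along σ ξ ξ' Y) ≈ trT (λ i → along σ ξ ξ' (e i)) (inst y m) →
                  along σ ξ ξ' Q' ≈ trT (λ i → along σ ξ ξ' (e i)) q' →
                  K (ξ' ⊙ (ξ ⊙ (wkS ⊙ ζ))) (map (subJ ξ') (map (subJ ξ) (map (subJ wkS) Γ)))) →
               K (wkS ⊙ ζ) ((σ , subF (raiseSub {t = nm} σ) (Onep (ren vs P) (↓T v0) (ren vs M)))
                            ∷ (σ , subF (raiseSub {t = nm} σ) (One (ren vs Q) (↑T2 v0 (ren vs Y)) (ren vs Q'))) ∷ map (subJ wkS) Γ)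
    com-left pᵢ pₒ ζ {σ} {e} M Y Q' {Γ} ap hP hQ k =
      onep-left pᵢ (wkS ⊙ ζ) (apart-shift ap wkS) (raised σ pᵢ hP) (contp λ ξ s a t →
        one-left pₒ (ξ ⊙ (wkS ⊙ ζ)) (apart-shift (apart-shift ap wkS) ξ) (shifted σ pₒ ξ (raised σ pₒ hQ)) (cont1 λ ξ' r a' t' →
          final ξ ξ' s r (dirT-injective dn _ a) a' (≈trans (sub-≈ _ t) (≡⇒≈ (sub-trM (underS σ ξ') _ _))) t'))
      where
      X = raiseSub {t = nm} σ vz
      final : ∀ {H H'} (ξ : Sub _ H) (ξ' : Sub H H') {d x m α q'} → Stepp pᵢ d x m → Step pₒ α q' →
              dn ≡ d × act σ ξ X ≈ act σ ξ (act σ wkS (e x)) →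
              ↑T2 (act σ ξ' (act σ ξ X)) (along′ σ ξ ξ' Y) ≈ trA (λ i → along σ ξ ξ' (e i)) α →
              along′ σ ξ ξ' M ≈ trM (λ i → along σ ξ ξ' (e i)) m → along′ σ ξ ξ' Q' ≈ trT (λ i → along σ ξ ξ' (e i)) q' →
              K (ξ' ⊙ (ξ ⊙ (wkS ⊙ ζ))) (map (subJ ξ') (map (subJ ξ) (map (subJ wkS) Γ)))
      final ξ ξ' {α = τ′} s r ax ay hM hQ' with head-≈ ay
      ... | ()
      final ξ ξ' {x = x} {m} {out′ x' y} s r (refl , ax) ay hM hQ' with x Fin.≟ x'
      ... | no x≢x' = refute (apart-shift (apart-shift ap wkS) ξ) ξ' x≢x' (≈trans (sub-≈ _ (≈sym ax)) (proj₁ (label-injective ↑C ay))) _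
      ... | yes refl = k ξ ξ' s r
        (≈trans (appc (≈trans (along-≈ σ ξ ξ' M) hM) (≈trans (along-≈ σ ξ ξ' Y) (proj₂ (label-injective ↑C ay)))) (inst-β _ y m))
        (≈trans (along-≈ σ ξ ξ' Q') hQ')

    onep-clause : (p : Pr n) (ζ : Sub G₁ G) {σ : Ctx} {e : Fin n → Tm (σ ++ G) nm} {A : Tm (σ ++ G) (nm ⇒ ac)}
                {M : Tm (σ ++ G) (nm ⇒ pr)} {Γ : List (Judg G)} → Apart {σ = σ} ζ e →
                {c : Clause} → Dpi c → (θ : Sub (cvars c) (σ ++ G)) →
                atom onep (trT e p ∷ A ∷ M ∷ []) ≈F atom (cpred c) (All.map (sub θ) (chead c)) →
                Contp {σ = σ} ζ e p A M Γ → K ζ ((σ , subF θ (cbody c)) ∷ Γ)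
    onep-clause p ζ {e = e} ap c-in θ (atomc (q ∷ ha ∷ hm ∷ [])) k with view e p q
    ... | isInp x b with con2-injective inC q
    ... | qx , qb = K-weak (contp-here k inp (≈trans ha (appc ≈refl (≈sym qx))) (≈trans hm (≈sym qb)))
    onep-clause p ζ {e = e} ap c-matchp θ (atomc (q ∷ ha ∷ hm ∷ [])) k with view e p q
    ... | isMat x y p₀ with con3-injective matchC q
    ... | qx , qy , qp with x Fin.≟ y
    ... | no x≢y = apart-here ap x≢y (≈trans qx (≈sym qy)) _
    ... | yes refl = onep-left p₀ ζ ap (≈sym qp) (contp λ ξ s a t → runp k ξ (mat s) (≈trans (sub-≈ _ ha) a) (≈trans (sub-≈ _ hm) t))
    onep-clause p ζ {e = e} ap c-sumLp θ (atomc (q ∷ ha ∷ hm ∷ [])) k with view e p q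
    ... | isSum p₁ p₂ = onep-left p₁ ζ ap (≈sym (proj₁ (con2-injective plusC q)))
      (contp λ ξ s a t → runp k ξ (sumL s) (≈trans (sub-≈ _ ha) a) (≈trans (sub-≈ _ hm) t))
    onep-clause p ζ {e = e} ap c-sumRp θ (atomc (q ∷ ha ∷ hm ∷ [])) k with view e p q
    ... | isSum p₁ p₂ = onep-left p₂ ζ ap (≈sym (proj₂ (con2-injective plusC q)))
      (contp λ ξ s a t → runp k ξ (sumR s) (≈trans (sub-≈ _ ha) a) (≈trans (sub-≈ _ hm) t))
    onep-clause p ζ {σ} {e} ap c-parLp θ (atomc (q ∷ ha ∷ hm ∷ [])) k with view e p q
    ... | isPar p₁ p₂ with con2-injective parC q
    ... | q₁ , q₂ = onep-left p₁ ζ ap (≈sym q₁) (contp λ ξ s a t → runp k ξ (parL s) (≈trans (sub-≈ _ ha) a)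
      (≈trans (sub-≈ _ hm) (lamc (appc (appc ≈refl (≈trans (appc (≡⇒≈ (sub-wk (underS σ ξ) (θ vz))) ≈refl) (apply-wk t)))
        (beside σ ξ p₂ (≈sym q₂))))))
    onep-clause p ζ {σ} {e} ap c-parRp θ (atomc (q ∷ ha ∷ hm ∷ [])) k with view e p q
    ... | isPar p₁ p₂ with con2-injective parC q
    ... | q₁ , q₂ = onep-left p₂ ζ ap (≈sym q₂) (contp λ ξ s a t → runp k ξ (parR s) (≈trans (sub-≈ _ ha) a)
      (≈trans (sub-≈ _ hm) (lamc (appc (appc ≈refl (beside σ ξ p₁ (≈sym q₁)))
        (≈trans (appc (≡⇒≈ (sub-wk (underS σ ξ) (θ vz))) ≈refl) (apply-wk t))))))
    onep-clause p ζ {σ} {e} {M = M} {Γ} ap c-resp θ (atomc (q ∷ ha ∷ hm ∷ [])) k with view e p q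
    ... | isRes b = K-∇ (onep-left b ζ (apart-up ap) (≈sym (lam-inj (con1-injective nuC q))) (contp λ ξ {d} {x} {m} s a t →
      res-cont ξ s (wkDir-inv {e = λ i → act σ ξ (e i)} {A = act σ ξ (θ (vs vz))} d x
          (≈trans (≡⇒≈ (sym (sub-wk (underS σ ξ) (θ (vs vz)))))
          (≈trans a (dirT-≈ d (≡⇒≈ (sub-upT (underS σ ξ) e x))))))
        (≈trans (sub-≈ _ hm) (≈trans
          (lamc (appc ≈refl (lamc (appc (appc (≡⇒≈ (trans (sub-wk (liftS (underS σ ξ)) (ren vs (θ vz))) (cong (ren vs) (sub-wk (underS σ ξ) (θ vz))))) ≈refl) ≈refl))))
          (swap-target m (η-lam (≈trans (appc (≡⇒≈ (sym (sub-wk (underS σ ξ) (θ vz)))) ≈refl)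
            (≈trans t (trM-≈ (λ i → ≡⇒≈ (sub-upT (underS σ ξ) e i)) m)))))))))
      where
      res-cont : ∀ {H} (ξ : Sub _ H) {d x m} → Stepp b d x m →
                 (∃ λ y → x ≡ suc y × act σ ξ (θ (vs vz)) ≈ dirT d (act σ ξ (e y))) →
                 act σ ξ M ≈ trM (λ i → act σ ξ (e i)) (res′ (mapPr swap m)) → K (ξ ⊙ ζ) (map (subJ ξ) Γ)
      res-cont ξ s (y , refl , a) t = runp k ξ (res s) (≈trans (sub-≈ _ ha) a) t
    onep-clause p ζ {σ} {e} {M = M} {Γ} ap c-open θ (atomc (q ∷ ha ∷ hm ∷ [])) k with view e p q
    ... | isRes b = K-∇ (one-left b ζ (apart-up ap) (≈sym (lam-inj (con1-injective nuC q))) (cont1 λ ξ {α} {m} s a t →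
      open-cont ξ s (open-inv {e = λ i → act σ ξ (e i)} {X = act σ ξ (θ (vs vz))} α
          (≈trans (appc (appc ≈refl (≡⇒≈ (sym (sub-wk (underS σ ξ) (θ (vs vz)))))) ≈refl)
          (≈trans a (trA-≈ (λ i → ≡⇒≈ (sub-upT (underS σ ξ) e i)) α))))
        (≈trans (sub-≈ _ hm) (η-lam (≈trans (appc (≡⇒≈ (sym (sub-wk (underS σ ξ) (θ vz)))) ≈refl)
            (≈trans t (trT-≈ (λ i → ≡⇒≈ (sub-upT (underS σ ξ) e i)) m)))))))
      where
      open-cont : ∀ {H} (ξ : Sub _ H) {α m} → Step b α m →
                 (∃ λ x → α ≡ out′ (suc x) zero × act σ ξ (θ (vs vz)) ≈ act σ ξ (e x)) →
                 act σ ξ M ≈ trM (λ i → act σ ξ (e i)) m → K (ξ ⊙ ζ) (map (subJ ξ) Γ)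
      open-cont ξ s (x , refl , a) t = runp k ξ (open′ s) (≈trans (sub-≈ _ ha) (appc ≈refl a)) t

-- Transitions in the term model

SatJ-wkS : {γ : Sub G G₀} {h : Tm G₀ s} (J : Judg G) → SatJ γ J → SatJ (γ ▸ h) (subJ wkS J)
SatJ-wkS = SatJ-sub⁻ (λ _ → ≈refl)

-- Only valuations `γ` that undo `ξ` are considered, so that terms carried along by the analysis can
-- be read back over `G₀`. The goal is an arbitrary set `X`, to be inhabited by the analysis.
semantic : Set → LeftFamily G₀
semantic X = record
  { K      = λ {H} ξ Γ → (γ : Sub H G₀) → (∀ {t} (x : Var G₀ t) → sub γ (ξ x) ≈ var x) → All (SatJ γ) Γ → Lift _ X
  ; K-ext  = λ h k γ e as → k γ (λ x → ≈trans (≡⇒≈ (cong (sub γ) (h x))) (e x)) as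
  ; K-weak = λ { k γ e (a ∷ as) → k γ e as }
  ; K-∧    = λ { k γ e ((a , b) ∷ as) → k γ e (a ∷ b ∷ as) }
  ; K-∧ˢ   = λ { k γ e ((a , b) ∷ as) → k γ e (b ∷ a ∷ as) }
  ; K-∃    = λ { {ξ = ξ} {σ} {B = B} k γ e ((T , b) ∷ as) →
      k (γ ▸ abstr σ T) (λ x → ≈trans (≡⇒≈ (sub-sub (λ _ → refl) (ξ x))) (e x))
        (Sat-sub⁻ (raise-≈ σ γ T) B b ∷ All-map SatJ-wkS as) }
  ; K-∇    = λ { k γ e (a ∷ as) → k γ e (a ∷ as) }
  ; K-defL = λ { {ξ = ξ} {σ} {q} k γ e (a ∷ as) → unfold {ξ = ξ} {σ} {q} k γ e as (Sat-unfold q a) }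
  }
  where
  unfold : ∀ {H} {ξ : Sub G₀ H} {σ q as Γ} →
    ((c : Clause) → Dpi c → (u : Unifier H σ q as c) → (γ : Sub (Unifier.G' u) G₀) →
       (∀ {t} (x : Var G₀ t) → sub γ ((Unifier.ρ u ⊙ ξ) x) ≈ var x) →
       All (SatJ γ) ((σ , subF (Unifier.θ u) (cbody c)) ∷ map (subJ (Unifier.ρ u)) Γ) → Lift _ X) →
    (γ : Sub H G₀) → (∀ {t} (x : Var G₀ t) → sub γ (ξ x) ≈ var x) → All (SatJ γ) Γ →
    Unfolding q σ (All.map (act σ γ) as) → Lift _ X
  unfold {ξ = ξ} {σ} k γ e hs record { c = c ; d = d ; ξ = ξ' ; head = h ; body = b } =
    -- The valuation itself serves as the unifier; after it, the identity valuation is left.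
    k c d (record { G' = G₀ ; ρ = γ ; θ = ξ' ; unifies = h }) var
      (λ x → ≈trans (≡⇒≈ (sub-id (λ _ → refl) (sub γ (ξ x)))) (e x))
      (Sat-sub⁻ (λ x → ≡⇒≈ (sub-id (underS-id σ (λ _ → refl)) (ξ' x))) (cbody c) b
        ∷ All-map (SatJ-sub⁻ (λ x → ≡⇒≈ (sub-id (λ _ → refl) (γ x)))) hs)

sub-trA : (θ : Sub Γ Δ) (e : Fin n → Tm Γ nm) (α : Act′ n) → sub θ (trA e α) ≡ trA (λ i → sub θ (e i)) α
sub-trA θ e τ′         = refl
sub-trA θ e (out′ x y) = refl

module _ {σ : Ctx} {e : Fin n → Tm (σ ++ G₀) nm} (e-inj : ∀ {i j} → e i ≈ e j → i ≡ j) where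

  retract : ∀ {H} (ξ : Sub G₀ H) (γ : Sub H G₀) → (∀ {t} (x : Var G₀ t) → sub γ (ξ x) ≈ var x) →
            (M : Tm (σ ++ G₀) t) → act σ γ (act σ ξ M) ≈ M
  retract ξ γ h M = ≈trans (≡⇒≈ (sub-sub (λ _ → refl) M)) (≈trans
    (sub-cong≈ (λ x → ≈trans (underS-∘≈ σ {ζ = var} h x) (≡⇒≈ (underS-id σ (λ _ → refl) x))) M)
    (≡⇒≈ (sub-id (λ _ → refl) M)))

  semantic-apart : (X : Set) → Left.Apart (semantic X) {σ = σ} var e
  semantic-apart X = Left.apart λ ξ {i} {j} i≢j p Γ γ h as →
    ⊥-elim (i≢j (e-inj (≈trans (≈sym (retract ξ γ h (e i))) (≈trans (sub-≈ (underS σ γ) p) (retract ξ γ h (e j))))))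

  -- The left analysis with the claim itself as goal `X`: the continuation returns the transition
  -- that it is given.
  One?-inv : (p : Pr n) {P : Tm (σ ++ G₀) pr} {A : Tm (σ ++ G₀) ac} {T : Tm (σ ++ G₀) pr} → P ≈ trT e p → One? σ P A T →
             ∃ λ α → ∃ λ p' → Step p α p' × A ≈ trA e α × T ≈ trT e p'
  One?-inv p {P} {A} {T} hP o = lower (Left.one-left (semantic _) p var {P = P} {A} {T} {[]} (semantic-apart _) hP
    (Left.cont1 λ ξ {α} {p'} s a t γ h _ → lift (α , p' , s ,
      ≈trans (≈sym (retract ξ γ h A)) (≈trans (sub-≈ (underS σ γ) a) (≈trans (≡⇒≈ (sub-trA (underS σ γ) _ α)) (trA-≈ (λ i → retract ξ γ h (e i)) α))) ,
      ≈trans (≈sym (retract ξ γ h T)) (≈trans (sub-≈ (underS σ γ) t) (≈trans (≡⇒≈ (sub-trT (λ _ → refl) p')) (trT-≈ (λ i → retract ξ γ h (e i)) p')))))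
    var (λ _ → ≈refl) (subst (Atom one σ) (sym (argsId (underS-id σ (λ _ → refl)) _)) o ∷ []))

  Onep?-inv : (p : Pr n) {P : Tm (σ ++ G₀) pr} {A : Tm (σ ++ G₀) (nm ⇒ ac)} {M : Tm (σ ++ G₀) (nm ⇒ pr)} → P ≈ trT e p → Onep? σ P A M →
             ∃ λ d → ∃ λ x → ∃ λ m → Stepp p d x m × A ≈ dirT d (e x) × M ≈ trM e m
  Onep?-inv p {P} {A} {M} hP o = lower (Left.onep-left (semantic _) p var {P = P} {A} {M} {[]} (semantic-apart _) hP
    (Left.contp λ ξ {d} {x} {m} s a t γ h _ → lift (d , x , m , s ,
      ≈trans (≈sym (retract ξ γ h A)) (≈trans (sub-≈ (underS σ γ) a) (≈trans (≡⇒≈ (sub-dirT (underS σ γ) d)) (dirT-≈ d (retract ξ γ h (e x))))) ,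
      ≈trans (≈sym (retract ξ γ h M)) (≈trans (sub-≈ (underS σ γ) t) (≈trans (≡⇒≈ (sub-trM (underS σ γ) _ m)) (trM-≈ (λ i → retract ξ γ h (e i)) m)))))
    var (λ _ → ≈refl) (subst (Atom onep σ) (sym (argsId (underS-id σ (λ _ → refl)) _)) o ∷ []))

-- The derivation of the transition, read in the model by soundness.
Step⇒One? : {p p' : Pr n} {α : Act′ n} → Step p α p' → ∀ {σ} (e : Fin n → Tm (σ ++ G₀) nm) → One? σ (trT e p) (trA e α) (trT e p')
Step⇒One? s {σ} e = subst (Atom one σ) (argsId (underS-id σ (λ _ → refl)) _) (sound (Step-R s {σ} {[]} e ≈refl ≈refl ≈refl) var [])

Stepp⇒Onep? : {p : Pr n} {d : Dir} {x : Fin n} {m : Pr (suc n)} → Stepp p d x m → ∀ {σ} (e : Fin n → Tm (σ ++ G₀) nm) →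
              Onep? σ (trT e p) (dirT d (e x)) (trM e m)
Stepp⇒Onep? s {σ} e = subst (Atom onep σ) (argsId (underS-id σ (λ _ → refl)) _) (sound (Stepp-R s {σ} {[]} e ≈refl ≈refl ≈refl) var [])

-- From the term model to late bisimilarity

trA-injective : {e : Fin n → Tm Γ nm} → (∀ {i j} → e i ≈ e j → i ≡ j) → (α β : Act′ n) → trA e α ≈ trA e β → α ≡ β
trA-injective h τ′ τ′ p = refl
trA-injective h (out′ x y) (out′ x' y') p with label-injective ↑C p
... | q , r = cong₂ out′ (h q) (h r)
trA-injective h τ′ (out′ _ _) p with head-≈ p
... | ()
trA-injective h (out′ _ _) τ′ p with head-≈ p
... | ()

trM-app : (e : Fin n → Tm Γ nm) (T : Tm Γ nm) (m : Pr (suc n)) → app (trM e m) T ≈ trT (e ▹ T) m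
trM-app e T m = ≈trans β (≡⇒≈ (sub-trT (λ { zero → refl ; (suc i) → sub1-wk T (e i) }) m))

upT-injective : {e : Fin n → Tm Γ nm} → (∀ {i j} → e i ≈ e j → i ≡ j) → ∀ {i j} → upT e i ≈ upT e j → i ≡ j
upT-injective h {zero}  {zero}  p = refl
upT-injective h {zero}  {suc j} p = ⊥-elim (wk≉vz (≈sym p))
upT-injective h {suc i} {zero}  p = ⊥-elim (wk≉vz p)
upT-injective {e = e} h {suc i} {suc j} p = cong suc (h (wk-cancel (e i) p))

▹-injective : {A : Set} {_∼_ : A → A → Set} {f : Fin n → A} {a : A} → (∀ {x y} → x ∼ y → y ∼ x) →
              (∀ {i j} → f i ∼ f j → i ≡ j) → (∀ i → ¬ (f i ∼ a)) → ∀ {i j} → (f ▹ a) i ∼ (f ▹ a) j → i ≡ j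
▹-injective s h f {zero}  {zero}  p = refl
▹-injective s h f {zero}  {suc j} p = ⊥-elim (f j (s p))
▹-injective s h f {suc i} {zero}  p = ⊥-elim (f i p)
▹-injective s h f {suc i} {suc j} p = cong suc (h p)

-- A named pair and a bisimilar pair of the model are two readings of one scoped pair. The names are
-- distinct at occurring indices only, as the observer chooses them, while the terms are kept
-- distinct at all indices.
record Related (P Q : Proc 0) : Set where
  constructor related
  field
    {size} : ℕ
    ν      : Fin size → ℕ
    p q    : Pr size
    σ      : Ctx
    e      : Fin size → Tm (σ ++ G₀) nm
    P≡     : P ≡ nameP ν p
    Q≡     : Q ≡ nameP ν q
    ν-inj  : InjOn ν (par′ p q)
    e-inj  : ∀ {i j} → e i ≈ e j → i ≡ j
    bisim  : Bis σ (trT e p) (trT e q)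

Bis-sym : ∀ {σ P Q} → Bis σ P Q → Bis σ Q P
Bis-sym (bis (a , b , c , d , e , f)) = bis (b , a , d , c , f , e)

InjOn-sub : {ν : Fin n → ℕ} (p p' : Pr n) → (∀ {i} → Occ i p' → Occ i p) → InjOn ν p → InjOn ν p'
InjOn-sub p p' f h o o' = h (f o) (f o')

Occ-inst : (y : Fin n) (m : Pr (suc n)) {i : Fin n} → Occ i (inst y m) → i ≡ y ⊎ Occ (suc i) m
Occ-inst y m o with Occ-map _ m o
... | zero  , o' , refl = inj₁ refl
... | suc i , o' , refl = inj₂ o'

Occ-swap′ : {p q : Pr n} {i : Fin n} → Occ i (par′ p q) → Occ i (par′ q p)
Occ-swap′ (inj₁ o) = inj₂ o
Occ-swap′ (inj₂ o) = inj₁ o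

related-bisim : IsLateBisim Related
related-bisim = record { symm = symm ; free = free′ ; binp = binp ; boutp = boutp }
  where
  symm : ∀ {P Q} → Related P Q → Related Q P
  symm (related ν p q σ e a b c d r) =
    related ν q p σ e b a (InjOn-sub (par′ p q) (par′ q p) (Occ-swap′ {p = q} {p}) c) d (Bis-sym r)

  free′ : ∀ {P Q α P'} → Related P Q → FreeAct α → P ─ α ⟶ P' → ∃ λ Q' → (Q ─ α ⟶ Q') × Related P' Q'
  free′ (related ν p q σ e refl refl c e-inj (bis (h , _))) fa D with reflects ν p (InjOn-sub (par′ p q) p inj₁ c) D
  ... | boundR {dn} s k refl refl = ⊥-elim fa
  ... | boundR {up} s k refl refl = ⊥-elim fa
  ... | freeR {a} {p'} s refl refl with h _ _ (Step⇒One? s e)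
  ... | T , o , r with One?-inv e-inj q ≈refl o
  ... | α' , q' , s' , ha , ht with trA-injective e-inj a α' ha
  ... | refl = nameP ν q' , Step⇒⟶ ν s' , related ν p' q' σ e refl refl
    (InjOn-sub (par′ p q) (par′ p' q') (λ { (inj₁ o') → inj₁ (Step-occ s o') ; (inj₂ o') → inj₂ (Step-occ s' o') }) c)
    e-inj (Bis-≈ ≈refl ht r)

  binp : ∀ {P Q x z P'} → Related P Q → P ─ bin x z ⟶ P' → z ∉fn P , Q →
         ∃ λ Q' → (Q ─ bin x z ⟶ Q') × (∀ y → Related (P' [ y / z ]) (Q' [ y / z ]))
  binp {z = z} (related ν p q σ e refl refl c e-inj (bis (_ , _ , h , _))) D (z∉P , z∉Q)
    with asBound dn (reflects ν p (InjOn-sub (par′ p q) p inj₁ c) D)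
  ... | reflectsBound {x} {m} s k refl refl with h (e x) (trM e m) (Stepp⇒Onep? s e)
  ... | T , o , r with Onep?-inv e-inj q ≈refl o
  ... | d , x' , m' , s' , ha , ht with dirT-injective dn d ha
  ... | refl , hx with e-inj hx
  ... | refl = nameP (ν ▹ z) m' , Stepp⇒⟶ ν s' z∉Q , λ y →
    subst₂ Related (sym (subst-name ν y z m k)) (sym (subst-name ν y z m' (λ i o' → ∉-fn q z∉Q i (Stepp-occ s' o')))) (pick y)
    where
    occ : ∀ {i} → Occ (suc i) (par′ m m') → Occ i (par′ p q)
    occ (inj₁ o') = inj₁ (Stepp-occ s o')
    occ (inj₂ o') = inj₂ (Stepp-occ s' o')
    pick : ∀ y → Related (nameP (ν ▹ y) m) (nameP (ν ▹ y) m')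
    -- The answer `m'` is already fixed for all `y`; only the term instantiating the ∀ of the input
    -- clause depends on `y`.
    pick y with y ∈? fn (nameP ν (par′ p q))
    ... | yes y∈ with fn-toP⁻ (par′ p q) y∈
    ...   | i , oi , refl = subst₂ Related (name-inst ν i m) (name-inst ν i m')
      (related ν (inst i m) (inst i m') σ e refl refl
        (InjOn-sub (par′ p q) (par′ (inst i m) (inst i m')) inst-occ c) e-inj
        (Bis-≈ (inst-β e i m) (≈trans (appc ht ≈refl) (inst-β e i m')) (r (e i))))
      where
      or-i : ∀ {j} {B : Set} → (B → Occ j (par′ p q)) → j ≡ i ⊎ B → Occ j (par′ p q)
      or-i f (inj₁ refl) = oi
      or-i f (inj₂ b)    = f b
      inst-occ : ∀ {j} → Occ j (par′ (inst i m) (inst i m')) → Occ j (par′ p q)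
      inst-occ (inj₁ o') = or-i (λ b → occ (inj₁ b)) (Occ-inst i m o')
      inst-occ (inj₂ o') = or-i (λ b → occ (inj₂ b)) (Occ-inst i m' o')
    -- The name may still belong to an index without occurrences, which `InjOn` tolerates; on the
    -- term side `Y` differs from every `e i`.
    pick y | no y∉ with freshName σ e
    ... | Y , Yf = related (ν ▹ y) m m' σ (e ▹ Y) refl refl
      (▹-injOn (par′ m m') (λ o₁ o₂ → c (occ o₁) (occ o₂)) (λ i o' → ∉-fn (par′ p q) y∉ i (occ o')))
      (▹-injective {_∼_ = _≈_} {e} ≈sym e-inj Yf)
      (Bis-≈ (trM-app e Y m) (≈trans (appc ht ≈refl) (trM-app e Y m')) (r Y))

  boutp : ∀ {P Q x z P'} → Related P Q → P ─ bout x z ⟶ P' → z ∉fn P , Q →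
          ∃ λ Q' → (Q ─ bout x z ⟶ Q') × Related P' Q'
  boutp {z = z} (related ν p q σ e refl refl c e-inj (bis (_ , _ , _ , _ , h , _))) D (z∉P , z∉Q)
    with asBound up (reflects ν p (InjOn-sub (par′ p q) p inj₁ c) D)
  ... | reflectsBound {x} {m} s k refl refl with h (e x) (trM e m) (Stepp⇒Onep? s e)
  ... | T , o , r with Onep?-inv e-inj q ≈refl o
  ... | d , x' , m' , s' , ha , ht with dirT-injective up d ha
  ... | refl , hx with e-inj hx
  ... | refl = nameP (ν ▹ z) m' , Stepp⇒⟶ ν s' z∉Q , related (ν ▹ z) m m' (nm ∷ σ) (upT e) refl refl
    (▹-injOn (par′ m m') (λ o₁ o₂ → c (occ o₁) (occ o₂))
      (λ { i (inj₁ o') → k i o' ; i (inj₂ o') → ∉-fn q z∉Q i (Stepp-occ s' o') }))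
    (upT-injective e-inj) (Bis-≈ (wkβ _) (apply-wk ht) r)
    where
    occ : ∀ {i} → Occ (suc i) (par′ m m') → Occ i (par′ p q)
    occ (inj₁ o') = inj₁ (Stepp-occ s o')
    occ (inj₂ o') = inj₂ (Stepp-occ s' o')

-- Scoping the given processes, and agreement with the translation ⟦_⟧

tr-trT : ∀ {E : Nm k → Maybe (Tm Γ nm)} {f : Fin n → Nm k} {e : Fin n → Tm Γ nm} → (∀ i → E (f i) ≡ just (e i)) →
         (p : Pr n) → tr E (toP f p) ≡ just (trT e p)

liftEnv-up : ∀ {E : Nm k → Maybe (Tm Γ nm)} {f : Fin n → Nm k} {e : Fin n → Tm Γ nm} → (∀ i → E (f i) ≡ just (e i)) →
             ∀ i → liftEnv E (upNm f i) ≡ just (upT e i)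
liftEnv-up h zero = refl
liftEnv-up {f = f} h (suc i) with f i | h i
... | fr a | q = cong (Maybe.map (ren vs)) q
... | bd j | q = cong (Maybe.map (ren vs)) q

tr-trT h nil′ = refl
tr-trT {E = E} {f} h (out′ x y p) rewrite h x | h y | tr-trT {E = E} {f} h p = refl
tr-trT {E = E} {f} h (inp′ x p) rewrite h x | tr-trT {E = liftEnv E} {upNm f} (liftEnv-up h) p = refl
tr-trT {E = E} {f} h (tau′ p) rewrite tr-trT {E = E} {f} h p = refl
tr-trT {E = E} {f} h (res′ p) rewrite tr-trT {E = liftEnv E} {upNm f} (liftEnv-up h) p = refl
tr-trT {E = E} {f} h (mat′ x y p) rewrite h x | h y | tr-trT {E = E} {f} h p = refl
tr-trT {E = E} {f} h (par′ p q) rewrite tr-trT {E = E} {f} h p | tr-trT {E = E} {f} h q = refl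
tr-trT {E = E} {f} h (sum′ p q) rewrite tr-trT {E = E} {f} h p | tr-trT {E = E} {f} h q = refl

Covers : (Fin n → Nm k) → List ℕ → Set
Covers f as = ∀ {a} → a ∈ as → ∃ λ i → f i ≡ fr a

Binds : (Fin n → Nm k) → Set
Binds {k = k} f = (j : Fin k) → ∃ λ i → f i ≡ bd j

binds-up : {f : Fin n → Nm k} → Binds f → Binds (upNm f)
binds-up b zero = zero , refl
binds-up b (suc j) with b j
... | i , q = suc i , cong wkNm q

covers-up : {f : Fin n → Nm k} {as : List ℕ} → Covers f as → Covers (upNm f) as
covers-up c a∈ with c a∈
... | i , q = suc i , cong wkNm q

scopeNm : {f : Fin n → Nm k} (x : Nm k) → Binds f → Covers f (fnNm x) → ∃ λ i → f i ≡ x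
scopeNm (fr a) b c = c (here refl)
scopeNm (bd j) b c = b j

scope : {f : Fin n → Nm k} (P : Proc k) → Binds f → Covers f (fn P) → ∃ λ p → toP f p ≡ P
scope nil b c = nil′ , refl
scope (out x y P) b c
  with scopeNm x b (λ a∈ → c (∈-++⁺ˡ a∈)) | scopeNm y b (λ a∈ → c (∈-++⁺ʳ (fnNm x) (∈-++⁺ˡ a∈)))
     | scope P b (λ a∈ → c (∈-++⁺ʳ (fnNm x) (∈-++⁺ʳ (fnNm y) a∈)))
... | i , refl | j , refl | p , refl = out′ i j p , refl
scope (inp x P) b c
  with scopeNm x b (λ a∈ → c (∈-++⁺ˡ a∈)) | scope P (binds-up b) (covers-up (λ a∈ → c (∈-++⁺ʳ (fnNm x) a∈)))
... | i , refl | p , refl = inp′ i p , refl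
scope (tau P) b c with scope P b c
... | p , refl = tau′ p , refl
scope (res P) b c with scope P (binds-up b) (covers-up c)
... | p , refl = res′ p , refl
scope (mat x y P) b c
  with scopeNm x b (λ a∈ → c (∈-++⁺ˡ a∈)) | scopeNm y b (λ a∈ → c (∈-++⁺ʳ (fnNm x) (∈-++⁺ˡ a∈)))
     | scope P b (λ a∈ → c (∈-++⁺ʳ (fnNm x) (∈-++⁺ʳ (fnNm y) a∈)))
... | i , refl | j , refl | p , refl = mat′ i j p , refl
scope (par P Q) b c with scope P b (λ a∈ → c (∈-++⁺ˡ a∈)) | scope Q b (λ a∈ → c (∈-++⁺ʳ (fn P) a∈))
... | p , refl | q , refl = par′ p q , refl
scope (sum P Q) b c with scope P b (λ a∈ → c (∈-++⁺ˡ a∈)) | scope Q b (λ a∈ → c (∈-++⁺ʳ (fn P) a∈))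
... | p , refl | q , refl = sum′ p q , refl

varAt : (ns : List ℕ) → Fin (length ns) → Var (nmCtx ns) nm
varAt (a ∷ ns) zero    = vz
varAt (a ∷ ns) (suc i) = vs (varAt ns i)

varAt-injective : (ns : List ℕ) {i j : Fin (length ns)} → varAt ns i ≡ varAt ns j → i ≡ j
varAt-injective (a ∷ ns) {zero}  {zero}  q = refl
varAt-injective (a ∷ ns) {suc i} {suc j} q = cong suc (varAt-injective ns (vs-injective q))
  where
  vs-injective : ∀ {Γ s t} {x y : Var Γ t} → vs {s = s} x ≡ vs y → x ≡ y
  vs-injective refl = refl

lookupName-at : (ns : List ℕ) → (∀ {i j} → lookup ns i ≡ lookup ns j → i ≡ j) → ∀ i → lookupName ns (lookup ns i) ≡ just (varAt ns i)
lookupName-at (a ∷ ns) inj zero    = if-≡ a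
lookupName-at (a ∷ ns) inj (suc i) = trans (if-≢ {b = a} (λ q → case (inj {suc i} {zero} q)))
  (cong (Maybe.map vs) (lookupName-at ns (λ q → suc-inj (inj (cong-lookup q))) i))
  where
  case : ∀ {n} {i : Fin n} → ¬ (Fin.suc i ≡ zero)
  case ()
  suc-inj : ∀ {n} {i j : Fin n} → Fin.suc i ≡ suc j → i ≡ j
  suc-inj refl = refl
  cong-lookup : ∀ {i j} → lookup ns i ≡ lookup ns j → lookup (a ∷ ns) (suc i) ≡ lookup (a ∷ ns) (suc j)
  cong-lookup q = q

-- Reading ∇ n̄ in the term model: the bound names become distinct local variables

Distinct : Sub Γ Δ → Set
Distinct {Γ} θ = ∀ {x y : Var Γ nm} → θ x ≈ θ y → x ≡ y

liftS-distinct : {θ : Sub Γ Δ} → Distinct θ → Distinct (liftS {s = nm} θ)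
liftS-distinct h {vz}   {vz}   p = refl
liftS-distinct h {vz}   {vs y} p = ⊥-elim (wk≉vz (≈sym p))
liftS-distinct h {vs x} {vz}   p = ⊥-elim (wk≉vz p)
liftS-distinct {θ = θ} h {vs x} {vs y} p = cong vs (h (wk-cancel (θ x) p))

∇all-Sat : (ns : List ℕ) {B : Fm (nmCtx ns)} {σ : Ctx} {θ : Sub [] (σ ++ G₀)} → Sat (∇all (nmCtx ns) B) σ θ →
           ∃ λ σ' → Σ (Sub (nmCtx ns) (σ' ++ G₀)) λ θ' → Distinct θ' × Sat B σ' θ'
∇all-Sat []       {σ = σ} {θ} b = σ , θ , (λ { {()} }) , b
∇all-Sat (a ∷ ns) {B} b with ∇all-Sat ns {∇' nm B} b
... | σ' , θ' , h , b' = nm ∷ σ' , liftS θ' , liftS-distinct h , b'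

Sat-∇all : (Γ : Ctx) {B : Fm Γ} {σ : Ctx} {θ : Sub [] (σ ++ G₀)} → (∀ {σ'} (θ' : Sub Γ (σ' ++ G₀)) → Sat B σ' θ') →
           Sat (∇all Γ B) σ θ
Sat-∇all []      {θ = θ} h = h θ
Sat-∇all (t ∷ Γ) h = Sat-∇all Γ (λ θ' → h (liftS θ'))

Eform-true : (k : ℕ) → SatJ emp ([] , Eform k)
Eform-true k = Sat-∇all (replicate k nm) λ θ' x y → dec x y (x ≈? y)
  where
  dec : ∀ {σ} (x y : Tm (σ ++ G₀) nm) → Dec (x ≈ y) → Atom (eq nm) σ (x ∷ y ∷ []) ⊎ (Atom (eq nm) σ (x ∷ y ∷ []) → ⊥)
  dec x y (yes p) = inj₁ (fold _ (c-eq nm) (emp ▸ x) (atomc (≈refl ∷ ≈sym p ∷ [])) ⊤p)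
  dec x y (no ¬p) = inj₂ λ { (fold _ (c-eq _) ξ (atomc (p ∷ q ∷ [])) _) → ¬p (≈trans p (≈sym q)) }

Ehyps-true : (𝒳 : List ℕ) → All (SatJ emp) (Ehyps 𝒳)
Ehyps-true []      = []
Ehyps-true (k ∷ 𝒳) = Eform-true k ∷ Ehyps-true 𝒳

-- Derived rules

⊢-subst : {Γ Γ' : List (Judg G)} {C C' : Judg G} → Γ ≡ Γ' → C ≡ C' → G ⊢ Γ ⊢ C → G ⊢ Γ' ⊢ C'
⊢-subst refl refl d = d

weaken : (Ψ : List (Judg G)) {Γ : List (Judg G)} {C : Judg G} → G ⊢ Γ ⊢ C → G ⊢ Ψ ++ Γ ⊢ C
weaken []      d = d
weaken (J ∷ Ψ) d = weak (weaken Ψ d)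

∈-split : {J : Judg G} {Γ : List (Judg G)} → J ∈ Γ → ∃ λ Γ' → Γ ↭ J ∷ Γ'
∈-split {Γ = J ∷ Γ} (here refl) = Γ , Perm.refl
∈-split {J = J} {Γ = K ∷ Γ} (there J∈) with ∈-split J∈
... | Γ' , p = K ∷ Γ' , Perm.trans (Perm.prep K p) (Perm.swap K J Perm.refl)

use : {J : Judg G} {Γ : List (Judg G)} {C : Judg G} → J ∈ Γ → G ⊢ J ∷ Γ ⊢ C → G ⊢ Γ ⊢ C
use {J = J} J∈ d with ∈-split J∈
... | Γ' , p = exch (↭-sym p) (contr (exch (Perm.prep J p) d))

subJ-cong : {θ ξ : Sub Γ Δ} → (∀ {t} (x : Var Γ t) → θ x ≡ ξ x) → (J : Judg Γ) → subJ θ J ≡ subJ ξ J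
subJ-cong {θ = θ} h J = trans (cong (subJ θ) (sym (subJ-id (λ _ → refl) J))) (subJ-sub h J)

map-renJ : (Js : List (Judg G)) → map (renJ (vs {s = s})) Js ≡ map (subJ wkS) Js
map-renJ = map-cong renJ-wk

wkθ : (σ : Ctx) → Sub Γ (σ ++ G) → Sub Γ (σ ++ (s ∷ G))
wkθ σ θ x = act σ wkS (θ x)

raiseF : (σ : Ctx) (θ : Sub Γ (σ ++ G)) (B : Fm (t ∷ Γ)) →
         subF (raiseSub σ) (subF (liftS θ) B) ≡ subF (wkθ σ θ ▸ raiseSub {t = t} σ vz) B
raiseF σ θ = subF-sub λ { vz → refl ; (vs x) → raise-wk σ (θ x) }

∀R° : {Γ₀ : List (Judg G)} (σ : Ctx) (θ : Sub Γ (σ ++ G)) (B : Fm (t ∷ Γ)) →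
      (raiseTy σ t ∷ G) ⊢ map (subJ wkS) Γ₀ ⊢ (σ , subF (wkθ σ θ ▸ raiseSub {t = t} σ vz) B) → G ⊢ Γ₀ ⊢ (σ , subF θ (∀' t B))
∀R° {Γ₀ = Γ₀} σ θ B d = ∀R (⊢-subst (sym (map-renJ Γ₀)) (cong (σ ,_) (sym (raiseF σ θ B))) d)

instF : (σ : Ctx) (θ : Sub Γ (σ ++ G)) (T : Tm (σ ++ G) t) (B : Fm (t ∷ Γ)) →
        subF (sub1 T) (subF (liftS θ) B) ≡ subF (θ ▸ T) B
instF σ θ T = subF-sub λ { vz → refl ; (vs x) → sub1-wk T (θ x) }

∃R° : {Γ₀ : List (Judg G)} (σ : Ctx) (θ : Sub Γ (σ ++ G)) (T : Tm (σ ++ G) t) (B : Fm (t ∷ Γ)) →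
      G ⊢ Γ₀ ⊢ (σ , subF (θ ▸ T) B) → G ⊢ Γ₀ ⊢ (σ , subF θ (∃' t B))
∃R° σ θ T B d = ∃R T (⊢-subst refl (cong (σ ,_) (sym (instF σ θ T B))) d)

allUnifiers : ∀ {G σ q as} (c : Clause) → CSU G σ q as c
allUnifiers {G} {σ} {q} {as} c = record
  { Idx      = Unifier G σ q as c
  ; unifier  = λ u → u
  ; complete = λ u → u , var , (λ x → ≡⇒≈ (sub-id (λ _ → refl) (Unifier.ρ u x))) ,
                                (λ x → ≡⇒≈ (sub-id (underS-id σ (λ _ → refl)) (Unifier.θ u x)))
  }

sequents : List (Judg G) → Judg G → LeftFamily G
sequents Γ₀ C = record
  { K      = λ {H} ξ Γ → H ⊢ Γ ++ map (subJ ξ) Γ₀ ⊢ subJ ξ C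
  ; K-ext  = λ {_} {_} {_} {Γ} h → ⊢-subst (cong (Γ ++_) (map-cong (subJ-cong h) Γ₀)) (subJ-cong h C)
  ; K-weak = weak
  ; K-∧    = λ d → contr (∧L₁ (exch (Perm.swap _ _ Perm.refl) (∧L₂ (exch (Perm.swap _ _ Perm.refl) d))))
  ; K-∧ˢ   = λ d → contr (∧L₂ (exch (Perm.swap _ _ Perm.refl) (∧L₁ (exch (Perm.swap _ _ Perm.refl) d))))
  ; K-∃    = λ {_} {ξ} {σ} {t} {B} {Γ} d → ∃L (⊢-subst
      (cong (_ ∷_) (trans (list wkS ξ Γ) (sym (map-renJ (Γ ++ map (subJ ξ) Γ₀)))))
      (trans (sym (subJ-sub (λ _ → refl) C)) (sym (renJ-wk (subJ ξ C)))) d)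
  ; K-∇    = ∇L
  ; K-defL = λ {_} {ξ} {σ} {q} {as} {Γ} d → defL (λ c _ → allUnifiers c) (λ c dc u → ⊢-subst
      (cong (_ ∷_) (list (Unifier.ρ u) ξ Γ)) (sym (subJ-sub (λ _ → refl) C)) (d c dc u))
  }
  where
  list : ∀ {H H'} (χ : Sub H H') (ξ : Sub _ H) (Γ : List (Judg H)) →
         map (subJ χ) Γ ++ map (subJ (χ ⊙ ξ)) Γ₀ ≡ map (subJ χ) (Γ ++ map (subJ ξ) Γ₀)
  list χ ξ Γ = trans (cong (map (subJ χ) Γ ++_) (map-subJ Γ₀)) (sym (map-++ (subJ χ) Γ (map (subJ ξ) Γ₀)))

eq-unify : ∀ {σ} {x y : Tm (σ ++ G) t} {c : Clause} → Dpi c → (θ : Sub (cvars c) (σ ++ G)) →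
           atom (eq t) (x ∷ y ∷ []) ≈F atom (cpred c) (All.map (sub θ) (chead c)) → x ≈ y
eq-unify (c-eq t) θ (atomc (p ∷ q ∷ [])) = ≈trans p (≈sym q)

eq-left : ∀ {σ} {x y : Tm (σ ++ G) t} {Γ : List (Judg G)} {C : Judg G} →
          (∀ {H} (ξ : Sub G H) → act σ ξ x ≈ act σ ξ y → H ⊢ map (subJ ξ) Γ ⊢ subJ ξ C) →
          G ⊢ (σ , x ≐ y) ∷ Γ ⊢ C
eq-left {σ = σ} k = defL (λ c _ → allUnifiers c) (λ c d u → weak (k (Unifier.ρ u) (eq-unify {σ = σ} d (Unifier.θ u) (Unifier.unifies u))))

Neq : (σ : Ctx) → Tm (σ ++ G) nm → Tm (σ ++ G) nm → Judg G
Neq σ x y = σ , ((x ≐ y) ⊃' ⊥')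

neq-left : ∀ {σ} {x y : Tm (σ ++ G) nm} {Γ : List (Judg G)} → Neq σ x y ∈ Γ → (ξ : Sub G H) →
           act σ ξ x ≈ act σ ξ y → (C : Judg H) → H ⊢ map (subJ ξ) Γ ⊢ C
neq-left {σ = σ} {x} N∈ ξ p C = use (∈-map⁺ (subJ ξ) N∈)
  (⊃L {Δ = []} (defR _ (c-eq nm) (emp ▸ act σ ξ x) (atomc (≈refl ∷ p ∷ [])) ⊤R) ⊥L)

-- The hypotheses in ℰ at depth k decide equality of names under k local variables.

EJ : ℕ → Judg G
EJ k = [] , subF emp (Eform k)

subJ-EJ : (ξ : Sub G H) (k : ℕ) → subJ ξ (EJ k) ≡ EJ k
subJ-EJ ξ k = cong ([] ,_) (subF-sub (λ ()) (Eform k))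

deep : (k : ℕ) → Sub (replicate k nm) (replicate k nm ++ G)
deep zero    = emp
deep (suc k) = liftS (deep k)

∇all-L : (k : ℕ) {B : Fm (replicate k nm)} {Γ : List (Judg G)} {C : Judg G} →
         G ⊢ (replicate k nm , subF (deep k) B) ∷ Γ ⊢ C → G ⊢ ([] , subF emp (∇all (replicate k nm) B)) ∷ Γ ⊢ C
∇all-L zero    {B} {Γ} {C} d = d
∇all-L (suc k) {B} d = ∇all-L k {∇' nm B} (∇L d)

split : (k : ℕ) (x y : Tm (replicate k nm ++ G) nm) {Γ : List (Judg G)} {C : Judg G} → EJ k ∈ Γ →
        G ⊢ (replicate k nm , x ≐ y) ∷ Γ ⊢ C → G ⊢ Neq (replicate k nm) x y ∷ Γ ⊢ C → G ⊢ Γ ⊢ C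
split k x y {Γ} {C} E∈ d d' = use E∈ (∇all-L k (∀L x (∀L y (∨L
  (subst (λ z → _ ⊢ (replicate k nm , z ≐ y) ∷ Γ ⊢ C) (sym (sub1-wk y x)) d)
  (subst (λ z → _ ⊢ Neq (replicate k nm) z y ∷ Γ ⊢ C) (sym (sub1-wk y x)) d')))))

-- Counts prefixes only. Restriction and parallel composition weigh nothing, because a closing
-- communication creates a restriction; every transition still consumes a prefix.
size : Pr n → ℕ
size nil′         = 0
size (out′ _ _ p) = suc (size p)
size (inp′ _ p)   = suc (size p)
size (tau′ p)     = suc (size p)
size (res′ p)     = size p
size (mat′ _ _ p) = size p
size (par′ p q)   = size p + size q
size (sum′ p q)   = size p + size q

size-map : ∀ {m} (f : Fin n → Fin m) (p : Pr n) → size (mapPr f p) ≡ size p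
size-map f nil′         = refl
size-map f (out′ _ _ p) = cong suc (size-map f p)
size-map f (inp′ _ p)   = cong suc (size-map (liftF f) p)
size-map f (tau′ p)     = cong suc (size-map f p)
size-map f (res′ p)     = size-map (liftF f) p
size-map f (mat′ _ _ p) = size-map f p
size-map f (par′ p q)   = cong₂ _+_ (size-map f p) (size-map f q)
size-map f (sum′ p q)   = cong₂ _+_ (size-map f p) (size-map f q)

size-inst : (y : Fin n) (m : Pr (suc n)) → size (inst y m) ≡ size m
size-inst y m = size-map _ m

mutual
  Step-size : {p p' : Pr n} {α : Act′ n} → Step p α p' → size p' < size p
  Step-size tau      = ≤-refl
  Step-size out      = ≤-refl
  Step-size (mat s)  = Step-size s
  Step-size (sumL s) = ≤-trans (Step-size s) (m≤m+n _ _)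
  Step-size (sumR {p} s) = ≤-trans (Step-size s) (m≤n+m _ (size p))
  Step-size (parL s) = +-mono-<-≤ (Step-size s) ≤-refl
  Step-size (parR {p} s) = +-mono-≤-< (≤-refl {size p}) (Step-size s)
  Step-size (res s)  = Step-size s
  Step-size (close d s r) = +-mono-< (Stepp-size s) (Stepp-size r)
  Step-size (comL {y = y} {m} s r) rewrite size-inst y m = +-mono-< (Stepp-size s) (Step-size r)
  Step-size (comR {y = y} {m = m} s r) rewrite size-inst y m = +-mono-< (Step-size s) (Stepp-size r)

  Stepp-size : {p : Pr n} {d : Dir} {x : Fin n} {m : Pr (suc n)} → Stepp p d x m → size m < size p
  Stepp-size inp      = ≤-refl
  Stepp-size (mat s)  = Stepp-size s
  Stepp-size (sumL s) = ≤-trans (Stepp-size s) (m≤m+n _ _)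
  Stepp-size (sumR {p} s) = ≤-trans (Stepp-size s) (m≤n+m _ (size p))
  Stepp-size (parL {q = q} s) rewrite size-map suc q = +-mono-<-≤ (Stepp-size s) ≤-refl
  Stepp-size (parR {p} s) rewrite size-map suc p = +-mono-≤-< (≤-refl {size p}) (Stepp-size s)
  Stepp-size (res {m = m} s) rewrite size-map swap m = Stepp-size s
  Stepp-size (open′ s) = Step-size s

Injective′ : (Fin n → ℕ) → Set
Injective′ ν = ∀ {i j} → ν i ≡ ν j → i ≡ j

▹-inj : {ν : Fin n → ℕ} {y : ℕ} → Injective′ ν → (∀ i → ν i ≢ y) → Injective′ (ν ▹ y)
▹-inj {ν = ν} = ▹-injective {_∼_ = _≡_} {ν} sym

actOf-injective : {ν : Fin n → ℕ} → Injective′ ν → (α β : Act′ n) → actOf ν α ≡ actOf ν β → α ≡ β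
actOf-injective h τ′ τ′ e = refl
actOf-injective h (out′ x y) (out′ x' y') e = cong₂ out′ (h (proj₁ (fout-injective e))) (h (proj₂ (fout-injective e)))
  where
  fout-injective : ∀ {a b c d} → fout a b ≡ fout c d → a ≡ c × b ≡ d
  fout-injective refl = refl , refl

FreeAct-actOf : (ν : Fin n → ℕ) (α : Act′ n) → FreeAct (actOf ν α)
FreeAct-actOf ν τ′         = _
FreeAct-actOf ν (out′ _ _) = _

actOf≢bAct : {ν : Fin n → ℕ} (α : Act′ n) (d : Dir) {x w : ℕ} → actOf ν α ≢ bAct d x w
actOf≢bAct τ′ dn ()
actOf≢bAct τ′ up ()
actOf≢bAct (out′ _ _) dn ()
actOf≢bAct (out′ _ _) up ()

-- From late bisimilarity to derivations

module Completeness (R : Proc 0 → Proc 0 → Set) (R-bisim : IsLateBisim R) (N : ℕ) where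
  open IsLateBisim R-bisim

  -- The quantification over instances ξ makes the invariant stable under defL.
  record State (Γ : List (Judg G)) (k : ℕ) (e : Fin n → Tm (replicate k nm ++ G) nm) : Set₁ where
    constructor state
    field
      refute : ∀ {H} (ξ : Sub G H) {i j : Fin n} → i ≢ j →
               act (replicate k nm) ξ (e i) ≈ act (replicate k nm) ξ (e j) → ∀ C → H ⊢ map (subJ ξ) Γ ⊢ C
      E∈     : ∀ j → j ≤ N → EJ j ∈ Γ
  open State

  shift : {Γ : List (Judg G)} {e : Fin n → Tm (replicate k nm ++ G) nm} → State Γ k e → (χ : Sub G H) →
          State (map (subJ χ) Γ) k (λ i → act (replicate k nm) χ (e i))
  shift {k = k} {Γ = Γ} {e} S χ = state
    (λ ξ {i} {j} i≢j p C → ⊢-subst (map-subJ Γ) refl (refute S (ξ ⊙ χ) i≢j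
      (≈trans (≡⇒≈ (∘-eq (replicate k nm) ξ (e i))) (≈trans p (≡⇒≈ (sym (∘-eq (replicate k nm) ξ (e j)))))) C))
    (λ j j≤ → subst (_∈ map (subJ χ) Γ) (subJ-EJ χ j) (∈-map⁺ (subJ χ) (E∈ S j j≤)))

  under : {Γ : List (Judg G)} {e : Fin n → Tm (replicate k nm ++ G) nm} → State Γ k e → State Γ (suc k) (upT e)
  under {e = e} S = state (λ ξ i≢j p C → upT-apart e ξ (λ i≢j q → refute S ξ i≢j q C) i≢j p) (E∈ S)

  assume : {Γ : List (Judg G)} {e : Fin n → Tm (replicate k nm ++ G) nm} (J : Judg G) → State Γ k e → State (J ∷ Γ) k e
  assume J S = state (λ ξ i≢j p C → weak (refute S ξ i≢j p C)) (λ j j≤ → there (E∈ S j j≤))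

  -- A term joins the known names once its inequality with each of them is a hypothesis: these
  -- hypotheses refute the instances in which it is merged with one of them.
  extend : {Γ : List (Judg G)} {e : Fin n → Tm (replicate k nm ++ G) nm} {w : Tm (replicate k nm ++ G) nm} → State Γ k e →
           (∀ i → Neq (replicate k nm) w (e i) ∈ Γ) → State Γ k (e ▹ w)
  extend {G = G} {k = k} {Γ = Γ} {e} {w} S N∈ = state go (E∈ S)
    where
    σ = replicate k nm
    go : ∀ {H} (ξ : Sub G H) {i j} → i ≢ j → act σ ξ ((e ▹ w) i) ≈ act σ ξ ((e ▹ w) j) →
         ∀ C → H ⊢ map (subJ ξ) Γ ⊢ C
    go ξ {zero}  {zero}  i≢j p = ⊥-elim (i≢j refl)
    go ξ {zero}  {suc j} i≢j p = neq-left (N∈ j) ξ p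
    go ξ {suc i} {zero}  i≢j p = neq-left (N∈ i) ξ (≈sym p)
    go ξ {suc i} {suc j} i≢j p = refute S ξ (λ { refl → i≢j refl }) p

  one-hyp : {Γ : List (Judg G)} {e : Fin n → Tm (replicate k nm ++ G) nm} {P T : Tm (replicate k nm ++ G) pr}
            {A : Tm (replicate k nm ++ G) ac} {C : Judg G} → State Γ k e → (p : Pr n) → P ≈ trT e p →
            (∀ {H} (ξ : Sub G H) {α p'} → Step p α p' →
               act (replicate k nm) ξ A ≈ trA (λ i → act (replicate k nm) ξ (e i)) α →
               act (replicate k nm) ξ T ≈ trT (λ i → act (replicate k nm) ξ (e i)) p' →
               H ⊢ map (subJ ξ) Γ ⊢ subJ ξ C) →
            G ⊢ (replicate k nm , One P A T) ∷ Γ ⊢ C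
  one-hyp {Γ = Γ} {C = C} S p hP k = ⊢-subst (cong (_ ∷_) (map-subJ-id Γ)) (subJ-id (λ _ → refl) C)
    (Left.one-left (sequents Γ C) p var (Left.apart λ ξ i≢j q Ψ → weaken Ψ (refute S ξ i≢j q _)) hP (Left.cont1 k))

  onep-hyp : {Γ : List (Judg G)} {e : Fin n → Tm (replicate k nm ++ G) nm} {P : Tm (replicate k nm ++ G) pr}
             {A : Tm (replicate k nm ++ G) (nm ⇒ ac)} {M : Tm (replicate k nm ++ G) (nm ⇒ pr)} {C : Judg G} →
             State Γ k e → (p : Pr n) → P ≈ trT e p →
             (∀ {H} (ξ : Sub G H) {d x m} → Stepp p d x m →
                act (replicate k nm) ξ A ≈ dirT d (act (replicate k nm) ξ (e x)) →
                act (replicate k nm) ξ M ≈ trM (λ i → act (replicate k nm) ξ (e i)) m →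
                H ⊢ map (subJ ξ) Γ ⊢ subJ ξ C) →
             G ⊢ (replicate k nm , Onep P A M) ∷ Γ ⊢ C
  onep-hyp {Γ = Γ} {C = C} S p hP k = ⊢-subst (cong (_ ∷_) (map-subJ-id Γ)) (subJ-id (λ _ → refl) C)
    (Left.onep-left (sequents Γ C) p var (Left.apart λ ξ i≢j q Ψ → weaken Ψ (refute S ξ i≢j q _)) hP (Left.contp k))

  -- `m` bounds the combined size strictly. Each round lowers `m` by one and raises the local depth
  -- `k` by at most one, so `k + m ≤ N` persists and the member of ℰ for the current depth is always
  -- at hand.
  Derivable : ℕ → Set₁
  Derivable m = ∀ {n G k} {Γ : List (Judg G)} {e : Fin n → Tm (replicate k nm ++ G) nm} (ν : Fin n → ℕ) (p q : Pr n) →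
    Injective′ ν → R (nameP ν p) (nameP ν q) → size p + size q < m → k + m ≤ N → State Γ k e →
    ∀ {P Q} → P ≈ trT e p → Q ≈ trT e q → G ⊢ Γ ⊢ (replicate k nm , Lbisim P Q)

  shiftF : (k : ℕ) {H : Ctx} (ξ : Sub G H) {Γ : List (Judg H)} (θ : Sub Δ (replicate k nm ++ G)) (B : Fm Δ) →
           H ⊢ Γ ⊢ (replicate k nm , subF (λ x → act (replicate k nm) ξ (θ x)) B) →
           H ⊢ Γ ⊢ subJ ξ (replicate k nm , subF θ B)
  shiftF k ξ θ B = ⊢-subst refl (cong (replicate k nm ,_) (sym (subF-sub (λ _ → refl) B)))

  module Conjuncts (m : ℕ) (rec : Derivable m) {n : ℕ} (ν : Fin n → ℕ) (ν-inj : Injective′ ν) (k : ℕ) (k≤ : k + suc m ≤ N) where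
    σ : Ctx
    σ = replicate k nm

    k≤N : k ≤ N
    k≤N = ≤-trans (m≤m+n k (suc m)) k≤

    k+m≤N : k + m ≤ N
    k+m≤N = ≤-trans (≤-trans (m≤n+m (k + m) 1) (≤-reflexive (sym (+-suc k m)))) k≤

    -- The eigenvariable w of the input clause either equals a known name or plays a fresh one.
    any-name : ∀ {G} {Γ : List (Judg G)} {e : Fin n → Tm (σ ++ G) nm} (w : Tm (σ ++ G) nm) (b c : Pr (suc n)) →
               (∀ y → R (nameP (ν ▹ y) b) (nameP (ν ▹ y) c)) → size b + size c < m → State Γ k e →
               ∀ {P Q} → P ≈ app (trM e b) w → Q ≈ app (trM e c) w → G ⊢ Γ ⊢ (σ , Lbisim P Q)
    any-name {G} {e = e} w b c r sz S₀ {P} {Q} hP hQ = loop (allFin n) S₀ (λ i → inj₁ (∈-allFin i))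
      where
      inst-≈-name : ∀ {H} (ξ : Sub G H) (a : Fin n) (b : Pr (suc n)) {P : Tm (σ ++ G) pr} → P ≈ app (trM e b) w →
                    act σ ξ w ≈ act σ ξ (e a) →
                    act σ ξ P ≈ trT (λ i → act σ ξ (e i)) (inst a b)
      inst-≈-name ξ a b hP q = ≈trans (sub-≈ _ hP) (≈trans (appc (≡⇒≈ (sub-trM (underS σ ξ) e b)) q) (inst-β _ a b))
      -- `as` lists the names not yet compared with `w`; for all others the inequality is among the
      -- hypotheses.
      loop : (as : List (Fin n)) {Γ : List (Judg G)} → State Γ k e → (∀ i → i ∈ as ⊎ Neq σ w (e i) ∈ Γ) → G ⊢ Γ ⊢ (σ , Lbisim P Q)
      loop [] {Γ} S h with fresh ν
      ... | y , y∉ = rec (ν ▹ y) b c (▹-inj ν-inj y∉) (r y) sz k+m≤N (extend S N∈)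
        (≈trans hP (trM-app e w b)) (≈trans hQ (trM-app e w c))
        where
        N∈ : ∀ i → Neq σ w (e i) ∈ Γ
        N∈ i with h i
        ... | inj₂ q = q
      loop (a ∷ as) {Γ} S h = split k w (e a) (E∈ S k k≤N)
        (eq-left λ ξ q → rec ν (inst a b) (inst a c) ν-inj
          (subst₂ R (sym (name-inst ν a b)) (sym (name-inst ν a c)) (r (ν a)))
          (subst₂ (λ x y → x + y < m) (sym (size-inst a b)) (sym (size-inst a c)) sz) k+m≤N (shift S ξ)
          (inst-≈-name ξ a b hP q) (inst-≈-name ξ a c hQ q))
        (loop as (assume _ S) h')
        where
        h' : ∀ i → i ∈ as ⊎ Neq σ w (e i) ∈ (Neq σ w (e a) ∷ Γ)
        h' i with h i
        ... | inj₁ (here refl) = inj₂ (here refl)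
        ... | inj₁ (there i∈)  = inj₁ i∈
        ... | inj₂ q           = inj₂ (there q)

    -- The variables `x` and `y` say which side moves and which one answers, so that each proof
    -- covers a conjunct of the clause and its mirror image.
    module _ (p q : Pr n) (r : R (nameP ν p) (nameP ν q)) (sz : size p + size q < suc m)
             {G : Ctx} {Γ : List (Judg G)} {e : Fin n → Tm (σ ++ G) nm} (S : State Γ k e)
             (θ : Sub (pr ∷ pr ∷ []) (σ ++ G)) (x y : Var (pr ∷ pr ∷ []) pr) (hx : θ x ≈ trT e p) (hy : θ y ≈ trT e q) where

      smaller : {a b : ℕ} → a < size p → b < size q → a + b < m
      smaller h h' = <-≤-trans (+-mono-< h h') (≤-pred sz)

      twice : {H : Ctx} {s t : Ty} (ξ : Sub (s ∷ t ∷ G) H) (r : Pr n) {P : Tm (σ ++ G) pr} → P ≈ trT e r →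
              act σ ξ (act σ wkS (act σ wkS P)) ≈
              trT (λ i → act σ ξ (act σ wkS (act σ wkS (e i)))) r
      twice ξ r h = shifted σ r ξ (shifted σ r wkS (shifted σ r wkS h))

      env₁ : (s : Ty) → Sub (s ∷ pr ∷ pr ∷ []) (σ ++ (raiseTy σ s ∷ G))
      env₁ s = wkθ σ θ ▸ raiseSub {t = s} σ vz

      env₂ : (s t : Ty) → Sub (t ∷ s ∷ pr ∷ pr ∷ []) (σ ++ (raiseTy σ t ∷ raiseTy σ s ∷ G))
      env₂ s t = wkθ σ (env₁ s) ▸ raiseSub {t = t} σ vz

      names₂ : {s t : Ty} {H : Ctx} → Sub (s ∷ t ∷ G) H → Fin n → Tm (σ ++ H) nm
      names₂ ξ i = act σ ξ (act σ wkS (act σ wkS (e i)))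

      hyps₂ : {s t : Ty} {H : Ctx} → Sub (s ∷ t ∷ G) H → List (Judg H)
      hyps₂ ξ = map (subJ ξ) (map (subJ wkS) (map (subJ wkS) Γ))

      ∀∀R° : {s t : Ty} (B : Fm (t ∷ s ∷ pr ∷ pr ∷ [])) →
             _ ⊢ map (subJ wkS) (map (subJ wkS) Γ) ⊢ (σ , subF (env₂ s t) B) → G ⊢ Γ ⊢ (σ , subF θ (∀' s (∀' t B)))
      ∀∀R° {s} {t} B d = ∀R° σ θ (∀' t B) (∀R° σ (env₁ s) B d)

      freeBody : Fm (pr ∷ ac ∷ pr ∷ pr ∷ [])
      freeBody = ∃' pr (One (var (vs (vs (vs y)))) v2 v0 ∧' Lbisim v1 v0)

      inBody outBody : Fm ((nm ⇒ pr) ∷ nm ∷ pr ∷ pr ∷ [])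
      inBody  = ∃' (nm ⇒ pr) (Onep (var (vs (vs (vs y)))) (↓T v2) v0 ∧' ∀' nm (Lbisim (v2 · v0) (v1 · v0)))
      outBody = ∃' (nm ⇒ pr) (Onep (var (vs (vs (vs y)))) (↑T v2) v0 ∧' ∇' nm (Lbisim (v2 · v0) (v1 · v0)))

      free-conjunct : G ⊢ Γ ⊢ (σ , subF θ (∀' ac (∀' pr (One (var (vs (vs x))) v1 v0 ⊃' freeBody))))
      free-conjunct = ∀∀R° (One (var (vs (vs x))) v1 v0 ⊃' freeBody)
        (⊃R (one-hyp (shift (shift S wkS) wkS) p (shifted σ p wkS (shifted σ p wkS hx))
          λ ξ s a t → shiftF k ξ (env₂ ac pr) freeBody (answer ξ s a t)))
        where
        answer : ∀ {H} (ξ : Sub _ H) {α p'} → Step p α p' → act σ ξ (env₂ ac pr (vs vz)) ≈ trA (names₂ ξ) α →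
                 act σ ξ (env₂ ac pr vz) ≈ trT (names₂ ξ) p' →
                 H ⊢ hyps₂ ξ ⊢ (σ , subF (λ x → act σ ξ (env₂ ac pr x)) freeBody)
        answer ξ {α} {p'} s a t with free r (FreeAct-actOf ν α) (Step⇒⟶ ν s)
        ... | Q' , D , r' with reflects ν q (λ _ _ → ν-inj) D
        ... | boundR {d} s' h e₁ e₂ = ⊥-elim (actOf≢bAct α d e₁)
        ... | freeR {α'} {q'} s' e₁ refl with actOf-injective ν-inj α α' e₁
        ... | refl = ∃R° σ (λ x → act σ ξ (env₂ ac pr x)) (trT (names₂ ξ) q') (One (var (vs (vs (vs y)))) v2 v0 ∧' Lbisim v1 v0)
          (∧R (Step-R s' (names₂ ξ) (twice ξ q hy) a ≈refl)
            (rec ν p' q' ν-inj r' (smaller (Step-size s) (Step-size s')) k+m≤N (shift (shift (shift S wkS) wkS) ξ) t ≈refl))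

      in-conjunct : G ⊢ Γ ⊢ (σ , subF θ (∀' nm (∀' (nm ⇒ pr) (Onep (var (vs (vs x))) (↓T v1) v0 ⊃' inBody))))
      in-conjunct = ∀∀R° (Onep (var (vs (vs x))) (↓T v1) v0 ⊃' inBody)
        (⊃R (onep-hyp (shift (shift S wkS) wkS) p (shifted σ p wkS (shifted σ p wkS hx))
          λ ξ {d} s a t → shiftF k ξ (env₂ nm (nm ⇒ pr)) inBody (answer ξ s (dirT-injective dn d a) t)))
        where
        answer : ∀ {H} (ξ : Sub _ H) {d z b} → Stepp p d z b →
                 dn ≡ d × act σ ξ (env₂ nm (nm ⇒ pr) (vs vz)) ≈ names₂ ξ z →
                 act σ ξ (env₂ nm (nm ⇒ pr) vz) ≈ trM (names₂ ξ) b →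
                 H ⊢ hyps₂ ξ ⊢ (σ , subF (λ x → act σ ξ (env₂ nm (nm ⇒ pr) x)) inBody)
        answer ξ {d} {z} {b} s (refl , a) t with fresh ν
        ... | w , w∉ with binp r (Stepp⇒⟶ ν s (fn-∉ p (λ i _ → w∉ i))) (fn-∉ p (λ i _ → w∉ i) , fn-∉ q (λ i _ → w∉ i))
        ... | Q' , D , r' with asBound dn (reflects ν q (λ _ _ → ν-inj) D)
        ... | reflectsBound {z'} {c} s' h e₁ refl with ν-inj e₁
        -- The witness `c` is given before the ∀ over names is entered. This is possible since late
        -- bisimilarity supplies one answer that works for every received name.
        ... | refl = ∃R° σ env₃ (trM (names₂ ξ) c)
            (Onep (var (vs (vs (vs y)))) (↓T v2) v0 ∧' ∀' nm (Lbisim (v2 · v0) (v1 · v0)))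
          (∧R (Stepp-R s' (names₂ ξ) (twice ξ q hy) (appc ≈refl a) ≈refl)
            (∀R° σ (env₃ ▸ trM (names₂ ξ) c) (Lbisim (v2 · v0) (v1 · v0)) (any-name (raiseSub σ vz) b c
              (λ y → subst₂ R (subst-name ν y w b (λ i _ → w∉ i)) (subst-name ν y w c (λ i _ → w∉ i)) (r' y))
              (smaller (Stepp-size s) (Stepp-size s')) (shift (shift (shift (shift S wkS) wkS) ξ) wkS)
              (appc (≈trans (sub-≈ _ t) (≡⇒≈ (sub-trM (underS σ wkS) _ b))) ≈refl)
              (appc (≡⇒≈ (sub-trM (underS σ wkS) _ c)) ≈refl))))
          where
          env₃ = λ {t} (x : Var _ t) → act σ ξ (env₂ nm (nm ⇒ pr) x)

      out-conjunct : G ⊢ Γ ⊢ (σ , subF θ (∀' nm (∀' (nm ⇒ pr) (Onep (var (vs (vs x))) (↑T v1) v0 ⊃' outBody))))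
      out-conjunct = ∀∀R° (Onep (var (vs (vs x))) (↑T v1) v0 ⊃' outBody)
        (⊃R (onep-hyp (shift (shift S wkS) wkS) p (shifted σ p wkS (shifted σ p wkS hx))
          λ ξ {d} s a t → shiftF k ξ (env₂ nm (nm ⇒ pr)) outBody (answer ξ s (dirT-injective up d a) t)))
        where
        answer : ∀ {H} (ξ : Sub _ H) {d z b} → Stepp p d z b →
                 up ≡ d × act σ ξ (env₂ nm (nm ⇒ pr) (vs vz)) ≈ names₂ ξ z →
                 act σ ξ (env₂ nm (nm ⇒ pr) vz) ≈ trM (names₂ ξ) b →
                 H ⊢ hyps₂ ξ ⊢ (σ , subF (λ x → act σ ξ (env₂ nm (nm ⇒ pr) x)) outBody)
        answer ξ {d} {z} {b} s (refl , a) t with fresh ν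
        ... | w , w∉ with boutp r (Stepp⇒⟶ ν s (fn-∉ p (λ i _ → w∉ i))) (fn-∉ p (λ i _ → w∉ i) , fn-∉ q (λ i _ → w∉ i))
        ... | Q' , D , r' with asBound up (reflects ν q (λ _ _ → ν-inj) D)
        ... | reflectsBound {z'} {c} s' h e₁ refl with ν-inj e₁
        ... | refl = ∃R° σ (λ x → act σ ξ (env₂ nm (nm ⇒ pr) x)) (trM (names₂ ξ) c)
            (Onep (var (vs (vs (vs y)))) (↑T v2) v0 ∧' ∇' nm (Lbisim (v2 · v0) (v1 · v0)))
          (∧R (Stepp-R s' (names₂ ξ) (twice ξ q hy) (appc ≈refl a) ≈refl)
            (∇R (rec (ν ▹ w) b c (▹-inj ν-inj w∉) r' (smaller (Stepp-size s) (Stepp-size s'))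
              (≤-trans (≤-reflexive (sym (+-suc k m))) k≤) (under (shift (shift (shift S wkS) wkS) ξ))
              (apply-wk t) (wkβ _))))

  derivable : (m : ℕ) → Derivable m
  derivable zero ν p q ν-inj r () k≤ S hP hQ
  derivable (suc m) {k = k} {e = e} ν p q ν-inj r sz k≤ S {P} {Q} hP hQ =
    defR lbisimClause c-lbisim env (≈F-refl _)
      (∧R (free-conjunct p q r sz S env (vs vz) vz hP hQ) (∧R (free-conjunct q p (symm r) sz′ S env vz (vs vz) hQ hP)
      (∧R (in-conjunct p q r sz S env (vs vz) vz hP hQ) (∧R (in-conjunct q p (symm r) sz′ S env vz (vs vz) hQ hP)
      (∧R (out-conjunct p q r sz S env (vs vz) vz hP hQ) (out-conjunct q p (symm r) sz′ S env vz (vs vz) hQ hP))))))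
    where
    open Conjuncts m (derivable m) ν ν-inj k k≤
    env = (emp ▸ P) ▸ Q
    sz′ = subst (_< suc m) (+-comm (size p) (size q)) sz

-- From duplicate-free lists of names to the equivalence

Unique⇒lookup-injective : {ns : List ℕ} → Unique ns → ∀ {i j} → lookup ns i ≡ lookup ns j → i ≡ j
Unique⇒lookup-injective (a∉ ∷ u) {zero}  {zero}  e = refl
Unique⇒lookup-injective (a∉ ∷ u) {zero}  {suc j} e = ⊥-elim (All.lookup a∉ (∈-lookup j) e)
Unique⇒lookup-injective (a∉ ∷ u) {suc i} {zero}  e = ⊥-elim (All.lookup a∉ (∈-lookup i) (sym e))
Unique⇒lookup-injective (a∉ ∷ u) {suc i} {suc j} e = cong suc (Unique⇒lookup-injective u e)

deepNames : (ns : List ℕ) → Sub (nmCtx ns) (replicate (length ns) nm ++ G)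
deepNames []       = emp
deepNames (a ∷ ns) = liftS (deepNames ns)

deepNames-distinct : (ns : List ℕ) → Distinct (deepNames {G} ns)
deepNames-distinct (a ∷ ns) = liftS-distinct (deepNames-distinct ns)

∇all-R : (ns : List ℕ) {B : Fm (nmCtx ns)} {Γ : List (Judg G)} →
         G ⊢ Γ ⊢ (replicate (length ns) nm , subF (deepNames ns) B) → G ⊢ Γ ⊢ ([] , subF emp (∇all (nmCtx ns) B))
∇all-R []       d = d
∇all-R (a ∷ ns) {B} d = ∇all-R ns {∇' nm B} (∇R d)

deepNames-sub : (ns : List ℕ) (ξ : Sub [] G) {t : Ty} (x : Var (nmCtx ns) t) →
                act (replicate (length ns) nm) ξ (deepNames ns x) ≡ deepNames ns x
deepNames-sub (a ∷ ns) ξ vz     = refl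
deepNames-sub (a ∷ ns) ξ (vs x) = trans (sub-wk (underS (replicate (length ns) nm) ξ) (deepNames ns x)) (cong (ren vs) (deepNames-sub ns ξ x))

module Named (ns : List ℕ) (ν-inj : Injective′ (lookup ns)) where
  ν : Fin (length ns) → ℕ
  ν = lookup ns

  e₀ : Fin (length ns) → Tm (nmCtx ns) nm
  e₀ i = var (varAt ns i)

  Sequent : List ℕ → Tm (nmCtx ns) pr → Tm (nmCtx ns) pr → Set₁
  Sequent 𝒳 t u = [] ⊢ Ehyps 𝒳 ⊢ ([] , ∇all (nmCtx ns) (Lbisim t u))

  translation : (p : Pr (length ns)) → ⟦ nameP ν p ⟧ ns ≡ just (trT e₀ p)
  translation = tr-trT {E = topEnv ns} {λ i → fr (ν i)} (λ i → cong (Maybe.map var) (lookupName-at ns ν-inj i))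

  sequent⇒related : (𝒳 : List ℕ) (p q : Pr (length ns)) → Sequent 𝒳 (trT e₀ p) (trT e₀ q) → Related (nameP ν p) (nameP ν q)
  sequent⇒related 𝒳 p q d with ∇all-Sat ns (sound d emp (Ehyps-true 𝒳))
  ... | σ , θ' , distinct , b = related ν p q σ (λ i → θ' (varAt ns i)) refl refl (λ _ _ → ν-inj)
    (λ h → varAt-injective ns (distinct h))
    (Bis-≈ (≡⇒≈ (sub-trT (λ _ → refl) p)) (≡⇒≈ (sub-trT (λ _ → refl) q)) b)

  module _ (R : Proc 0 → Proc 0 → Set) (R-bisim : IsLateBisim R) (N : ℕ) where
    open Completeness R R-bisim N

    initial : State (Ehyps (upTo (suc N))) (length ns) (λ i → deepNames ns (varAt ns i))
    initial = state
      -- The free names are distinct ∇-bound variables, which substitutions for global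
      -- eigenvariables leave fixed, so no instance merges two of them.
      (λ ξ {i} {j} i≢j h C → ⊥-elim (i≢j (varAt-injective ns (deepNames-distinct ns
        (≈trans (≡⇒≈ (sym (deepNames-sub ns ξ (varAt ns i)))) (≈trans h (≡⇒≈ (deepNames-sub ns ξ (varAt ns j)))))))))
      (λ j j≤ → subst (_∈ Ehyps (upTo (suc N))) (cong ([] ,_) (sym (subF-id (λ ()) (Eform j))))
        (∈-map⁺ (λ k → [] , Eform k) (∈-upTo⁺ (s≤s j≤))))

    related⇒sequent : (p q : Pr (length ns)) → R (nameP ν p) (nameP ν q) → length ns + suc (size p + size q) ≤ N →
                      Sequent (upTo (suc N)) (trT e₀ p) (trT e₀ q)
    related⇒sequent p q r N≥ = ⊢-subst refl (cong ([] ,_) (subF-id (λ ()) (∇all (nmCtx ns) (Lbisim (trT e₀ p) (trT e₀ q)))))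
      (∇all-R ns {Lbisim (trT e₀ p) (trT e₀ q)} (derivable (suc (size p + size q)) ν p q ν-inj r ≤-refl N≥ initial
        (≡⇒≈ (sub-trT (λ _ → refl) p)) (≡⇒≈ (sub-trT (λ _ → refl) q))))

  equivalence : (p q : Pr (length ns)) →
    (nameP ν p ∼l nameP ν q) ⇔
    (Σ (List ℕ) λ 𝒳 → Σ (Tm (nmCtx ns) pr) λ t → Σ (Tm (nmCtx ns) pr) λ u →
      (⟦ nameP ν p ⟧ ns ≡ just t) × (⟦ nameP ν q ⟧ ns ≡ just u) × Sequent 𝒳 t u)
  equivalence p q = mk⇔
    (λ { (R , R-bisim , r) → upTo (suc N) , trT e₀ p , trT e₀ q , translation p , translation q ,
                             related⇒sequent R R-bisim N p q r ≤-refl })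
    (λ { (𝒳 , t , u , et , eu , d) → Related , related-bisim , sequent⇒related 𝒳 p q
      (subst₂ (Sequent 𝒳) (just-injective (trans (sym et) (translation p))) (just-injective (trans (sym eu) (translation q))) d) })
    where
    -- The initial local depth plus the initial measure; `suc` makes the bound on the size strict.
    N = length ns + suc (size p + size q)

theorem5p5 : (P Q : Proc 0) →
    (P ∼l Q) ⇔
    (Σ (List ℕ) λ 𝒳 →
    Σ (Tm (nmCtx (fnPQ P Q)) pr) λ tP →
    Σ (Tm (nmCtx (fnPQ P Q)) pr) λ tQ →
    (⟦ P ⟧ fnPQ P Q ≡ just tP) × (⟦ Q ⟧ fnPQ P Q ≡ just tQ) ×
    ([] ⊢ Ehyps 𝒳 ⊢ ([] , ∇all (nmCtx (fnPQ P Q)) (Lbisim tP tQ))))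
theorem5p5 P Q = subst₂ (Statement (fnPQ P Q)) (proj₂ scopedP) (proj₂ scopedQ)
  (Named.equivalence (fnPQ P Q) ν-inj (proj₁ scopedP) (proj₁ scopedQ))
  where
  Statement : List ℕ → Proc 0 → Proc 0 → Set₁
  Statement ns P Q =
    (P ∼l Q) ⇔
    (Σ (List ℕ) λ 𝒳 → Σ (Tm (nmCtx ns) pr) λ tP → Σ (Tm (nmCtx ns) pr) λ tQ →
      (⟦ P ⟧ ns ≡ just tP) × (⟦ Q ⟧ ns ≡ just tQ) × ([] ⊢ Ehyps 𝒳 ⊢ ([] , ∇all (nmCtx ns) (Lbisim tP tQ))))

  ν-inj : Injective′ (lookup (fnPQ P Q))
  ν-inj = Unique⇒lookup-injective (deduplicate-! (fn P ++ fn Q))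

  covers : ∀ {as} → (∀ {a} → a ∈ as → a ∈ fn P ++ fn Q) → Covers (λ i → fr {0} (lookup (fnPQ P Q) i)) as
  covers h a∈ = let a∈ns = ∈-deduplicate⁺ _≟_ (h a∈) in Any.index a∈ns , cong fr (sym (lookup-index a∈ns))

  scopedP : ∃ λ p → nameP (lookup (fnPQ P Q)) p ≡ P
  scopedP = scope P (λ ()) (covers ∈-++⁺ˡ)

  scopedQ : ∃ λ q → nameP (lookup (fnPQ P Q)) q ≡ Q
  scopedQ = scope Q (λ ()) (covers (∈-++⁺ʳ (fn P)))
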